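{- Let $F$ be a number field Galois over $\mathbb Q$, $M$ an even integer divisible by the discriminant of $F$, $n\ge1$, $i\mapsto\sigma_i\in\mathrm{Gal}(F/\mathbb Q)$ ($i=1,\dots,n$, $\sigma_1=\mathrm{id}$) a vertical gauge, $p$ a prime not dividing $M$, $\mathfrak P$ a prime of $\mathcal O_F$ dividing $p$, and $q=(q_{ij})\in GL_n(\mathcal O_F[1/M])$ with $q^t=q$. Assume $q$ is vertical gauge invariant, i.e. $\sigma_i(q)=q$ for $i=1,\dots,n$. Let $(\varphi_{ij})$ be the curvature of the vertical Levi-Civita connection attached to $q$ at $\mathfrak P$, $\Phi_{ij}:=\varphi_{ij}(x)$, and let $R_{ijmk}$ be the $(m,k)$ entry of the matrix $x^{(p^2)t}q^{(p^2)}\Phi_{ij}$. With $\delta=\delta^1$ let $$C=(C_{jk}):=-x^{(p)t}\cdot\delta q\cdot x^{(p)}+\frac1p\left\{(x^tqx)^{(p)}-x^{(p)t}q^{(p)}x^{(p)}\right\}.$$ Then for all $i,j,m,k$ the following congruences hold in $\mathcal O(\widehat{G^1})$: $$R_{ijmk}\equiv\tfrac12(C_{ik}+C_{jm}-C_{jk}-C_{im})^p\quad\text{mod }p,$$ $$R_{ijmk}\equiv\tfrac12(\delta q_{jk}+\delta q_{im}-\delta q_{ik}-\delta q_{jm})^p\quad\text{mod }(p,x-1),$$ where $(p,x-1)$ is the ideal generated by $p$, the $x_{ii}-1$, and the $x_{ij}$ for $i\ne j$.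
   Context: For a matrix $a=(a_{ij})$, $a^t$ is the transpose, $a^{(p)}=(a_{ij}^p)$ and $a^{(p^2)}=(a_{ij}^{p^2})$; set maps between rings are applied to matrices entrywise. A Frobenius lift on a ring $A$ is a ring endomorphism reducing mod $p$ to the $p$-power Frobenius of $A/pA$. On a $p$-torsion free ring a $p$-derivation $\delta$ is the same as a Frobenius lift $\phi$, via $\phi(a)=a^p+p\,\delta a$ ("attached"). $\widehat{\ }$ denotes $p$-adic completion. Set $\mathfrak P_i=\sigma_i\mathfrak P$ and let $R_i=\widehat{\mathcal O_{\mathfrak P_i}}$ be the $p$-adic completion of the localization of $\mathcal O_F$ at $\mathfrak P_i$ (a complete discrete valuation ring with maximal ideal generated by the odd prime $p$). It has a unique Frobenius lift $\phi^i$, hence a unique $p$-derivation $\delta^i$. Let $x$ be an $n\times n$ matrix of indeterminates, $G^i=\mathrm{Spec}\,R_i[x,\det(x)^{ -1}]$, $\mathcal O(\widehat{G^i})=R_i[x,\det(x)^{ -1}]^{\widehat{\ }}$. The automorphism $\sigma_i$ induces an isomorphism $R_1\to R_i$, extended to $\sigma_i:\mathcal O(\widehat{G^1})\to\mathcal O(\widehat{G^i})$ by $\sigma_i(x)=x$. A vertical connection at $\mathfrak P$ is an $n$-tuple $(\delta^1,\dots,\delta^n)$ where $\delta^i$ is a $p$-derivation on $\mathcal O(\widehat{G^i})$ extending that of $R_i$ (same notation), with attached Frobenius lift $\phi^i$. It is metric with respect to $q$ if for every $i$, $\phi^i\circ\mathcal H_q=\mathcal H_q\circ\phi^i_0$,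 where $\mathcal H_q$ is the (continuous) $R_i$-algebra endomorphism of $\mathcal O(\widehat{G^i})$ with $x\mapsto x^tqx$ and $\phi_0^i$ is the Frobenius lift extending that of $R_i$ with $\phi_0^i(x)=x^{(p)}$. With $\gamma_i=(\gamma_{ijk})_{j,k}:=(\delta^ix)^t\cdot\phi^i(q)\cdot x^{(p)}$, it is torsion free relative to $q$ if $\sigma_i^{ -1}\gamma_{ijk}=\sigma_j^{ -1}\gamma_{jik}$ for all $i,j,k$. The vertical Levi-Civita connection attached to $q$ at $\mathfrak P$ is the unique (it exists) vertical connection that is metric with respect to $q$ and torsion free relative to $q$. Its curvature is the family of additive maps $\varphi_{ij}:\mathcal O(\widehat{G^1})\to\mathcal O(\widehat{G^1})$, $$\varphi_{ij}=\frac1p\{\sigma_i^{ -1}\phi^i\sigma_i\sigma_j^{ -1}\phi^j\sigma_j-\sigma_j^{ -1}\phi^j\sigma_j\sigma_i^{ -1}\phi^i\sigma_i\}$$ (composition of maps, rightmost first). -}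

module Defs where

open import Algebra.Bundles using (CommutativeRing)
open import Algebra.Morphism.Bundles using (RingHomomorphism)
open import Algebra.Morphism.Structures using (IsRingHomomorphism)
open import Data.Empty using (⊥; ⊥-elim)
open import Data.Fin.Base using (Fin; zero; suc; toℕ; punchIn)
open import Data.Integer.Base as ℤ using (ℤ; +_; -[1+_])
import Data.Integer.Divisibility as ℤ
open import Data.Nat.Base as ℕ using (ℕ; zero; suc)
import Data.Nat.Properties as ℕ
import Data.Nat.Divisibility as ℕ
open import Data.Nat.Coprimality using (Coprime; coprime-Bézout)
import Data.Nat.GCD as GCD
open import Data.Nat.Primality using (Prime; prime⇒irreducible)
open import Data.Product.Base using (Σ; Σ-syntax; ∃; ∃-syntax; _×_; _,_; proj₁; proj₂)
open import Data.Rational.Base using (ℚ)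
import Data.Rational.Properties as ℚ
open import Data.Sum.Base using (_⊎_; inj₁; inj₂)
open import Level using (Level; _⊔_) renaming (suc to lsuc)
open import Relation.Binary.PropositionalEquality.Core as ≡ using (_≡_)
open import Relation.Nullary using (¬_)

import Algebra.Properties.AbelianGroup as AbelianGroupProperties
import Algebra.Properties.CommutativeMonoid.Sum as Sum
import Algebra.Properties.Group as GroupProperties
import Algebra.Properties.Ring as RingProperties
import Algebra.Properties.Semiring.Exp as Exp
import Algebra.Properties.Semiring.Mult as Mult
import Algebra.Solver.Ring.NaturalCoefficients.Default as NatSolver
import Relation.Binary.Reasoning.Setoid as SetoidReasoning

private
  variable
    a b c ℓ ℓ₁ ℓ₂ ℓ₃ s t : Level

∣_∣ᴿ : CommutativeRing c ℓ → Set c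
∣ A ∣ᴿ = CommutativeRing.Carrier A

Hom : CommutativeRing a ℓ₁ → CommutativeRing b ℓ₂ → Set (a ⊔ b ⊔ ℓ₁ ⊔ ℓ₂)
Hom A B = RingHomomorphism (CommutativeRing.rawRing A) (CommutativeRing.rawRing B)

open RingHomomorphism public using (⟦_⟧)

module RingOps (A : CommutativeRing c ℓ) where
  open CommutativeRing A public hiding (zero)
  open Sum +-commutativeMonoid public using (sum; sum-cong-≋)
  open Exp semiring public using (_^_; ^-congˡ; ^-homo-*)
  open Mult semiring public
    using (×-congʳ; ×-homo-+; ×-assocˡ; ×1-homo-*; ×-assoc-*; ×-comm-*)
    renaming (_×_ to _·_)

  infixr 8 _⋆_

  _⋆_ : ℤ → Carrier → Carrier
  (+ n)    ⋆ x = n · x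
  -[1+ n ] ⋆ x = - (suc n · x)

  infix 4 _≡_[mod_]

  _≡_[mod_] : Carrier → Carrier → ℕ → Set (c ⊔ ℓ)
  x ≡ y [mod m ] = ∃[ z ] x - y ≈ m · z

  Matrix : ℕ → Set c
  Matrix n = Fin n → Fin n → Carrier

  infixl 7 _⊗_
  infix  8 _ᵗ _⁽_⁾
  infix  4 _≋_

  _≋_ : ∀ {n} → Matrix n → Matrix n → Set ℓ
  X ≋ Y = ∀ i j → X i j ≈ Y i j

  _⊗_ : ∀ {n} → Matrix n → Matrix n → Matrix n
  (X ⊗ Y) i j = sum λ k → X i k * Y k j

  _ᵗ : ∀ {n} → Matrix n → Matrix n
  (X ᵗ) i j = X j i

  _⁽_⁾ : ∀ {n} → Matrix n → ℕ → Matrix n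
  (X ⁽ e ⁾) i j = X i j ^ e

  𝟙 : ∀ {n} → Matrix n
  𝟙 zero    zero    = 1#
  𝟙 zero    (suc _) = 0#
  𝟙 (suc _) zero    = 0#
  𝟙 (suc i) (suc j) = 𝟙 i j

  IsInvertible : ∀ {n} → Matrix n → Set (c ⊔ ℓ)
  IsInvertible X = ∃[ Y ] (X ⊗ Y ≋ 𝟙) × (Y ⊗ X ≋ 𝟙)

  sign : ∀ {n} → Fin n → Carrier
  sign j = (- 1#) ^ toℕ j

  minor : ∀ {n} → Matrix (suc n) → Fin (suc n) → Matrix n
  minor X j k l = X (suc k) (punchIn j l)

  det : ∀ {n} → Matrix n → Carrier
  det {zero}  X = 1#
  det {suc n} X = sum λ j → (sign j * X zero j) * det (minor X j)

mapᴹ : {A : Set a} {B : Set b} {n : ℕ} → (A → B) → (Fin n → Fin n → A) → Fin n → Fin n → B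
mapᴹ f X i j = f (X i j)

module _ (A : CommutativeRing a ℓ₁) (B : CommutativeRing b ℓ₂) where
  private
    module A = RingOps A
    module B = RingOps B
    open GroupProperties B.+-group using (identityʳ-unique; inverseʳ-unique)

  mkIsHom : (f : A.Carrier → B.Carrier) →
            (∀ {x y} → x A.≈ y → f x B.≈ f y) →
            (∀ x y → f (x A.+ y) B.≈ f x B.+ f y) →
            (∀ x y → f (x A.* y) B.≈ f x B.* f y) →
            f A.1# B.≈ B.1# →
            IsRingHomomorphism A.rawRing B.rawRing f
  mkIsHom f f-cong f-+ f-* f-1 = record
    { isSemiringHomomorphism = record
      { isNearSemiringHomomorphism = record
        { +-isMonoidHomomorphism = record
          { isMagmaHomomorphism = record
            { isRelHomomorphism = record { cong = f-cong }
            ; homo = f-+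
            }
          ; ε-homo = f-0
          }
        ; *-homo = f-*
        }
      ; 1#-homo = f-1
      }
    ; -‿homo = λ x → inverseʳ-unique (f x) (f (A.- x))
        (B.trans (B.sym (f-+ x (A.- x))) (B.trans (f-cong (A.-‿inverseʳ x)) f-0))
    }
    where
    f-0 : f A.0# B.≈ B.0#
    f-0 = identityʳ-unique (f A.0#) (f A.0#)
      (B.trans (B.sym (f-+ A.0# A.0#)) (f-cong (A.+-identityʳ A.0#)))

  mkHom : (f : A.Carrier → B.Carrier) →
          (∀ {x y} → x A.≈ y → f x B.≈ f y) →
          (∀ x y → f (x A.+ y) B.≈ f x B.+ f y) →
          (∀ x y → f (x A.* y) B.≈ f x B.* f y) →
          f A.1# B.≈ B.1# →
          Hom A B
  mkHom f f-cong f-+ f-* f-1 = record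
    { ⟦_⟧ = f ; isRingHomomorphism = mkIsHom f f-cong f-+ f-* f-1 }

module HomProperties
  (A : CommutativeRing a ℓ₁) (B : CommutativeRing b ℓ₂) (f : Hom A B) where
  private
    module A = RingOps A
    module B = RingOps B
  open RingHomomorphism f public
    using (⟦⟧-cong; +-homo; *-homo; 1#-homo; 0#-homo; -‿homo)

  sum-homo : ∀ {n} (v : Fin n → A.Carrier) → ⟦ f ⟧ (A.sum v) B.≈ B.sum (λ i → ⟦ f ⟧ (v i))
  sum-homo {zero}  v = 0#-homo
  sum-homo {suc n} v =
    B.trans (+-homo _ _) (B.+-congˡ (sum-homo (λ i → v (suc i))))

  ·-homo : ∀ n x → ⟦ f ⟧ (n A.· x) B.≈ n B.· ⟦ f ⟧ x
  ·-homo zero    x = 0#-homo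
  ·-homo (suc n) x = B.trans (+-homo _ _) (B.+-congˡ (·-homo n x))

  ⋆-homo : ∀ k x → ⟦ f ⟧ (k A.⋆ x) B.≈ k B.⋆ ⟦ f ⟧ x
  ⋆-homo (+ n)    x = ·-homo n x
  ⋆-homo -[1+ n ] x = B.trans (-‿homo _) (B.-‿cong (·-homo (suc n) x))

  ^-homo : ∀ x n → ⟦ f ⟧ (x A.^ n) B.≈ ⟦ f ⟧ x B.^ n
  ^-homo x zero    = 1#-homo
  ^-homo x (suc n) = B.trans (*-homo _ _) (B.*-congˡ (^-homo x n))

  sign-homo : ∀ {n} (j : Fin n) → ⟦ f ⟧ (A.sign j) B.≈ B.sign j
  sign-homo j = B.trans (^-homo (A.- A.1#) (toℕ j))
    (B.^-congˡ (toℕ j) (B.trans (-‿homo A.1#) (B.-‿cong 1#-homo)))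

  det-homo : ∀ {n} (X : A.Matrix n) → ⟦ f ⟧ (A.det X) B.≈ B.det (mapᴹ ⟦ f ⟧ X)
  det-homo {zero}  X = 1#-homo
  det-homo {suc n} X = B.trans (sum-homo term) (B.sum-cong-≋ term-homo)
    where
    term : Fin (suc n) → A.Carrier
    term j = (A.sign j A.* X zero j) A.* A.det (A.minor X j)
    term-homo : ∀ j → ⟦ f ⟧ (term j) B.≈
                (B.sign j B.* ⟦ f ⟧ (X zero j)) B.* B.det (B.minor (mapᴹ ⟦ f ⟧ X) j)
    term-homo j = B.trans (*-homo (A.sign j A.* X zero j) (A.det (A.minor X j)))
      (B.*-cong (B.trans (*-homo (A.sign j) (X zero j)) (B.*-congʳ (sign-homo j)))
                (det-homo (A.minor X j)))

idHom : (A : CommutativeRing a ℓ₁) → Hom A A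
idHom A = mkHom A A (λ x → x) (λ e → e) (λ _ _ → refl) (λ _ _ → refl) refl
  where open CommutativeRing A

-- The rings Localization, Completion and Polynomial are opaque only to keep conversion
-- checking cheap once they are stacked; unfold them to compute.

record MulSubset (A : CommutativeRing c ℓ) (s : Level) : Set (c ⊔ ℓ ⊔ lsuc s) where
  open CommutativeRing A
  field
    Mem   : Carrier → Set s
    1-mem : Mem 1#
    *-mem : ∀ {x y} → Mem x → Mem y → Mem (x * y)

powers : (A : CommutativeRing c ℓ) → ∣ A ∣ᴿ → MulSubset A ℓ
powers A x = record
  { Mem   = λ y → ∃[ k ] y ≈ x ^ k
  ; 1-mem = 0 , refl
  ; *-mem = λ { (k , y≈) (l , z≈) → k ℕ.+ l , trans (*-cong y≈ z≈) (sym (^-homo-* x k l)) }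
  }
  where open RingOps A

record Fraction (A : CommutativeRing c ℓ) (S : MulSubset A s) : Set (c ⊔ s) where
  constructor frac
  field
    num     : ∣ A ∣ᴿ
    den     : ∣ A ∣ᴿ
    den-mem : MulSubset.Mem S den

record FractionEq (A : CommutativeRing c ℓ) (S : MulSubset A s)
                  (x y : Fraction A S) : Set (c ⊔ ℓ ⊔ s) where
  constructor cross
  open CommutativeRing A
  open Fraction
  field
    factor     : Carrier
    factor-mem : MulSubset.Mem S factor
    equation   : factor * (num x * den y) ≈ factor * (num y * den x)

module _ (A : CommutativeRing c ℓ) (S : MulSubset A s) where
  private
    module S = MulSubset S
    open RingOps A
    open Fraction
    open NatSolver commutativeSemiring using (solve; _:+_; _:*_; _:=_; con)
    open RingProperties ring using (-‿distribˡ-*)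

    _~_ : Fraction A S → Fraction A S → Set (c ⊔ ℓ ⊔ s)
    _~_ = FractionEq A S

    equal : ∀ {x y} → num x * den y ≈ num y * den x → x ~ y
    equal e = cross 1# S.1-mem (*-congˡ e)

    _+ᶠ_ _*ᶠ_ : Fraction A S → Fraction A S → Fraction A S
    frac x s s∈ +ᶠ frac y t t∈ = frac (x * t + y * s) (s * t) (S.*-mem s∈ t∈)
    frac x s s∈ *ᶠ frac y t t∈ = frac (x * y) (s * t) (S.*-mem s∈ t∈)

    -ᶠ_ : Fraction A S → Fraction A S
    -ᶠ frac x s s∈ = frac (- x) s s∈

    0ᶠ 1ᶠ : Fraction A S
    0ᶠ = frac 0# 1# S.1-mem
    1ᶠ = frac 1# 1# S.1-mem

    ~-trans : ∀ {x y z} → x ~ y → y ~ z → x ~ z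
    ~-trans {frac x s _} {frac y t t∈} {frac z r _} (cross u u∈ e) (cross v v∈ f) =
      cross ((u * v) * t) (S.*-mem (S.*-mem u∈ v∈) t∈) (begin
        (u * v) * t * (x * r)   ≈⟨ solve 5 (λ u v t x r → (u :* v) :* t :* (x :* r) := (v :* r) :* (u :* (x :* t))) refl u v t x r ⟩
        (v * r) * (u * (x * t)) ≈⟨ *-congˡ e ⟩
        (v * r) * (u * (y * s)) ≈⟨ solve 5 (λ u v r y s → (v :* r) :* (u :* (y :* s)) := (u :* s) :* (v :* (y :* r))) refl u v r y s ⟩
        (u * s) * (v * (y * r)) ≈⟨ *-congˡ f ⟩
        (u * s) * (v * (z * t)) ≈⟨ solve 5 (λ u v t z s → (u :* s) :* (v :* (z :* t)) := (u :* v) :* t :* (z :* s)) refl u v t z s ⟩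
        (u * v) * t * (z * s)   ∎)
      where open SetoidReasoning setoid

    +ᶠ-cong : ∀ {x x′ y y′} → x ~ x′ → y ~ y′ → (x +ᶠ y) ~ (x′ +ᶠ y′)
    +ᶠ-cong {frac x s _} {frac x′ s′ _} {frac y t _} {frac y′ t′ _} (cross u u∈ e) (cross v v∈ f) =
      cross (u * v) (S.*-mem u∈ v∈) (begin
        (u * v) * ((x * t + y * s) * (s′ * t′))
          ≈⟨ solve 8 (λ u v x t y s s′ t′ → (u :* v) :* ((x :* t :+ y :* s) :* (s′ :* t′)) :=
               (v :* t :* t′) :* (u :* (x :* s′)) :+ (u :* s :* s′) :* (v :* (y :* t′))) refl u v x t y s s′ t′ ⟩
        (v * t * t′) * (u * (x * s′)) + (u * s * s′) * (v * (y * t′))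
          ≈⟨ +-cong (*-congˡ e) (*-congˡ f) ⟩
        (v * t * t′) * (u * (x′ * s)) + (u * s * s′) * (v * (y′ * t))
          ≈⟨ solve 8 (λ u v x′ t y′ s s′ t′ →
               (v :* t :* t′) :* (u :* (x′ :* s)) :+ (u :* s :* s′) :* (v :* (y′ :* t)) :=
               (u :* v) :* ((x′ :* t′ :+ y′ :* s′) :* (s :* t))) refl u v x′ t y′ s s′ t′ ⟩
        (u * v) * ((x′ * t′ + y′ * s′) * (s * t)) ∎)
      where open SetoidReasoning setoid

    *ᶠ-cong : ∀ {x x′ y y′} → x ~ x′ → y ~ y′ → (x *ᶠ y) ~ (x′ *ᶠ y′)
    *ᶠ-cong {frac x s _} {frac x′ s′ _} {frac y t _} {frac y′ t′ _} (cross u u∈ e) (cross v v∈ f) =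
      cross (u * v) (S.*-mem u∈ v∈) (begin
        (u * v) * ((x * y) * (s′ * t′))
          ≈⟨ solve 6 (λ u v x y s′ t′ → (u :* v) :* ((x :* y) :* (s′ :* t′)) :=
               (u :* (x :* s′)) :* (v :* (y :* t′))) refl u v x y s′ t′ ⟩
        (u * (x * s′)) * (v * (y * t′)) ≈⟨ *-cong e f ⟩
        (u * (x′ * s)) * (v * (y′ * t))
          ≈⟨ solve 6 (λ u v x′ y′ s t → (u :* (x′ :* s)) :* (v :* (y′ :* t)) :=
               (u :* v) :* ((x′ :* y′) :* (s :* t))) refl u v x′ y′ s t ⟩
        (u * v) * ((x′ * y′) * (s * t)) ∎)
      where open SetoidReasoning setoid

    -ᶠ-cong : ∀ {x y} → x ~ y → (-ᶠ x) ~ (-ᶠ y)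
    -ᶠ-cong {frac x s _} {frac y t _} (cross u u∈ e) = cross u u∈ (begin
      u * (- x * t)   ≈⟨ neg x t ⟩
      - (u * (x * t)) ≈⟨ -‿cong e ⟩
      - (u * (y * s)) ≈⟨ neg y s ⟨
      u * (- y * s)   ∎)
      where
      open SetoidReasoning setoid
      open RingProperties ring using (-‿distribʳ-*)
      neg : ∀ z r → u * (- z * r) ≈ - (u * (z * r))
      neg z r = trans (*-congˡ (sym (-‿distribˡ-* z r))) (sym (-‿distribʳ-* u (z * r)))

  opaque
    Localization : CommutativeRing (c ⊔ s) (c ⊔ ℓ ⊔ s)
    Localization = record
      { Carrier = Fraction A S
      ; _≈_ = _~_
      ; _+_ = _+ᶠ_
      ; _*_ = _*ᶠ_
      ; -_  = -ᶠ_
      ; 0#  = 0ᶠ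
      ; 1#  = 1ᶠ
      ; isCommutativeRing = record
        { isRing = record
          { +-isAbelianGroup = record
            { isGroup = record
              { isMonoid = record
                { isSemigroup = record
                  { isMagma = record
                    { isEquivalence = record
                      { refl  = equal refl
                      ; sym   = λ { (cross u u∈ e) → cross u u∈ (sym e) }
                      ; trans = λ {x} {y} {z} → ~-trans {x} {y} {z}
                      }
                    ; ∙-cong = λ {x} {x′} {y} {y′} → +ᶠ-cong {x} {x′} {y} {y′}
                    }
                  ; assoc = λ { (frac x s _) (frac y t _) (frac z r _) → equal
                      (solve 6 (λ x s y t z r →
                        ((x :* t :+ y :* s) :* r :+ z :* (s :* t)) :* (s :* (t :* r)) :=
                        (x :* (t :* r) :+ (y :* r :+ z :* t) :* s) :* ((s :* t) :* r)) refl x s y t z r) }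
                  }
                ; identity =
                    (λ { (frac x s _) → equal
                      (solve 2 (λ x s → (con 0 :* s :+ x :* con 1) :* s := x :* (con 1 :* s)) refl x s) })
                  , (λ { (frac x s _) → equal
                      (solve 2 (λ x s → (x :* con 1 :+ con 0 :* s) :* s := x :* (s :* con 1)) refl x s) })
                }
              ; inverse =
                  (λ { (frac x s _) → equal (cancel (- x) x s (-‿inverseˡ x)) })
                , (λ { (frac x s _) → equal (cancel x (- x) s (-‿inverseʳ x)) })
              ; ⁻¹-cong = λ {x} {y} → -ᶠ-cong {x} {y}
              }
            ; comm = λ { (frac x s _) (frac y t _) → equal
                (solve 4 (λ x s y t → (x :* t :+ y :* s) :* (t :* s) :=
                  (y :* s :+ x :* t) :* (s :* t)) refl x s y t) }
            }
          ; *-cong = λ {x} {x′} {y} {y′} → *ᶠ-cong {x} {x′} {y} {y′}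
          ; *-assoc = λ { (frac x s _) (frac y t _) (frac z r _) → equal
              (solve 6 (λ x s y t z r → ((x :* y) :* z) :* (s :* (t :* r)) :=
                (x :* (y :* z)) :* ((s :* t) :* r)) refl x s y t z r) }
          ; *-identity =
              (λ { (frac x s _) → equal
                (solve 2 (λ x s → (con 1 :* x) :* s := x :* (con 1 :* s)) refl x s) })
            , (λ { (frac x s _) → equal
                (solve 2 (λ x s → (x :* con 1) :* s := x :* (s :* con 1)) refl x s) })
          ; distrib =
              (λ { (frac x s _) (frac y t _) (frac z r _) → equal
                (solve 6 (λ x s y t z r →
                  (x :* (y :* r :+ z :* t)) :* ((s :* t) :* (s :* r)) :=
                  ((x :* y) :* (s :* r) :+ (x :* z) :* (s :* t)) :* (s :* (t :* r))) refl x s y t z r) })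
            , (λ { (frac x s _) (frac y t _) (frac z r _) → equal
                (solve 6 (λ x s y t z r →
                  ((y :* r :+ z :* t) :* x) :* ((t :* s) :* (r :* s)) :=
                  ((y :* x) :* (r :* s) :+ (z :* x) :* (t :* s)) :* ((t :* r) :* s)) refl x s y t z r) })
          }
        ; *-comm = λ { (frac x s _) (frac y t _) → equal
            (solve 4 (λ x s y t → (x :* y) :* (t :* s) := (y :* x) :* (s :* t)) refl x s y t) }
        }
      }
      where
      cancel : ∀ x y s → x + y ≈ 0# → (x * s + y * s) * 1# ≈ 0# * (s * s)
      cancel x y s e = begin
        (x * s + y * s) * 1# ≈⟨ *-identityʳ _ ⟩
        x * s + y * s        ≈⟨ distribʳ s x y ⟨
        (x + y) * s          ≈⟨ *-congʳ e ⟩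
        0# * s               ≈⟨ zeroˡ s ⟩
        0#                   ≈⟨ zeroˡ (s * s) ⟨
        0# * (s * s)         ∎
        where open SetoidReasoning setoid

    fraction : (x y : ∣ A ∣ᴿ) → S.Mem y → ∣ Localization ∣ᴿ
    fraction = frac

    toLocalization : Hom A Localization
    toLocalization = mkHom A Localization (λ x → frac x 1# S.1-mem)
      (λ e → equal (*-congʳ e))
      (λ x y → equal (solve 2 (λ x y → (x :+ y) :* (con 1 :* con 1) :=
        (x :* con 1 :+ y :* con 1) :* con 1) refl x y))
      (λ x y → equal (solve 2 (λ x y → (x :* y) :* (con 1 :* con 1) := (x :* y) :* con 1) refl x y))
      (equal refl)

module _ (A : CommutativeRing a ℓ₁) (B : CommutativeRing b ℓ₂)
         (S : MulSubset A s) (T : MulSubset B t) (f : Hom A B)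
         (S⇒T : ∀ {x} → MulSubset.Mem S x → MulSubset.Mem T (⟦ f ⟧ x)) where
  private
    module A = RingOps A
    module B = RingOps B
    module T = MulSubset T
    open HomProperties A B f

    eq : ∀ {x y z w} → x B.≈ z → y B.≈ w → B.1# B.* (x B.* w) B.≈ B.1# B.* (z B.* y)
    eq x≈z y≈w = B.*-congˡ (B.*-cong x≈z (B.sym y≈w))

  opaque
    unfolding Localization

    mapLocalization : Hom (Localization A S) (Localization B T)
    mapLocalization = mkHom (Localization A S) (Localization B T)
      (λ { (frac x s s∈) → frac (⟦ f ⟧ x) (⟦ f ⟧ s) (S⇒T s∈) })
      (λ { {frac x s _} {frac y t _} (cross u u∈ e) → cross (⟦ f ⟧ u) (S⇒T u∈)
           (B.trans (B.*-congˡ (B.sym (*-homo x t)))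
           (B.trans (B.sym (*-homo u (x A.* t)))
           (B.trans (⟦⟧-cong e)
           (B.trans (*-homo u (y A.* s)) (B.*-congˡ (*-homo y s)))))) })
      (λ { (frac x s _) (frac y t _) → cross B.1# T.1-mem (eq
           (B.trans (+-homo _ _) (B.+-cong (*-homo x t) (*-homo y s))) (*-homo s t)) })
      (λ { (frac x s _) (frac y t _) → cross B.1# T.1-mem (eq (*-homo x y) (*-homo s t)) })
      (cross B.1# T.1-mem (eq 1#-homo 1#-homo))

module CongruenceProperties (A : CommutativeRing c ℓ) (m : ℕ) where
  private
    open RingOps A
    open RingProperties ring using (-‿distribʳ-*)
    open AbelianGroupProperties +-abelianGroup using (⁻¹-∙-comm; ⁻¹-involutive; ⁻¹-anti-homo‿-)
    open NatSolver commutativeSemiring using (solve; _:+_; _:*_; _:=_; con)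

    ·-distribˡ-+ : ∀ x y → m · (x + y) ≈ m · x + m · y
    ·-distribˡ-+ = go m
      where
      go : ∀ k x y → k · (x + y) ≈ k · x + k · y
      go zero    x y = sym (+-identityˡ 0#)
      go (suc k) x y = trans (+-congˡ (go k x y))
        (solve 4 (λ x y u v → (x :+ y) :+ (u :+ v) := (x :+ u) :+ (y :+ v)) refl x y (k · x) (k · y))

    ·-neg : ∀ x → m · (- x) ≈ - (m · x)
    ·-neg x = begin
      m · (- x)      ≈⟨ ×-congʳ m (-x≈ x) ⟩
      m · (x * - 1#) ≈⟨ ×-assoc-* m x (- 1#) ⟨
      (m · x) * - 1# ≈⟨ -x≈ (m · x) ⟨
      - (m · x)      ∎
      where
      open SetoidReasoning setoid
      -x≈ : ∀ y → - y ≈ y * - 1#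
      -x≈ y = trans (-‿cong (sym (*-identityʳ y))) (-‿distribʳ-* y 1#)

  mod-reflexive : ∀ {x y} → x ≈ y → x ≡ y [mod m ]
  mod-reflexive {x} {y} e = 0# , (begin
    x - y   ≈⟨ +-congʳ e ⟩
    y - y   ≈⟨ -‿inverseʳ y ⟩
    0#      ≈⟨ zeroˡ 0# ⟨
    0# * 0# ≈⟨ *-congʳ (-‿inverseʳ 0#) ⟨
    (0# - 0#) * 0# ≈⟨ zeroʳ _ ⟩
    0#      ≈⟨ zeroʳ (m · 1#) ⟨
    (m · 1#) * 0# ≈⟨ ×-assoc-* m 1# 0# ⟩
    m · (1# * 0#) ≈⟨ ×-congʳ m (*-identityˡ 0#) ⟩
    m · 0#  ∎)
    where open SetoidReasoning setoid

  mod-sym : ∀ {x y} → x ≡ y [mod m ] → y ≡ x [mod m ]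
  mod-sym {x} {y} (z , e) = - z ,
    trans (sym (⁻¹-anti-homo‿- x y)) (trans (-‿cong e) (sym (·-neg z)))

  mod-trans : ∀ {x y w} → x ≡ y [mod m ] → y ≡ w [mod m ] → x ≡ w [mod m ]
  mod-trans {x} {y} {w} (u , e) (v , f) = u + v , (begin
    x - w             ≈⟨ +-congʳ (+-identityʳ x) ⟨
    x + 0# - w        ≈⟨ +-congʳ (+-congˡ (-‿inverseˡ y)) ⟨
    x + (- y + y) - w ≈⟨ solve 4 (λ x y′ y w′ → x :+ (y′ :+ y) :+ w′ := (x :+ y′) :+ (y :+ w′)) refl x (- y) y (- w) ⟩
    (x - y) + (y - w) ≈⟨ +-cong e f ⟩
    m · u + m · v     ≈⟨ ·-distribˡ-+ u v ⟨
    m · (u + v)       ∎)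
    where open SetoidReasoning setoid

  mod-+ : ∀ {x x′ y y′} → x ≡ x′ [mod m ] → y ≡ y′ [mod m ] → x + y ≡ x′ + y′ [mod m ]
  mod-+ {x} {x′} {y} {y′} (u , e) (v , f) = u + v , (begin
    (x + y) - (x′ + y′)   ≈⟨ +-congˡ (⁻¹-∙-comm x′ y′) ⟨
    (x + y) + (- x′ - y′) ≈⟨ solve 4 (λ x y z w → (x :+ y) :+ (z :+ w) := (x :+ z) :+ (y :+ w)) refl x y (- x′) (- y′) ⟩
    (x - x′) + (y - y′)   ≈⟨ +-cong e f ⟩
    m · u + m · v         ≈⟨ ·-distribˡ-+ u v ⟨
    m · (u + v)           ∎)
    where open SetoidReasoning setoid

  mod-*ˡ : ∀ w {x y} → x ≡ y [mod m ] → w * x ≡ w * y [mod m ]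
  mod-*ˡ w {x} {y} (u , e) = w * u , (begin
    w * x - w * y       ≈⟨ +-congˡ (-‿distribʳ-* w y) ⟩
    w * x + w * (- y)   ≈⟨ distribˡ w x (- y) ⟨
    w * (x - y)         ≈⟨ *-congˡ e ⟩
    w * (m · u)         ≈⟨ ×-comm-* m w u ⟩
    m · (w * u)         ∎)
    where open SetoidReasoning setoid

  mod-* : ∀ {x x′ y y′} → x ≡ x′ [mod m ] → y ≡ y′ [mod m ] → x * y ≡ x′ * y′ [mod m ]
  mod-* {x} {x′} {y} {y′} d e = mod-trans (mod-*ˡ x e)
    (mod-trans (mod-reflexive (*-comm x y′))
    (mod-trans (mod-*ˡ y′ d) (mod-reflexive (*-comm y′ x′))))

  mod-neg : ∀ {x y} → x ≡ y [mod m ] → - x ≡ - y [mod m ]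
  mod-neg {x} {y} (u , e) = - u ,
    trans (⁻¹-∙-comm x (- y)) (trans (-‿cong e) (sym (·-neg u)))

-- Elements of lim A/pᵏA, given by compatible sequences of representatives.
record PAdic (A : CommutativeRing c ℓ) (p : ℕ) : Set (c ⊔ ℓ) where
  constructor padic
  open RingOps A using (_≡_[mod_])
  field
    term       : ℕ → ∣ A ∣ᴿ
    compatible : ∀ k → term (suc k) ≡ term k [mod p ℕ.^ k ]

record PAdicEq (A : CommutativeRing c ℓ) (p : ℕ) (x y : PAdic A p) : Set (c ⊔ ℓ) where
  constructor levelwise
  open RingOps A using (_≡_[mod_])
  field
    at : ∀ k → PAdic.term x k ≡ PAdic.term y k [mod p ℕ.^ k ]

module _ (A : CommutativeRing c ℓ) (p : ℕ) where
  private
    open RingOps A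
    open PAdic
    open PAdicEq
    module C k = CongruenceProperties A (p ℕ.^ k)

    _~_ : PAdic A p → PAdic A p → Set (c ⊔ ℓ)
    _~_ = PAdicEq A p

    pointwise : ∀ {x y} → (∀ k → term x k ≈ term y k) → x ~ y
    pointwise e = levelwise λ k → C.mod-reflexive k (e k)

  constant : ∣ A ∣ᴿ → PAdic A p
  constant x = padic (λ _ → x) (λ k → C.mod-reflexive k refl)

  opaque
    Completion : CommutativeRing (c ⊔ ℓ) (c ⊔ ℓ)
    Completion = record
      { Carrier = PAdic A p
      ; _≈_ = _~_
      ; _+_ = λ x y → padic (λ k → term x k + term y k)
                            (λ k → C.mod-+ k (compatible x k) (compatible y k))
      ; _*_ = λ x y → padic (λ k → term x k * term y k)
                            (λ k → C.mod-* k (compatible x k) (compatible y k))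
      ; -_  = λ x → padic (λ k → - term x k) (λ k → C.mod-neg k (compatible x k))
      ; 0#  = constant 0#
      ; 1#  = constant 1#
      ; isCommutativeRing = record
        { isRing = record
          { +-isAbelianGroup = record
            { isGroup = record
              { isMonoid = record
                { isSemigroup = record
                  { isMagma = record
                    { isEquivalence = record
                      { refl  = pointwise λ k → refl
                      ; sym   = λ e → levelwise λ k → C.mod-sym k (at e k)
                      ; trans = λ d e → levelwise λ k → C.mod-trans k (at d k) (at e k)
                      }
                    ; ∙-cong = λ d e → levelwise λ k → C.mod-+ k (at d k) (at e k)
                    }
                  ; assoc = λ x y z → pointwise λ k → +-assoc _ _ _
                  }
                ; identity = (λ x → pointwise λ k → +-identityˡ _)
                           , (λ x → pointwise λ k → +-identityʳ _)
                }
              ; inverse = (λ x → pointwise λ k → -‿inverseˡ _)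
                        , (λ x → pointwise λ k → -‿inverseʳ _)
              ; ⁻¹-cong = λ e → levelwise λ k → C.mod-neg k (at e k)
              }
            ; comm = λ x y → pointwise λ k → +-comm _ _
            }
          ; *-cong = λ d e → levelwise λ k → C.mod-* k (at d k) (at e k)
          ; *-assoc = λ x y z → pointwise λ k → *-assoc _ _ _
          ; *-identity = (λ x → pointwise λ k → *-identityˡ _)
                       , (λ x → pointwise λ k → *-identityʳ _)
          ; distrib = (λ x y z → pointwise λ k → distribˡ _ _ _)
                    , (λ x y z → pointwise λ k → distribʳ _ _ _)
          }
        ; *-comm = λ x y → pointwise λ k → *-comm _ _
        }
      }

    toCompletion : Hom A Completion
    toCompletion = mkHom A Completion constant
      (λ e → pointwise λ k → e)
      (λ x y → pointwise λ k → refl)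
      (λ x y → pointwise λ k → refl)
      (pointwise λ k → refl)

module _ (A : CommutativeRing a ℓ₁) (B : CommutativeRing b ℓ₂) (p : ℕ) (f : Hom A B) where
  private
    module A = RingOps A
    module B = RingOps B
    open HomProperties A B f
    open PAdic
    open PAdicEq
    module C k = CongruenceProperties B (p ℕ.^ k)

    mod-homo : ∀ m {x y} → x A.≡ y [mod m ] → ⟦ f ⟧ x B.≡ ⟦ f ⟧ y [mod m ]
    mod-homo m {x} {y} (z , e) = ⟦ f ⟧ z ,
      B.trans (B.+-congˡ (B.sym (-‿homo y)))
      (B.trans (B.sym (+-homo x _)) (B.trans (⟦⟧-cong e) (·-homo m z)))

  opaque
    unfolding Completion

    mapCompletion : Hom (Completion A p) (Completion B p)
    mapCompletion = mkHom (Completion A p) (Completion B p)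
      (λ x → padic (λ k → ⟦ f ⟧ (term x k)) (λ k → mod-homo (p ℕ.^ k) (compatible x k)))
      (λ e → levelwise λ k → mod-homo (p ℕ.^ k) (at e k))
      (λ x y → levelwise λ k → C.mod-reflexive k (+-homo _ _))
      (λ x y → levelwise λ k → C.mod-reflexive k (*-homo _ _))
      (levelwise λ k → C.mod-reflexive k 1#-homo)

-- The polynomial ring A[V], presented as the free commutative A-algebra on V:
-- expressions modulo the congruence generated by the commutative ring laws
-- and by the requirement that con is a ring homomorphism.
data Expr (A : CommutativeRing c ℓ) (V : Set) : Set c where
  con       : ∣ A ∣ᴿ → Expr A V
  var       : V → Expr A V
  _⊕_ _⊛_ : Expr A V → Expr A V → Expr A V
  ⊖_        : Expr A V → Expr A V

module _ (A : CommutativeRing c ℓ) (V : Set) where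
  open CommutativeRing A

  data _≈ᴾ_ : Expr A V → Expr A V → Set (c ⊔ ℓ) where
    ≈-refl      : ∀ {f} → f ≈ᴾ f
    ≈-sym       : ∀ {f g} → f ≈ᴾ g → g ≈ᴾ f
    ≈-trans     : ∀ {f g h} → f ≈ᴾ g → g ≈ᴾ h → f ≈ᴾ h
    con-cong    : ∀ {x y} → x ≈ y → con x ≈ᴾ con y
    ⊕-cong      : ∀ {f f′ g g′} → f ≈ᴾ f′ → g ≈ᴾ g′ → (f ⊕ g) ≈ᴾ (f′ ⊕ g′)
    ⊛-cong      : ∀ {f f′ g g′} → f ≈ᴾ f′ → g ≈ᴾ g′ → (f ⊛ g) ≈ᴾ (f′ ⊛ g′)
    ⊖-cong      : ∀ {f g} → f ≈ᴾ g → (⊖ f) ≈ᴾ (⊖ g)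
    con-+       : ∀ x y → con (x + y) ≈ᴾ (con x ⊕ con y)
    con-*       : ∀ x y → con (x * y) ≈ᴾ (con x ⊛ con y)
    ⊕-assoc     : ∀ f g h → ((f ⊕ g) ⊕ h) ≈ᴾ (f ⊕ (g ⊕ h))
    ⊕-comm      : ∀ f g → (f ⊕ g) ≈ᴾ (g ⊕ f)
    ⊕-identityˡ : ∀ f → (con 0# ⊕ f) ≈ᴾ f
    ⊖-inverseˡ  : ∀ f → ((⊖ f) ⊕ f) ≈ᴾ con 0#
    ⊛-assoc     : ∀ f g h → ((f ⊛ g) ⊛ h) ≈ᴾ (f ⊛ (g ⊛ h))
    ⊛-comm      : ∀ f g → (f ⊛ g) ≈ᴾ (g ⊛ f)
    ⊛-identityˡ : ∀ f → (con 1# ⊛ f) ≈ᴾ f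
    ⊛-distribˡ  : ∀ f g h → (f ⊛ (g ⊕ h)) ≈ᴾ ((f ⊛ g) ⊕ (f ⊛ h))

  opaque
    Polynomial : CommutativeRing c (c ⊔ ℓ)
    Polynomial = record
      { Carrier = Expr A V
      ; _≈_ = _≈ᴾ_
      ; _+_ = _⊕_
      ; _*_ = _⊛_
      ; -_  = ⊖_
      ; 0#  = con 0#
      ; 1#  = con 1#
      ; isCommutativeRing = record
        { isRing = record
          { +-isAbelianGroup = record
            { isGroup = record
              { isMonoid = record
                { isSemigroup = record
                  { isMagma = record
                    { isEquivalence = record { refl = ≈-refl ; sym = ≈-sym ; trans = ≈-trans }
                    ; ∙-cong = ⊕-cong
                    }
                  ; assoc = ⊕-assoc
                  }
                ; identity = ⊕-identityˡ , λ f → ≈-trans (⊕-comm _ _) (⊕-identityˡ f)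
                }
              ; inverse = ⊖-inverseˡ , λ f → ≈-trans (⊕-comm _ _) (⊖-inverseˡ f)
              ; ⁻¹-cong = ⊖-cong
              }
            ; comm = ⊕-comm
            }
          ; *-cong = ⊛-cong
          ; *-assoc = ⊛-assoc
          ; *-identity = ⊛-identityˡ , λ f → ≈-trans (⊛-comm _ _) (⊛-identityˡ f)
          ; distrib = ⊛-distribˡ , λ f g h → ≈-trans (⊛-comm _ _)
              (≈-trans (⊛-distribˡ f g h) (⊕-cong (⊛-comm _ _) (⊛-comm _ _)))
          }
        ; *-comm = ⊛-comm
        }
      }

    X : V → ∣ Polynomial ∣ᴿ
    X = var

    toPolynomial : Hom A Polynomial
    toPolynomial = mkHom A Polynomial con con-cong con-+ con-* ≈-refl

module _ (A : CommutativeRing a ℓ₁) (B : CommutativeRing b ℓ₂) (V : Set) (f : Hom A B) where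
  private
    module A = CommutativeRing A
    module B = CommutativeRing B
    open HomProperties A B f

    go : Expr A V → Expr B V
    go (con x) = con (⟦ f ⟧ x)
    go (var v) = var v
    go (g ⊕ h) = go g ⊕ go h
    go (g ⊛ h) = go g ⊛ go h
    go (⊖ g)   = ⊖ go g

    con-0 : _≈ᴾ_ B V (con (⟦ f ⟧ A.0#)) (con B.0#)
    con-0 = con-cong 0#-homo

    con-1 : _≈ᴾ_ B V (con (⟦ f ⟧ A.1#)) (con B.1#)
    con-1 = con-cong 1#-homo

    go-cong : ∀ {g h} → _≈ᴾ_ A V g h → _≈ᴾ_ B V (go g) (go h)
    go-cong ≈-refl           = ≈-refl
    go-cong (≈-sym e)        = ≈-sym (go-cong e)
    go-cong (≈-trans d e)    = ≈-trans (go-cong d) (go-cong e)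
    go-cong (con-cong e)     = con-cong (⟦⟧-cong e)
    go-cong (⊕-cong d e)     = ⊕-cong (go-cong d) (go-cong e)
    go-cong (⊛-cong d e)     = ⊛-cong (go-cong d) (go-cong e)
    go-cong (⊖-cong e)       = ⊖-cong (go-cong e)
    go-cong (con-+ x y)      = ≈-trans (con-cong (+-homo x y)) (con-+ _ _)
    go-cong (con-* x y)      = ≈-trans (con-cong (*-homo x y)) (con-* _ _)
    go-cong (⊕-assoc _ _ _)  = ⊕-assoc _ _ _
    go-cong (⊕-comm _ _)     = ⊕-comm _ _
    go-cong (⊕-identityˡ _)  = ≈-trans (⊕-cong con-0 ≈-refl) (⊕-identityˡ _)
    go-cong (⊖-inverseˡ _)   = ≈-trans (⊖-inverseˡ _) (≈-sym con-0)
    go-cong (⊛-assoc _ _ _)  = ⊛-assoc _ _ _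
    go-cong (⊛-comm _ _)     = ⊛-comm _ _
    go-cong (⊛-identityˡ _)  = ≈-trans (⊛-cong con-1 ≈-refl) (⊛-identityˡ _)
    go-cong (⊛-distribˡ _ _ _) = ⊛-distribˡ _ _ _

  opaque
    unfolding Polynomial

    mapPolynomial : Hom (Polynomial A V) (Polynomial B V)
    mapPolynomial = mkHom (Polynomial A V) (Polynomial B V) go go-cong
      (λ _ _ → ≈-refl) (λ _ _ → ≈-refl) con-1

Indeterminate : ℕ → Set
Indeterminate n = Fin n × Fin n

module _ (R : CommutativeRing c ℓ) (n : ℕ) where

  R[x] : CommutativeRing c (c ⊔ ℓ)
  R[x] = Polynomial R (Indeterminate n)

  generic : RingOps.Matrix R[x] n
  generic i j = X R (Indeterminate n) (i , j)

  detPowers : MulSubset R[x] (c ⊔ ℓ)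
  detPowers = powers R[x] (RingOps.det R[x] generic)

  𝒪G : CommutativeRing (c ⊔ ℓ) (c ⊔ ℓ)
  𝒪G = Localization R[x] detPowers

  module _ (p : ℕ) where

    𝒪Ĝ : CommutativeRing (c ⊔ ℓ) (c ⊔ ℓ)
    𝒪Ĝ = Completion 𝒪G p

    fromPolynomial : ∣ R[x] ∣ᴿ → ∣ 𝒪Ĝ ∣ᴿ
    fromPolynomial f = ⟦ toCompletion 𝒪G p ⟧ (⟦ toLocalization R[x] detPowers ⟧ f)

    scalar : ∣ R ∣ᴿ → ∣ 𝒪Ĝ ∣ᴿ
    scalar r = fromPolynomial (⟦ toPolynomial R (Indeterminate n) ⟧ r)

    coordinate : RingOps.Matrix 𝒪Ĝ n
    coordinate = mapᴹ fromPolynomial generic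

module _ (R : CommutativeRing a ℓ₁) (S : CommutativeRing b ℓ₂) (n : ℕ) (f : Hom R S) where
  private
    f[x] : Hom (R[x] R n) (R[x] S n)
    f[x] = mapPolynomial R S (Indeterminate n) f

    module S[x] = RingOps (R[x] S n)
    open HomProperties (R[x] R n) (R[x] S n) f[x]

    opaque
      unfolding mapPolynomial

      preserves : ∀ {g} → MulSubset.Mem (detPowers R n) g → MulSubset.Mem (detPowers S n) (⟦ f[x] ⟧ g)
      preserves (k , e) = k , S[x].trans (⟦⟧-cong e)
        (S[x].trans (^-homo _ k) (S[x].^-congˡ k (det-homo (generic R n))))

  map𝒪Ĝ : (p : ℕ) → Hom (𝒪Ĝ R n p) (𝒪Ĝ S n p)
  map𝒪Ĝ p = mapCompletion (𝒪G R n) (𝒪G S n) p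
    (mapLocalization (R[x] R n) (R[x] S n) (detPowers R n) (detPowers S n) f[x] preserves)

module _ (A : CommutativeRing c ℓ) (p : ℕ) where
  private
    open module A = RingOps A using (Carrier; _^_; _+_; _·_; _≡_[mod_])

  IsFrobeniusLift : (Carrier → Carrier) → Set (c ⊔ ℓ)
  IsFrobeniusLift φ = IsRingHomomorphism A.rawRing A.rawRing φ × (∀ x → φ x ≡ x ^ p [mod p ])

  attached : (Carrier → Carrier) → Carrier → Carrier
  attached δ x = x ^ p + p · δ x

-- Meaningful for p-torsion free A only, as are all rings it is applied to
-- below: there δ determines and is determined by its attached Frobenius lift.
record PDerivation (A : CommutativeRing c ℓ) (p : ℕ) : Set (c ⊔ ℓ) where
  field
    δ                        : ∣ A ∣ᴿ → ∣ A ∣ᴿ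
    attached-isFrobeniusLift : IsFrobeniusLift A p (attached A p δ)

  φ : ∣ A ∣ᴿ → ∣ A ∣ᴿ
  φ = attached A p δ

conjugate : (A : CommutativeRing a ℓ₁) (B : CommutativeRing b ℓ₂) → Hom A B → Hom B A →
            (p : ℕ) → PDerivation B p → ∣ A ∣ᴿ → ∣ A ∣ᴿ
conjugate A B f g p d x = ⟦ g ⟧ (PDerivation.φ d (⟦ f ⟧ x))

-- φᵢⱼ is given through p φᵢⱼ, which determines it when A is p-torsion free.
IsCurvatureOf : (A : CommutativeRing a ℓ₁) (p : ℕ) {I : Set} (Φ : I → ∣ A ∣ᴿ → ∣ A ∣ᴿ) →
                (I → I → ∣ A ∣ᴿ → ∣ A ∣ᴿ) → Set (a ⊔ ℓ₁)
IsCurvatureOf A p Φ φ = ∀ i j f → p · φ i j f ≈ Φ i (Φ j f) - Φ j (Φ i f)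
  where open RingOps A

-- A family of p-derivations on Bᵢ extending p-derivations on Aᵢ. For Aᵢ = Rᵢ the
-- latter are not a choice: Rᵢ carries exactly one p-derivation.
record Connection (I : Set) (A : I → CommutativeRing a ℓ₁) (B : I → CommutativeRing b ℓ₂)
                  (ι : ∀ i → ∣ A i ∣ᴿ → ∣ B i ∣ᴿ) (p : ℕ) : Set (a ⊔ b ⊔ ℓ₁ ⊔ ℓ₂) where
  field
    base    : ∀ i → PDerivation (A i) p
    deriv   : ∀ i → PDerivation (B i) p
    extends : ∀ i r → CommutativeRing._≈_ (B i)
                (PDerivation.δ (deriv i) (ι i r)) (ι i (PDerivation.δ (base i) r))

module _ (A : CommutativeRing c ℓ) (p : ℕ) {n : ℕ} (x q : RingOps.Matrix A n) where
  private
    open module A = RingOps A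
      using (Carrier; Matrix; _⊗_; _ᵗ; _⁽_⁾; _≋_; _·_; _+_; _-_; -_; _≈_)

  -- Ring homomorphisms between p-adically complete rings are p-adically
  -- continuous, so for A = 𝒪(Ĝ) the maps H and φ₀ are determined by the
  -- conditions imposed on them.
  IsMetricLift : (R : CommutativeRing a ℓ₁) (ι : ∣ R ∣ᴿ → Carrier) →
                 PDerivation R p → PDerivation A p → Set (a ⊔ c ⊔ ℓ)
  IsMetricLift R ι dR d =
    Σ[ H ∈ Hom A A ] Σ[ φ₀ ∈ (Carrier → Carrier) ]
      (∀ r → ⟦ H ⟧ (ι r) ≈ ι r)
    × mapᴹ ⟦ H ⟧ x ≋ x ᵗ ⊗ q ⊗ x
    × IsFrobeniusLift A p φ₀
    × (∀ r → φ₀ (ι r) ≈ ι (PDerivation.φ dR r))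
    × mapᴹ φ₀ x ≋ x ⁽ p ⁾
    × (∀ f → PDerivation.φ d (⟦ H ⟧ f) ≈ ⟦ H ⟧ (φ₀ f))

  christoffel : PDerivation A p → Matrix n
  christoffel d = mapᴹ (PDerivation.δ d) x ᵗ ⊗ mapᴹ (PDerivation.φ d) q ⊗ x ⁽ p ⁾

  -- T = (1/p){(xᵗqx)⁽ᵖ⁾ - x⁽ᵖ⁾ᵗ q⁽ᵖ⁾ x⁽ᵖ⁾}; A is p-torsion free.
  IsCorrection : Matrix n → Set ℓ
  IsCorrection T = ∀ j k →
    p · T j k ≈ ((x ᵗ ⊗ q ⊗ x) ⁽ p ⁾) j k - (x ⁽ p ⁾ ᵗ ⊗ q ⁽ p ⁾ ⊗ x ⁽ p ⁾) j k

  C-matrix : PDerivation A p → Matrix n → Matrix n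
  C-matrix d T j k = - (x ⁽ p ⁾ ᵗ ⊗ mapᴹ (PDerivation.δ d) q ⊗ x ⁽ p ⁾) j k + T j k

  lower : Matrix n → Matrix n
  lower Φ = x ⁽ p ℕ.^ 2 ⁾ ᵗ ⊗ q ⁽ p ℕ.^ 2 ⁾ ⊗ Φ

module _ (A : CommutativeRing c ℓ) (p : ℕ) {n : ℕ} (x : RingOps.Matrix A n) where
  private
    open module A = RingOps A using (Carrier; Matrix; _·_; _+_; _*_; _-_; _≈_; sum; 𝟙)

  Congruent[p,x-1] : Carrier → Carrier → Set (c ⊔ ℓ)
  Congruent[p,x-1] f g = Σ[ u ∈ Carrier ] Σ[ v ∈ Matrix n ]
    f - g ≈ p · u + sum (λ i → sum (λ j → v i j * (x i j - 𝟙 i j)))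

record PrimeIdeal (A : CommutativeRing c ℓ) (π : Level) : Set (c ⊔ ℓ ⊔ lsuc π) where
  open CommutativeRing A
  field
    Mem      : Carrier → Set π
    Mem-resp : ∀ {x y} → x ≈ y → Mem x → Mem y
    0-mem    : Mem 0#
    +-mem    : ∀ {x y} → Mem x → Mem y → Mem (x + y)
    *-mem    : ∀ x {y} → Mem y → Mem (x * y)
    1∉       : ¬ Mem 1#
    prime    : ∀ {x y} → Mem (x * y) → Mem x ⊎ Mem y

_Divides_ : {A : CommutativeRing c ℓ} {π : Level} → PrimeIdeal A π → ℕ → Set π
_Divides_ {A = A} P p = PrimeIdeal.Mem P (p · 1#)
  where open RingOps A

complement : (A : CommutativeRing c ℓ) {π : Level} → PrimeIdeal A π → MulSubset A π
complement A P = record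
  { Mem   = λ x → ¬ Mem x
  ; 1-mem = 1∉
  ; *-mem = λ x∉ y∉ xy∈ → case (prime xy∈) x∉ y∉
  }
  where
  open PrimeIdeal P
  case : ∀ {x y} → Mem x ⊎ Mem y → ¬ Mem x → ¬ Mem y → ⊥
  case (inj₁ x∈) x∉ y∉ = x∉ x∈
  case (inj₂ y∈) x∉ y∉ = y∉ y∈

module _ (A : CommutativeRing c ℓ) {π : Level} (P : PrimeIdeal A π)
         (p : ℕ) (p-prime : Prime p) where
  private
    open RingOps A
    open PrimeIdeal P
    open GroupProperties +-group using (⁻¹-involutive)
    open RingProperties ring using (-‿distribˡ-*)

    neg-mem : ∀ {x} → Mem x → Mem (- x)
    neg-mem {x} x∈ = Mem-resp
      (trans (sym (-‿distribˡ-* 1# x)) (-‿cong (*-identityˡ x))) (*-mem (- 1#) x∈)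

    multiple-mem : ∀ k m → Mem (m · 1#) → Mem ((k ℕ.* m) · 1#)
    multiple-mem k m m∈ = Mem-resp (sym (×1-homo-* k m)) (*-mem (k · 1#) m∈)

    difference-mem : ∀ m → Mem (suc m · 1#) → Mem (m · 1#) → Mem 1#
    difference-mem m sm∈ m∈ = Mem-resp
      (trans (+-assoc 1# _ _) (trans (+-congˡ (-‿inverseʳ _)) (+-identityʳ 1#)))
      (+-mem sm∈ (neg-mem m∈))

    prime-coprime : ∀ m → ¬ p ℕ.∣ m → Coprime p m
    prime-coprime m p∤m (d∣p , d∣m) with prime⇒irreducible p-prime d∣p
    ... | inj₁ d≡1   = d≡1
    ... | inj₂ ≡.refl = ⊥-elim (p∤m d∣m)

  nat∉ : Mem (p · 1#) → ∀ m → ¬ p ℕ.∣ m → ¬ Mem (m · 1#)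
  nat∉ p∈ m p∤m m∈ with coprime-Bézout (prime-coprime m p∤m)
  ... | GCD.Bézout.+- x y 1+ym≡xp = 1∉ (difference-mem (y ℕ.* m)
          (≡.subst (λ k → Mem (k · 1#)) (≡.sym 1+ym≡xp) (multiple-mem x p p∈))
          (multiple-mem y m m∈))
  ... | GCD.Bézout.-+ x y 1+xp≡ym = 1∉ (difference-mem (x ℕ.* p)
          (≡.subst (λ k → Mem (k · 1#)) (≡.sym 1+xp≡ym) (multiple-mem y m m∈))
          (multiple-mem x p p∈))

  int∉ : Mem (p · 1#) → ∀ k → ¬ (+ p) ℤ.∣ k → ¬ Mem (k ⋆ 1#)
  int∉ p∈ (+ m)    p∤k       = nat∉ p∈ m p∤k
  int∉ p∈ -[1+ m ] p∤k k∈ = nat∉ p∈ (suc m) p∤k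
    (Mem-resp (⁻¹-involutive _) (neg-mem k∈))

  power∉ : ∀ {x} → ¬ Mem x → ∀ k → ¬ Mem (x ^ k)
  power∉ x∉ zero    = 1∉
  power∉ x∉ (suc k) xᵏ⁺¹∈ with prime xᵏ⁺¹∈
  ... | inj₁ x∈  = x∉ x∈
  ... | inj₂ xᵏ∈ = power∉ x∉ k xᵏ∈

module _ (A : CommutativeRing c ℓ) where
  private
    open module A = RingOps A using (Carrier; _≈_; _≉_; _+_; _*_; _^_; _⋆_; 0#; 1#; sum)

  IsField : Set (c ⊔ ℓ)
  IsField = 1# ≉ 0# × (∀ x → x ≉ 0# → ∃[ y ] x * y ≈ 1#)

  -- Roots of monic polynomials Xᵈ + k_{d-1} Xᵈ⁻¹ + … + k₀ over ℤ.
  Integral : Carrier → Set ℓ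
  Integral x = ∃[ d ] Σ[ k ∈ (Fin d → ℤ) ] x ^ d + sum (λ i → k i ⋆ x ^ toℕ i) ≈ 0#

  -- Every element is a unique combination of v, for coefficients in S acting by act.
  IsBasis : {S : Set} (act : S → Carrier → Carrier) {d : ℕ} (v : Fin d → Carrier) → Set (c ⊔ ℓ)
  IsBasis {S} act {d} v =
      (∀ x → Σ[ r ∈ (Fin d → S) ] x ≈ sum (λ i → act (r i) (v i)))
    × ((r r′ : Fin d → S) → sum (λ i → act (r i) (v i)) ≈ sum (λ i → act (r′ i) (v i)) →
       ∀ i → r i ≡ r′ i)

record NumberField (c ℓ : Level) : Set (lsuc (c ⊔ ℓ)) where
  field
    F       : CommutativeRing c ℓ
    isField : IsField F
    fromℚ   : Hom ℚ.+-*-commutativeRing F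
    degree  : ℕ
    basis   : Fin degree → ∣ F ∣ᴿ
    isBasis : IsBasis F (λ r → CommutativeRing._*_ F (⟦ fromℚ ⟧ r)) basis

module _ (K : NumberField c ℓ) where
  open NumberField K
  private
    module K = RingOps F

  record Automorphism : Set (c ⊔ ℓ) where
    field
      to      : Hom F F
      from    : Hom F F
      to∘from : ∀ x → ⟦ to ⟧ (⟦ from ⟧ x) K.≈ x
      from∘to : ∀ x → ⟦ from ⟧ (⟦ to ⟧ x) K.≈ x
      fixes-ℚ : ∀ r → ⟦ to ⟧ (⟦ fromℚ ⟧ r) K.≈ ⟦ fromℚ ⟧ r

  open Automorphism

  infix 9 _⁻¹ᴬ

  _⁻¹ᴬ : Automorphism → Automorphism
  τ ⁻¹ᴬ = record
    { to = from τ ; from = to τ ; to∘from = from∘to τ ; from∘to = to∘from τ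
    ; fixes-ℚ = λ r → K.trans
        (HomProperties.⟦⟧-cong F F (from τ) (K.sym (fixes-ℚ τ r))) (from∘to τ (⟦ fromℚ ⟧ r))
    }

  -- F/ℚ is Galois when it has exactly [F : ℚ] automorphisms.
  record IsGalois : Set (c ⊔ ℓ) where
    field
      aut        : Fin degree → Automorphism
      distinct   : ∀ i j → (∀ x → ⟦ to (aut i) ⟧ x K.≈ ⟦ to (aut j) ⟧ x) → i ≡ j
      exhaustive : ∀ τ → ∃[ i ] (∀ x → ⟦ to (aut i) ⟧ x K.≈ ⟦ to τ ⟧ x)

  -- A ring embedded in F with image the set of integral elements, i.e. 𝒪_F.
  record RingOfIntegers : Set (lsuc (c ⊔ ℓ)) where
    field
      𝒪               : CommutativeRing c ℓ
      embed           : Hom 𝒪 F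
      embed-injective : ∀ {x y} → ⟦ embed ⟧ x K.≈ ⟦ embed ⟧ y → CommutativeRing._≈_ 𝒪 x y
      embed-integral  : ∀ x → Integral F (⟦ embed ⟧ x)
      integral⇒embed  : ∀ x → Integral F x → ∃[ y ] ⟦ embed ⟧ y K.≈ x

module _ (K : NumberField c ℓ) (𝓞 : RingOfIntegers K) where
  open NumberField K
  open RingOfIntegers 𝓞
  open Automorphism using (to; from; to∘from)
  private
    module K = RingOps F
    module 𝒪 = RingOps 𝒪
    module ι = HomProperties 𝒪 F embed

  -- For a ℤ-basis ω of 𝒪_F, the discriminant is det(τᵢ(ωⱼ))², where τ runs over
  -- the embeddings of F in an algebraic closure; as F/ℚ is Galois, these are
  -- given by its automorphisms.
  IsDiscriminant : IsGalois K → ℤ → Set (c ⊔ ℓ)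
  IsDiscriminant galois D =
    Σ[ ω ∈ (Fin degree → 𝒪.Carrier) ]
      IsBasis 𝒪 𝒪._⋆_ ω
    × D K.⋆ K.1# K.≈ K.det (λ i j → ⟦ to (IsGalois.aut galois i) ⟧ (⟦ embed ⟧ (ω j))) K.^ 2

  private
    integral-homo : (f : Hom F F) → ∀ {x} → Integral F x → Integral F (⟦ f ⟧ x)
    integral-homo f {x} (d , k , e) = d , k , (begin
      ⟦ f ⟧ x K.^ d K.+ K.sum (λ i → k i K.⋆ ⟦ f ⟧ x K.^ toℕ i)
        ≈⟨ K.+-cong (f.^-homo x d) (K.trans (f.sum-homo (λ i → k i K.⋆ x K.^ toℕ i)) (K.sum-cong-≋ λ i →
             K.trans (f.⋆-homo (k i) (x K.^ toℕ i)) (⋆-cong (k i) (f.^-homo x (toℕ i))))) ⟨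
      ⟦ f ⟧ (x K.^ d) K.+ ⟦ f ⟧ (K.sum (λ i → k i K.⋆ x K.^ toℕ i)) ≈⟨ f.+-homo _ _ ⟨
      ⟦ f ⟧ (x K.^ d K.+ K.sum (λ i → k i K.⋆ x K.^ toℕ i))         ≈⟨ f.⟦⟧-cong e ⟩
      ⟦ f ⟧ K.0#                                                    ≈⟨ f.0#-homo ⟩
      K.0#                                                          ∎)
      where
      open SetoidReasoning K.setoid
      module f = HomProperties F F f
      ⋆-cong : ∀ m {y z} → y K.≈ z → m K.⋆ y K.≈ m K.⋆ z
      ⋆-cong (+ m)    y≈z = K.×-congʳ m y≈z
      ⋆-cong -[1+ m ] y≈z = K.-‿cong (K.×-congʳ (suc m) y≈z)

  module _ (τ : Automorphism K) where
    private
      module τ = HomProperties F F (to τ)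

      lift : ∀ x → ∃[ y ] ⟦ embed ⟧ y K.≈ ⟦ to τ ⟧ (⟦ embed ⟧ x)
      lift x = integral⇒embed _ (integral-homo (to τ) (embed-integral x))

      res : 𝒪.Carrier → 𝒪.Carrier
      res x = proj₁ (lift x)

      res-≈ : ∀ {x y} → ⟦ to τ ⟧ (⟦ embed ⟧ x) K.≈ ⟦ embed ⟧ y → res x 𝒪.≈ y
      res-≈ {x} e = embed-injective (K.trans (proj₂ (lift x)) e)

    restrict : Hom 𝒪 𝒪
    restrict = mkHom 𝒪 𝒪 res
      (λ {x} {y} x≈y → res-≈ (K.trans (τ.⟦⟧-cong (ι.⟦⟧-cong x≈y)) (K.sym (proj₂ (lift y)))))
      (λ x y → res-≈ (K.trans (τ.⟦⟧-cong (ι.+-homo x y)) (K.trans (τ.+-homo _ _)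
        (K.trans (K.+-cong (K.sym (proj₂ (lift x))) (K.sym (proj₂ (lift y)))) (K.sym (ι.+-homo _ _))))))
      (λ x y → res-≈ (K.trans (τ.⟦⟧-cong (ι.*-homo x y)) (K.trans (τ.*-homo _ _)
        (K.trans (K.*-cong (K.sym (proj₂ (lift x))) (K.sym (proj₂ (lift y)))) (K.sym (ι.*-homo _ _))))))
      (res-≈ (K.trans (τ.⟦⟧-cong ι.1#-homo) (K.trans τ.1#-homo (K.sym ι.1#-homo))))

    restrict-embed : ∀ x → ⟦ embed ⟧ (⟦ restrict ⟧ x) K.≈ ⟦ to τ ⟧ (⟦ embed ⟧ x)
    restrict-embed x = proj₂ (lift x)

  restrict-inverse : ∀ τ x → ⟦ restrict τ ⟧ (⟦ restrict (_⁻¹ᴬ K τ) ⟧ x) 𝒪.≈ x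
  restrict-inverse τ x = embed-injective (K.trans (restrict-embed τ _)
    (K.trans (HomProperties.⟦⟧-cong F F (to τ) (restrict-embed (_⁻¹ᴬ K τ) x)) (to∘from τ _)))

  image : {π : Level} → Automorphism K → PrimeIdeal 𝒪 π → PrimeIdeal 𝒪 (c ⊔ ℓ ⊔ π)
  image τ P = record
    { Mem      = λ y → ∃[ x ] P.Mem x × ⟦ restrict τ ⟧ x 𝒪.≈ y
    ; Mem-resp = λ { y≈z (x , x∈ , e) → x , x∈ , 𝒪.trans e y≈z }
    ; 0-mem    = 𝒪.0# , P.0-mem , τ.0#-homo
    ; +-mem    = λ { (x , x∈ , d) (y , y∈ , e) → x 𝒪.+ y , P.+-mem x∈ y∈ ,
                     𝒪.trans (τ.+-homo x y) (𝒪.+-cong d e) }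
    ; *-mem    = λ { z (x , x∈ , e) → ⟦ restrict τ⁻¹ ⟧ z 𝒪.* x , P.*-mem _ x∈ ,
                     𝒪.trans (τ.*-homo _ x) (𝒪.*-cong (restrict-inverse τ z) e) }
    ; 1∉       = λ { (x , x∈ , e) → P.1∉ (P.Mem-resp
                     (𝒪.trans (back e) τ⁻¹.1#-homo) x∈) }
    ; prime    = λ { (x , x∈ , e) → split (P.prime (P.Mem-resp
                     (𝒪.trans (back e) (τ⁻¹.*-homo _ _)) x∈)) }
    }
    where
    module P = PrimeIdeal P
    τ⁻¹ = _⁻¹ᴬ K τ
    module τ   = HomProperties 𝒪 𝒪 (restrict τ)
    module τ⁻¹ = HomProperties 𝒪 𝒪 (restrict τ⁻¹)
    back : ∀ {x y} → ⟦ restrict τ ⟧ x 𝒪.≈ y → x 𝒪.≈ ⟦ restrict τ⁻¹ ⟧ y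
    back e = 𝒪.trans (𝒪.sym (restrict-inverse τ⁻¹ _)) (τ⁻¹.⟦⟧-cong e)
    split : ∀ {y z} → P.Mem (⟦ restrict τ⁻¹ ⟧ y) ⊎ P.Mem (⟦ restrict τ⁻¹ ⟧ z) →
            (∃[ x ] P.Mem x × ⟦ restrict τ ⟧ x 𝒪.≈ y) ⊎ (∃[ x ] P.Mem x × ⟦ restrict τ ⟧ x 𝒪.≈ z)
    split (inj₁ y∈) = inj₁ (_ , y∈ , restrict-inverse τ _)
    split (inj₂ z∈) = inj₂ (_ , z∈ , restrict-inverse τ _)

  intPowers : ℤ → MulSubset 𝒪 ℓ
  intPowers M = powers 𝒪 (M 𝒪.⋆ 𝒪.1#)

  𝒪[1/_] : ℤ → CommutativeRing (c ⊔ ℓ) (c ⊔ ℓ)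
  𝒪[1/ M ] = Localization 𝒪 (intPowers M)

  restrict[1/_] : (M : ℤ) → Automorphism K → Hom 𝒪[1/ M ] 𝒪[1/ M ]
  restrict[1/ M ] τ = mapLocalization 𝒪 𝒪 (intPowers M) (intPowers M) (restrict τ)
    λ { (k , e) → k , 𝒪.trans (⟦⟧-cong e) (𝒪.trans (^-homo _ k) (𝒪.^-congˡ k (fixes M))) }
    where
    open HomProperties 𝒪 𝒪 (restrict τ)
    fixes : ∀ k → ⟦ restrict τ ⟧ (k 𝒪.⋆ 𝒪.1#) 𝒪.≈ k 𝒪.⋆ 𝒪.1#
    fixes (+ n)    = 𝒪.trans (·-homo n 𝒪.1#) (𝒪.×-congʳ n 1#-homo)
    fixes -[1+ n ] = 𝒪.trans (-‿homo _) (𝒪.-‿cong (fixes (+ suc n)))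

-- The matrix size is n = suc m, so that n ≥ 1; indices start at zero.
record Setting (c ℓ π : Level) : Set (lsuc (c ⊔ ℓ ⊔ π)) where
  field
    K       : NumberField c ℓ
    galois  : IsGalois K
    𝓞       : RingOfIntegers K
    M       : ℤ
    2∣M     : + 2 ℤ.∣ M
    D       : ℤ
    isDisc  : IsDiscriminant K 𝓞 galois D
    D∣M     : D ℤ.∣ M
    m       : ℕ
    σ       : Fin (suc m) → Automorphism K
    σ₁≈id   : ∀ x → CommutativeRing._≈_ (NumberField.F K) (⟦ Automorphism.to (σ zero) ⟧ x) x
    p       : ℕ
    p-prime : Prime p
    p∤M     : ¬ + p ℤ.∣ M
    𝔓       : PrimeIdeal (RingOfIntegers.𝒪 𝓞) π
    𝔓∣p     : 𝔓 Divides p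

module _ {c ℓ π : Level} (S : Setting c ℓ π) where
  open Setting S
  open NumberField K using (F)
  open RingOfIntegers 𝓞 using (𝒪; embed-injective)
  private
    module 𝒪 = RingOps 𝒪

    _∉_ : 𝒪.Carrier → {π : Level} → PrimeIdeal 𝒪 π → Set π
    s ∉ P = ¬ PrimeIdeal.Mem P s

  Size : ℕ
  Size = suc m

  Index : Set
  Index = Fin Size

  𝔓[_] : Index → PrimeIdeal 𝒪 (c ⊔ ℓ ⊔ π)
  𝔓[ i ] = image K 𝓞 (σ i) 𝔓

  𝒪at : Index → CommutativeRing (c ⊔ ℓ ⊔ π) (c ⊔ ℓ ⊔ π)
  𝒪at i = Localization 𝒪 (complement 𝒪 𝔓[ i ])

  R : Index → CommutativeRing (c ⊔ ℓ ⊔ π) (c ⊔ ℓ ⊔ π)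
  R i = Completion (𝒪at i) p

  Ô : Index → CommutativeRing (c ⊔ ℓ ⊔ π) (c ⊔ ℓ ⊔ π)
  Ô i = 𝒪Ĝ (R i) Size p

  private
    res : Index → Hom 𝒪 𝒪
    res i = restrict K 𝓞 (σ i)

    res⁻¹ : Index → Hom 𝒪 𝒪
    res⁻¹ i = restrict K 𝓞 (_⁻¹ᴬ K (σ i))

    res-zero : ∀ x → ⟦ res zero ⟧ x 𝒪.≈ x
    res-zero x = embed-injective
      (CommutativeRing.trans F (restrict-embed K 𝓞 (σ zero) x) (σ₁≈id _))

    res-preserves : ∀ i {s} → s ∉ 𝔓[ zero ] → ⟦ res i ⟧ s ∉ 𝔓[ i ]
    res-preserves i {s} s∉ (x , x∈ , e) = s∉ (x , x∈ , 𝒪.trans (res-zero x)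
      (𝒪.trans (𝒪.sym (restrict-inverse K 𝓞 (_⁻¹ᴬ K (σ i)) x))
      (𝒪.trans (HomProperties.⟦⟧-cong 𝒪 𝒪 (res⁻¹ i) e)
               (restrict-inverse K 𝓞 (_⁻¹ᴬ K (σ i)) s))))

    res⁻¹-preserves : ∀ i {s} → s ∉ 𝔓[ i ] → ⟦ res⁻¹ i ⟧ s ∉ 𝔓[ zero ]
    res⁻¹-preserves i {s} s∉ (x , x∈ , e) = s∉ (x , x∈ ,
      𝒪.trans (HomProperties.⟦⟧-cong 𝒪 𝒪 (res i) (𝒪.trans (𝒪.sym (res-zero x)) e))
              (restrict-inverse K 𝓞 (σ i) s))

    𝔓[_]∣p : ∀ i → 𝔓[ i ] Divides p
    𝔓[ i ]∣p = p 𝒪.· 𝒪.1# , 𝔓∣p , 𝒪.trans (·-homo p 𝒪.1#) (𝒪.×-congʳ p 1#-homo)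
      where open HomProperties 𝒪 𝒪 (res i)

  σR : ∀ i → Hom (R zero) (R i)
  σR i = mapCompletion (𝒪at zero) (𝒪at i) p
    (mapLocalization 𝒪 𝒪 (complement 𝒪 𝔓[ zero ]) (complement 𝒪 𝔓[ i ])
      (res i) (res-preserves i))

  σR⁻¹ : ∀ i → Hom (R i) (R zero)
  σR⁻¹ i = mapCompletion (𝒪at i) (𝒪at zero) p
    (mapLocalization 𝒪 𝒪 (complement 𝒪 𝔓[ i ]) (complement 𝒪 𝔓[ zero ])
      (res⁻¹ i) (res⁻¹-preserves i))

  σÔ : ∀ i → Hom (Ô zero) (Ô i)
  σÔ i = map𝒪Ĝ (R zero) (R i) Size (σR i) p

  σÔ⁻¹ : ∀ i → Hom (Ô i) (Ô zero)
  σÔ⁻¹ i = map𝒪Ĝ (R i) (R zero) Size (σR⁻¹ i) p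

  fromR : ∀ i → ∣ R i ∣ᴿ → ∣ Ô i ∣ᴿ
  fromR i = scalar (R i) Size p

  x[_] : ∀ i → RingOps.Matrix (Ô i) Size
  x[ i ] = coordinate (R i) Size p

  𝒪[1/M] : CommutativeRing (c ⊔ ℓ) (c ⊔ ℓ)
  𝒪[1/M] = 𝒪[1/_] K 𝓞 M

  from𝒪[1/M] : ∀ i → ∣ 𝒪[1/M] ∣ᴿ → ∣ R i ∣ᴿ
  from𝒪[1/M] i y = ⟦ toCompletion (𝒪at i) p ⟧ (⟦ inclusion ⟧ y)
    where
    inclusion : Hom 𝒪[1/M] (𝒪at i)
    inclusion = mapLocalization 𝒪 𝒪 (intPowers K 𝓞 M) (complement 𝒪 𝔓[ i ]) (idHom 𝒪)
      λ { (k , e) s∈ → power∉ 𝒪 𝔓[ i ] p p-prime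
            (int∉ 𝒪 𝔓[ i ] p p-prime 𝔓[ i ]∣p M p∤M) k (PrimeIdeal.Mem-resp 𝔓[ i ] e s∈) }

  half : ∣ Ô zero ∣ᴿ
  half = fromR zero (⟦ toCompletion (𝒪at zero) p ⟧ (fraction 𝒪 (complement 𝒪 𝔓[ zero ]) 𝒪.1# (2 𝒪.· 𝒪.1#)
    (nat∉ 𝒪 𝔓[ zero ] p p-prime 𝔓[ zero ]∣p 2 λ p∣2 → p∤M (ℕ.∣-trans p∣2 2∣M))))

  VerticalConnection : Set (c ⊔ ℓ ⊔ π)
  VerticalConnection = Connection Index R Ô fromR p

  open Connection

  module _ (q : RingOps.Matrix 𝒪[1/M] Size) where

    IsGaugeInvariant : Set (c ⊔ ℓ)
    IsGaugeInvariant =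
      ∀ i j k → CommutativeRing._≈_ 𝒪[1/M] (⟦ restrict[1/_] K 𝓞 M (σ i) ⟧ (q j k)) (q j k)

    q[_] : ∀ i → RingOps.Matrix (Ô i) Size
    q[ i ] = mapᴹ (λ y → fromR i (from𝒪[1/M] i y)) q

    module _ (∇ : VerticalConnection) where

      IsMetric : Set (c ⊔ ℓ ⊔ π)
      IsMetric = ∀ i → IsMetricLift (Ô i) p x[ i ] q[ i ] (R i) (fromR i) (base ∇ i) (deriv ∇ i)

      γ : ∀ i → RingOps.Matrix (Ô i) Size
      γ i = christoffel (Ô i) p x[ i ] q[ i ] (deriv ∇ i)

      IsTorsionFree : Set (c ⊔ ℓ ⊔ π)
      IsTorsionFree = ∀ i j k → CommutativeRing._≈_ (Ô zero)
        (⟦ σÔ⁻¹ i ⟧ (γ i j k)) (⟦ σÔ⁻¹ j ⟧ (γ j i k))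

      -- Exactly one ∇ satisfies this.
      IsLeviCivita : Set (c ⊔ ℓ ⊔ π)
      IsLeviCivita = IsMetric × IsTorsionFree

  module _ (∇ : VerticalConnection) where

    transported : Index → ∣ Ô zero ∣ᴿ → ∣ Ô zero ∣ᴿ
    transported i = conjugate (Ô zero) (Ô i) (σÔ i) (σÔ⁻¹ i) p (deriv ∇ i)

    IsCurvature : (Index → Index → ∣ Ô zero ∣ᴿ → ∣ Ô zero ∣ᴿ) → Set (c ⊔ ℓ ⊔ π)
    IsCurvature = IsCurvatureOf (Ô zero) p transported

{-# OPTIONS --safe #-}
module Submission where

-- Conjugating φⁱ by σᵢ gives Frobenius lifts Φᵢ on A = 𝒪(Ĝ¹), with Φᵢ(x) = x⁽ᵖ⁾ + pΔᵢ. The ring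
-- 𝒪_F/p is perfect (p is unramified), so any two Frobenius lifts on A agree mod p² on the entries
-- of q. Expanding the metric equation mod p² and dividing by p, which is not a zero divisor in A,
-- gives C ≡ Γᵢ + Γᵢᵗ mod p for Γᵢ = Δᵢᵗ Φᵢ(q) x⁽ᵖ⁾. The symmetry of Γᵢⱼₖ in i and j then yields
-- 2Γᵢⱼₖ ≡ Cⱼₖ + Cᵢₖ - Cᵢⱼ. Expanding ΦᵢΦⱼ(x) - ΦⱼΦᵢ(x) mod p² gives Φᵢⱼ ≡ Δⱼ⁽ᵖ⁾ - Δᵢ⁽ᵖ⁾ mod p,
-- whence Rᵢⱼₘₖ ≡ (Γⱼₖₘ - Γᵢₖₘ)ᵖ. At x = 1 the correction term of C vanishes, leaving -δq.

open import Defs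
open import Algebra.Bundles using (CommutativeRing)
open import Algebra.Morphism.Bundles using (RingHomomorphism)
open import Data.Empty using (⊥; ⊥-elim)
open import Data.Fin.Base using (Fin; finToFun; funToFin; combine; remQuot; fromℕ<; zero; suc; toℕ; fromℕ; inject₁; punchIn; punchOut)
open import Data.Integer.Base as ℤ using (ℤ; +_; -[1+_])
import Data.Integer.Properties as ℤ
import Data.Integer.Divisibility as ℤD
import Data.Integer.DivMod as ℤ
open import Data.List.Base using (List; []; _∷_; map)
open import Data.Maybe.Base using (Maybe; just; nothing)
open import Data.Nat.Base as ℕ using (ℕ; zero; suc)
import Data.Nat.Properties as ℕ
import Data.Nat.Divisibility as ℕD
open import Data.Nat.Primality using (Prime; prime⇒nonZero; prime⇒nonTrivial; euclidsLemma)
open import Data.Nat.Combinatorics using (nCn≡1; nCk≡n!/k![n-k]!; k![n∸k]!∣n!) renaming (_C_ to _choose_)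
open import Data.Nat.DivMod using (m/n*n≡m)
import Data.Fin.Properties as Fin
open import Data.Product.Base using (Σ; Σ-syntax; ∃; ∃-syntax; _×_; _,_; proj₁; proj₂)
open import Data.Sum.Base using (_⊎_; inj₁; inj₂)
open import Data.Vec.Functional using (updateAt)
import Data.Vec.Functional.Properties as Vector
open import Level using (Level; _⊔_) renaming (suc to lsuc)
open import Relation.Binary.PropositionalEquality.Core as ≡ using (_≡_; _≢_)
open import Relation.Binary.Definitions using (tri<; tri≈; tri>)
open import Relation.Nullary using (¬_; yes; no)

import Algebra.Properties.AbelianGroup as AbelianGroupProperties
import Algebra.Properties.CommutativeSemiring.Binomial as Binomial
import Algebra.Properties.CommutativeSemiring.Exp as Exp
import Algebra.Properties.Ring as RingProperties
import Algebra.Properties.Semiring.Mult as Mult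
import Algebra.Properties.Semiring.Sum as Sum
import Algebra.Solver.Ring as RingSolver
import Algebra.Solver.Ring.AlmostCommutativeRing as ACR
import Relation.Binary.Reasoning.Setoid as SetoidReasoning

-- Two Frobenius lifts agree mod p² on 𝒪 because each y is s^p + p t there: any lift sends it to
-- s^(p²) + p t^p mod p², a formula that does not mention the lift. Denominators in 𝒪[1/M] are
-- powers of an integer, which every ring endomorphism fixes. Gauge invariance makes all the
-- conjugates Φᵢ act on one matrix q, so that a single δq serves for every i.
--
-- Perfectness is a counting argument. If the p-th power of an element of 𝒪 lies in p𝒪, then
-- Cramer's rule for its Galois conjugates shows that p divides r D for each of its integral
-- coordinates r. Hence Frobenius is injective on the finite ring 𝒪/p.
--
-- Absence of p-torsion has to be carried through localization, polynomial extension and completion.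
-- Polynomials are given by generators and relations, so their coefficients must be recovered before
-- they can be compared.
--
-- For the second congruence, knowing that p T lies in (p, x - 1) says nothing about T. The
-- expansion of p-th powers of sums therefore records in which ideal the quotient of its error by p
-- lies.

private
  variable
    a b c ℓ ℓ₁ ℓ₂ : Level

-- Integer multiples and a ring solver with integer coefficients

module IntegerRing (A : CommutativeRing c ℓ) where
  open RingOps A
  open RingProperties ring
  open AbelianGroupProperties +-abelianGroup using (⁻¹-∙-comm; ⁻¹-involutive; ε⁻¹≈ε)
  open SetoidReasoning setoid

  ⋆1-⊖ : ∀ m n → (m ℤ.⊖ n) ⋆ 1# ≈ m · 1# - n · 1#
  ⋆1-⊖ zero    zero    = sym (-‿inverseʳ 0#)
  ⋆1-⊖ zero    (suc n) = sym (+-identityˡ _)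
  ⋆1-⊖ (suc m) zero    = sym (trans (+-congˡ ε⁻¹≈ε) (+-identityʳ _))
  ⋆1-⊖ (suc m) (suc n) = begin
    (suc m ℤ.⊖ suc n) ⋆ 1#              ≡⟨ ≡.cong (_⋆ 1#) (ℤ.[1+m]⊖[1+n]≡m⊖n m n) ⟩
    (m ℤ.⊖ n) ⋆ 1#                      ≈⟨ ⋆1-⊖ m n ⟩
    m · 1# - n · 1#                     ≈⟨ +-congʳ (+-identityˡ _) ⟨
    0# + m · 1# - n · 1#                ≈⟨ +-congʳ (+-congʳ (-‿inverseʳ 1#)) ⟨
    (1# - 1#) + m · 1# - n · 1#         ≈⟨ +-congʳ (+-assoc 1# (- 1#) (m · 1#)) ⟩
    1# + (- 1# + m · 1#) - n · 1#       ≈⟨ +-congʳ (+-congˡ (+-comm (- 1#) (m · 1#))) ⟩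
    1# + (m · 1# - 1#) - n · 1#         ≈⟨ +-congʳ (+-assoc 1# (m · 1#) (- 1#)) ⟨
    suc m · 1# - 1# - n · 1#            ≈⟨ +-assoc _ _ _ ⟩
    suc m · 1# + (- 1# - n · 1#)        ≈⟨ +-congˡ (⁻¹-∙-comm 1# (n · 1#)) ⟩
    suc m · 1# - suc n · 1#             ∎

  ⋆1-+ : ∀ k l → (k ℤ.+ l) ⋆ 1# ≈ k ⋆ 1# + l ⋆ 1#
  ⋆1-+ (+ m)    (+ n)    = ×-homo-+ 1# m n
  ⋆1-+ (+ m)    -[1+ n ] = ⋆1-⊖ m (suc n)
  ⋆1-+ -[1+ m ] (+ n)    = trans (⋆1-⊖ n (suc m)) (+-comm _ _)
  ⋆1-+ -[1+ m ] -[1+ n ] = begin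
    - (suc (suc (m ℕ.+ n)) · 1#)      ≡⟨ ≡.cong (λ k → - (suc k · 1#)) (ℕ.+-suc m n) ⟨
    - ((suc m ℕ.+ suc n) · 1#)        ≈⟨ -‿cong (×-homo-+ 1# (suc m) (suc n)) ⟩
    - (suc m · 1# + suc n · 1#)       ≈⟨ ⁻¹-∙-comm _ _ ⟨
    - (suc m · 1#) - suc n · 1#       ∎

  ⋆1-neg : ∀ k → (ℤ.- k) ⋆ 1# ≈ - (k ⋆ 1#)
  ⋆1-neg (+ zero)  = sym ε⁻¹≈ε
  ⋆1-neg (+ suc n) = refl
  ⋆1-neg -[1+ n ]  = sym (⁻¹-involutive _)

  private
    ⋆1-*-pos : ∀ m l → (+ m ℤ.* l) ⋆ 1# ≈ (m · 1#) * (l ⋆ 1#)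
    ⋆1-*-pos m (+ n) = begin
      (+ m ℤ.* + n) ⋆ 1#     ≡⟨ ≡.cong (_⋆ 1#) (ℤ.pos-* m n) ⟨
      (m ℕ.* n) · 1#         ≈⟨ ×1-homo-* m n ⟩
      (m · 1#) * (n · 1#)    ∎
    ⋆1-*-pos m -[1+ n ] = begin
      (+ m ℤ.* ℤ.- (+ suc n)) ⋆ 1#    ≡⟨ ≡.cong (_⋆ 1#) (ℤ.neg-distribʳ-* (+ m) (+ suc n)) ⟨
      (ℤ.- (+ m ℤ.* + suc n)) ⋆ 1#    ≈⟨ ⋆1-neg (+ m ℤ.* + suc n) ⟩
      - ((+ m ℤ.* + suc n) ⋆ 1#)      ≈⟨ -‿cong (⋆1-*-pos m (+ suc n)) ⟩
      - ((m · 1#) * (suc n · 1#))     ≈⟨ -‿distribʳ-* _ _ ⟩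
      (m · 1#) * (-[1+ n ] ⋆ 1#)      ∎

  ⋆1-* : ∀ k l → (k ℤ.* l) ⋆ 1# ≈ (k ⋆ 1#) * (l ⋆ 1#)
  ⋆1-* (+ m)    l = ⋆1-*-pos m l
  ⋆1-* -[1+ m ] l = begin
    (ℤ.- (+ suc m) ℤ.* l) ⋆ 1#      ≡⟨ ≡.cong (_⋆ 1#) (ℤ.neg-distribˡ-* (+ suc m) l) ⟨
    (ℤ.- (+ suc m ℤ.* l)) ⋆ 1#      ≈⟨ ⋆1-neg (+ suc m ℤ.* l) ⟩
    - ((+ suc m ℤ.* l) ⋆ 1#)        ≈⟨ -‿cong (⋆1-*-pos (suc m) l) ⟩
    - ((suc m · 1#) * (l ⋆ 1#))     ≈⟨ -‿distribˡ-* _ _ ⟩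
    (-[1+ m ] ⋆ 1#) * (l ⋆ 1#)      ∎

  -- The solver knows only ring operations, so integer multiples enter its equations as products
  -- with the ring element `k ⋆ 1#`.
  ⋆-as-* : ∀ k x → k ⋆ x ≈ (k ⋆ 1#) * x
  ·-as-* : ∀ n x → n · x ≈ (n · 1#) * x
  ·-as-* n x = sym (trans (×-assoc-* n 1# x) (×-congʳ n (*-identityˡ x)))
  ⋆-as-* (+ n)    x = ·-as-* n x
  ⋆-as-* -[1+ n ] x = trans (-‿cong (·-as-* (suc n) x)) (-‿distribˡ-* _ _)

  private
    almostCommutative = ACR.fromCommutativeRing A

    morphism : ℤ.+-*-rawRing ACR.-Raw-AlmostCommutative⟶ almostCommutative
    morphism = record
      { ⟦_⟧    = _⋆ 1#
      ; +-homo = ⋆1-+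
      ; *-homo = ⋆1-*
      ; -‿homo = ⋆1-neg
      ; 0-homo = refl
      ; 1-homo = +-identityʳ 1#
      }

    -- Distinct integers may still coincide in `A`; `nothing` makes no claim about them and costs no
    -- soundness.
    decide : ∀ k l → Maybe (k ⋆ 1# ≈ l ⋆ 1#)
    decide k l with k ℤ.≟ l
    ... | yes ≡.refl = just refl
    ... | no _       = nothing

  open RingSolver ℤ.+-*-rawRing almostCommutative morphism decide public
    using (solve; _:=_; _:+_; _:*_; _:-_; :-_; _:^_)
    renaming (con to :con)

-- Binomial coefficients and p-th powers of a sum

prime∤! : ∀ {p} → Prime p → ∀ {j} → j ℕ.< p → ¬ p ℕD.∣ j ℕ.!
prime∤! {p} pr {zero}  j<p p∣1 = ℕ.<⇒≱ (ℕ.nonTrivial⇒n>1 p {{prime⇒nonTrivial pr}}) (ℕD.∣⇒≤ p∣1)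
prime∤! {p} pr {suc j} j<p p∣j! with euclidsLemma (suc j) (j ℕ.!) pr p∣j!
... | inj₁ p∣1+j = ℕ.<⇒≱ j<p (ℕD.∣⇒≤ p∣1+j)
... | inj₂ p∣j!  = prime∤! pr (ℕ.<-trans (ℕ.n<1+n j) j<p) p∣j!

-- The prime divides p!, which is the binomial coefficient times k! (p - k)!, and it divides neither
-- of these two factorials.
prime∣binomial : ∀ {p} → Prime p → ∀ {k} → 0 ℕ.< k → k ℕ.< p → p ℕD.∣ p choose k
prime∣binomial {p@(suc r)} pr {k} 0<k k<p
  with euclidsLemma (p choose k) (k ℕ.! ℕ.* (p ℕ.∸ k) ℕ.!) pr
         -- With p matched as `suc r`, its factorial is p times r! by computation.
         (≡.subst (p ℕD.∣_) (≡.sym expand) (ℕD.m∣m*n (r ℕ.!)))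
  where
  instance _ = k ℕ.!* (p ℕ.∸ k) !≢0
  expand : (p choose k) ℕ.* (k ℕ.! ℕ.* (p ℕ.∸ k) ℕ.!) ≡ p ℕ.!
  expand = ≡.trans (≡.cong (ℕ._* (k ℕ.! ℕ.* (p ℕ.∸ k) ℕ.!)) (nCk≡n!/k![n-k]! (ℕ.<⇒≤ k<p)))
                   (m/n*n≡m (k![n∸k]!∣n! (ℕ.<⇒≤ k<p)))
... | inj₁ p∣C = p∣C
... | inj₂ p∣k![p-k]! with euclidsLemma (k ℕ.!) ((p ℕ.∸ k) ℕ.!) pr p∣k![p-k]!
...   | inj₁ p∣k! = ⊥-elim (prime∤! pr k<p p∣k!)
...   | inj₂ p∣[p-k]! = ⊥-elim (prime∤! pr (ℕ.∸-monoʳ-< 0<k (ℕ.<⇒≤ k<p)) p∣[p-k]!)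

module PrimePower (A : CommutativeRing c ℓ) {p : ℕ} (p-prime : Prime p) where
  open RingOps A
  open IntegerRing A
  open Sum semiring using (*-distribˡ-sum; sum-init-last)
  open Mult semiring using (×-congˡ; ×-homo-1)
  open Exp commutativeSemiring using (^-congʳ)
  open SetoidReasoning setoid

  -- The factor `x * y` of the error is kept because two later arguments depend on it: with y
  -- divisible by p the error gains a second factor p, and with `x * y` in an ideal the error
  -- divided by p stays in that ideal.
  [x+y]^p : ∀ x y → ∃[ w ] (x + y) ^ p ≈ x ^ p + y ^ p + p · (x * y * w)
  [x+y]^p x y = go p ≡.refl
    where
    -- Both exponents are positive, so one factor x and one factor y split off, while the binomial
    -- coefficient supplies p.
    middle : ∀ k e → 0 ℕ.< k → 0 ℕ.< e → k ℕ.+ e ≡ p → ∃[ w ] (p choose k) · (x ^ k * y ^ e) ≈ p · (x * y * w)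
    middle k@(suc k′) (suc l) 0<k 0<e k+e≡p
      with prime∣binomial p-prime 0<k (≡.subst (k ℕ.<_) k+e≡p (ℕ.m<m+n k 0<e))
    ... | ℕD.divides m C≡m*p = (m · 1#) * (x ^ k′ * y ^ l) , (begin
      (p choose k) · (x ^ k * y ^ suc l)
        ≈⟨ ×-congˡ C≡m*p ⟩
      (m ℕ.* p) · (x ^ k * y ^ suc l)
        ≈⟨ ·-as-* (m ℕ.* p) _ ⟩
      ((m ℕ.* p) · 1#) * (x ^ k * y ^ suc l)
        ≈⟨ *-congʳ (×1-homo-* m p) ⟩
      ((m · 1#) * (p · 1#)) * (x ^ k * y ^ suc l)
        ≈⟨ solve 6 (λ m p x y u v → (m :* p) :* ((x :* u) :* (y :* v)) := p :* (x :* y :* (m :* (u :* v))))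
             refl (m · 1#) (p · 1#) x y (x ^ k′) (y ^ l) ⟩
      (p · 1#) * (x * y * ((m · 1#) * (x ^ k′ * y ^ l)))
        ≈⟨ ·-as-* p _ ⟨
      p · (x * y * ((m · 1#) * (x ^ k′ * y ^ l))) ∎)

    sum-middle : ∀ {n} (v : Fin n → Carrier) → (∀ i → ∃[ w ] v i ≈ p · (x * y * w)) →
                 ∃[ w ] sum v ≈ p · (x * y * w)
    sum-middle v v≈ = sum (λ i → proj₁ (v≈ i)) , (begin
      sum v
        ≈⟨ sum-cong-≋ (λ i → trans (proj₂ (v≈ i)) (trans (·-as-* p _) (sym (*-assoc (p · 1#) (x * y) _)))) ⟩
      sum (λ i → (p · 1#) * (x * y) * proj₁ (v≈ i))
        ≈⟨ *-distribˡ-sum ((p · 1#) * (x * y)) (λ i → proj₁ (v≈ i)) ⟨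
      (p · 1#) * (x * y) * sum (λ i → proj₁ (v≈ i))
        ≈⟨ *-assoc _ _ _ ⟩
      (p · 1#) * ((x * y) * sum (λ i → proj₁ (v≈ i)))
        ≈⟨ ·-as-* p _ ⟨
      p · (x * y * sum (λ i → proj₁ (v≈ i))) ∎)

    go : ∀ n → n ≡ p → ∃[ w ] (x + y) ^ p ≈ x ^ p + y ^ p + p · (x * y * w)
    go zero    ≡.refl = ⊥-elim (ℕ.≢-nonZero⁻¹ 0 {{prime⇒nonZero p-prime}} ≡.refl)
    go (suc r) ≡.refl = w , (begin
      (x + y) ^ p                            ≈⟨ Binomial.theorem commutativeSemiring p x y ⟩
      term zero + sum (λ i → term (suc i))   ≈⟨ +-cong first (trans (sum-init-last (λ i → term (suc i))) (+-cong w≈ final)) ⟩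
      y ^ p + (p · (x * y * w) + x ^ p)      ≈⟨ solve 3 (λ a b c → a :+ (b :+ c) := c :+ a :+ b) refl (y ^ p) (p · (x * y * w)) (x ^ p) ⟩
      x ^ p + y ^ p + p · (x * y * w)        ∎)
      where
      term : Fin (suc p) → Carrier
      term k = (p choose toℕ k) · (x ^ toℕ k * y ^ (p ℕ.∸ toℕ k))

      first : term zero ≈ y ^ p
      first = trans (×-homo-1 _) (*-identityˡ _)

      final : term (suc (fromℕ r)) ≈ x ^ p
      final = begin
        term (suc (fromℕ r))
          ≡⟨ ≡.cong (λ k → (p choose suc k) · (x ^ suc k * y ^ (r ℕ.∸ k))) (Fin.toℕ-fromℕ r) ⟩
        (p choose p) · (x ^ p * y ^ (r ℕ.∸ r))
          ≈⟨ trans (×-congˡ (nCn≡1 p)) (×-homo-1 _) ⟩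
        x ^ p * y ^ (r ℕ.∸ r)
          ≈⟨ *-congˡ (^-congʳ y (ℕ.n∸n≡0 r)) ⟩
        x ^ p * 1#
          ≈⟨ *-identityʳ _ ⟩
        x ^ p ∎

      middle-term : ∀ i → ∃[ w ] term (suc (inject₁ i)) ≈ p · (x * y * w)
      middle-term i = middle k (p ℕ.∸ k) (ℕ.s≤s ℕ.z≤n) (ℕ.m<n⇒0<n∸m k<p) (ℕ.m+[n∸m]≡n (ℕ.<⇒≤ k<p))
        where
        k = suc (toℕ (inject₁ i))
        k<p : k ℕ.< p
        k<p = ℕ.s≤s (≡.subst (ℕ._< r) (≡.sym (Fin.toℕ-inject₁ i)) (Fin.toℕ<n i))

      middle-sum : ∃[ w ] sum (λ i → term (suc (inject₁ i))) ≈ p · (x * y * w)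
      middle-sum = sum-middle _ middle-term
      w = proj₁ middle-sum
      w≈ = proj₂ middle-sum

-- Congruences modulo an ideal

record Ideal (A : CommutativeRing c ℓ) (i : Level) : Set (c ⊔ ℓ ⊔ lsuc i) where
  open CommutativeRing A
  field
    Mem      : Carrier → Set i
    Mem-resp : ∀ {x y} → x ≈ y → Mem x → Mem y
    0-mem    : Mem 0#
    +-mem    : ∀ {x y} → Mem x → Mem y → Mem (x + y)
    *-mem    : ∀ x {y} → Mem y → Mem (x * y)

module Congruence {i} (A : CommutativeRing c ℓ) (I : Ideal A i) where
  open RingOps A
  open RingProperties ring
  open IntegerRing A
  open Ideal I

  infix 4 _∼_

  _∼_ : Carrier → Carrier → Set i
  x ∼ y = Mem (x - y)

  ≈⇒∼ : ∀ {x y} → x ≈ y → x ∼ y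
  ≈⇒∼ {x} {y} e = Mem-resp (sym (trans (+-congʳ e) (-‿inverseʳ y))) 0-mem

  private
    neg-mem : ∀ {x} → Mem x → Mem (- x)
    neg-mem x∈ = Mem-resp (-1*x≈-x _) (*-mem (- 1#) x∈)

    *-memˡ : ∀ x {y} → Mem y → Mem (y * x)
    *-memˡ x y∈ = Mem-resp (*-comm x _) (*-mem x y∈)

  sum-mem : ∀ {n} (v : Fin n → Carrier) → (∀ i → Mem (v i)) → Mem (sum v)
  sum-mem {zero}  v v∈ = 0-mem
  sum-mem {suc n} v v∈ = +-mem (v∈ zero) (sum-mem (λ i → v (suc i)) (λ i → v∈ (suc i)))

  -- The carrier stays and only the equality is coarsened, so no quotient map intervenes and setoid
  -- reasoning applies to congruences. For the ideal `multiples A m` this equality unfolds to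
  -- `_≡_[mod m ]`.
  Quotient : CommutativeRing c i
  Quotient = record
    { Carrier = Carrier
    ; _≈_ = _∼_
    ; _+_ = _+_
    ; _*_ = _*_
    ; -_  = -_
    ; 0#  = 0#
    ; 1#  = 1#
    ; isCommutativeRing = record
      { isRing = record
        { +-isAbelianGroup = record
          { isGroup = record
            { isMonoid = record
              { isSemigroup = record
                { isMagma = record
                  { isEquivalence = record
                    { refl  = ≈⇒∼ refl
                    ; sym   = λ {x} {y} e → Mem-resp (solve 2 (λ x y → :- (x :- y) := y :- x) refl x y) (neg-mem e)
                    ; trans = λ {x} {y} {z} d e → Mem-resp (solve 3 (λ x y z → (x :- y) :+ (y :- z) := x :- z) refl x y z) (+-mem d e)
                    }
                  ; ∙-cong = λ {x} {x′} {y} {y′} d e → Mem-resp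
                      (solve 4 (λ x x′ y y′ → (x :- x′) :+ (y :- y′) := (x :+ y) :- (x′ :+ y′)) refl x x′ y y′) (+-mem d e)
                  }
                ; assoc = λ x y z → ≈⇒∼ (+-assoc x y z)
                }
              ; identity = (λ x → ≈⇒∼ (+-identityˡ x)) , (λ x → ≈⇒∼ (+-identityʳ x))
              }
            ; inverse = (λ x → ≈⇒∼ (-‿inverseˡ x)) , (λ x → ≈⇒∼ (-‿inverseʳ x))
            ; ⁻¹-cong = λ {x} {y} e → Mem-resp (solve 2 (λ x y → :- (x :- y) := :- x :- :- y) refl x y) (neg-mem e)
            }
          ; comm = λ x y → ≈⇒∼ (+-comm x y)
          }
        ; *-cong = λ {x} {x′} {y} {y′} d e → Mem-resp
            (solve 4 (λ x x′ y y′ → (x :- x′) :* y :+ x′ :* (y :- y′) := x :* y :- x′ :* y′) refl x x′ y y′)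
            (+-mem (*-memˡ y d) (*-mem x′ e))
        ; *-assoc = λ x y z → ≈⇒∼ (*-assoc x y z)
        ; *-identity = (λ x → ≈⇒∼ (*-identityˡ x)) , (λ x → ≈⇒∼ (*-identityʳ x))
        ; distrib = (λ x y z → ≈⇒∼ (distribˡ x y z)) , (λ x y z → ≈⇒∼ (distribʳ x y z))
        }
      ; *-comm = λ x y → ≈⇒∼ (*-comm x y)
      }
    }

  module Q = CommutativeRing Quotient

  mem⇒∼0 : ∀ {x} → Mem x → x ∼ 0#
  mem⇒∼0 = Mem-resp (sym (x-0#≈x _))
    where
    x-0#≈x : ∀ x → x - 0# ≈ x
    x-0#≈x x = trans (+-congˡ -0#≈0#) (+-identityʳ x)

  sum-∼ : ∀ {n} {v w : Fin n → Carrier} → (∀ i → v i ∼ w i) → sum v ∼ sum w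
  sum-∼ {zero}  e = Q.refl
  sum-∼ {suc n} e = Q.+-cong (e zero) (sum-∼ (λ i → e (suc i)))

  ^-∼ : ∀ n {x y} → x ∼ y → x ^ n ∼ y ^ n
  ^-∼ zero    e = Q.refl
  ^-∼ (suc n) e = Q.*-cong e (^-∼ n e)

  ⊗-∼ : ∀ {n} {X X′ Y Y′ : Matrix n} → (∀ j k → X j k ∼ X′ j k) → (∀ j k → Y j k ∼ Y′ j k) →
        ∀ j k → (X ⊗ Y) j k ∼ (X′ ⊗ Y′) j k
  ⊗-∼ d e j k = sum-∼ λ l → Q.*-cong (d j l) (e l k)

module _ (A : CommutativeRing c ℓ) where
  open RingOps A
  open IntegerRing A

  multiples : ℕ → Ideal A (c ⊔ ℓ)
  multiples m = record
    { Mem      = λ x → ∃[ w ] x ≈ m · w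
    ; Mem-resp = λ { x≈y (w , e) → w , trans (sym x≈y) e }
    ; 0-mem    = 0# , trans (sym (zeroʳ (m · 1#))) (sym (·-as-* m 0#))
    ; +-mem    = λ { (v , d) (w , e) → v + w , trans (+-cong (trans d (·-as-* m v)) (trans e (·-as-* m w)))
                     (trans (sym (distribˡ _ v w)) (sym (·-as-* m (v + w)))) }
    ; *-mem    = λ { x (w , e) → x * w , trans (*-congˡ e) (×-comm-* m x w) }
    }

  TorsionFree : ℕ → Set (c ⊔ ℓ)
  TorsionFree m = ∀ x → m · x ≈ 0# → x ≈ 0#

-- Congruences for p-th powers modulo p and p²

module FrobeniusCongruences (A : CommutativeRing c ℓ) {p : ℕ} (p-prime : Prime p) where
  open RingOps A
  open IntegerRing A
  open PrimePower A p-prime public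
  open Sum semiring using (*-distribˡ-sum)
  open Congruence A (multiples A p)

  0^p : 0# ^ p ≈ 0#
  0^p = go p {{prime⇒nonZero p-prime}}
    where
    go : ∀ n .{{_ : ℕ.NonZero n}} → 0# ^ n ≈ 0#
    go (suc n) = zeroˡ _

  frobenius-+ : ∀ x y → (x + y) ^ p ≡ x ^ p + y ^ p [mod p ]
  frobenius-+ x y with [x+y]^p x y
  ... | w , e = x * y * w , trans (+-congʳ e) (solve 2 (λ a b → a :+ b :- a := b) refl _ _)

  -- Each binomial step contributes an error p times a multiple of `v zero` times the remaining sum,
  -- hence p times a combination of products of distinct summands. The ideal is arbitrary so that T
  -- can later be located in (p, x - 1).
  sum-^p : ∀ {i} (I : Ideal A i) → ∀ {n} (v : Fin n → Carrier) →
           (∀ j k → j ≢ k → Ideal.Mem I (v j * v k)) →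
           ∃[ t ] Ideal.Mem I t × sum v ^ p ≈ sum (λ j → v j ^ p) + p · t
  sum-^p I {zero} v v∈ = 0# , 0-mem , trans 0^p (sym (trans (+-identityˡ _) (trans (·-as-* p 0#) (zeroʳ _))))
    where open Ideal I
  sum-^p I {suc n} v v∈ with sum-^p I (λ j → v (suc j)) (λ j k j≢k → v∈ (suc j) (suc k) (λ e → j≢k (Fin.suc-injective e)))
                           | [x+y]^p (v zero) (sum (λ j → v (suc j)))
  ... | t , t∈ , t≈ | w , w≈ = r * w + t , +-mem (Mem-resp (*-comm w r) (*-mem w r∈)) t∈ , (begin
    (v zero + s) ^ p                                    ≈⟨ w≈ ⟩
    v zero ^ p + s ^ p + p · (r * w)                    ≈⟨ +-cong (+-congˡ t≈) (·-as-* p _) ⟩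
    v zero ^ p + (s′ + p · t) + (p · 1#) * (r * w)      ≈⟨ +-congʳ (+-congˡ (+-congˡ (·-as-* p t))) ⟩
    v zero ^ p + (s′ + (p · 1#) * t) + (p · 1#) * (r * w)
      ≈⟨ solve 5 (λ a s p t u → a :+ (s :+ p :* t) :+ p :* u := a :+ s :+ p :* (u :+ t)) refl (v zero ^ p) s′ (p · 1#) t (r * w) ⟩
    v zero ^ p + s′ + (p · 1#) * (r * w + t)            ≈⟨ +-congˡ (·-as-* p _) ⟨
    v zero ^ p + s′ + p · (r * w + t)                   ∎)
    where
    open Ideal I
    open SetoidReasoning setoid
    s  = sum (λ j → v (suc j))
    s′ = sum (λ j → v (suc j) ^ p)
    r  = v zero * s
    r∈ : Mem r
    r∈ = Mem-resp (sym (*-distribˡ-sum (v zero) (λ j → v (suc j))))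
           (Congruence.sum-mem A I _ (λ j → v∈ zero (suc j) (λ ())))

  frobenius-sum : ∀ {n} (v : Fin n → Carrier) → sum v ^ p ≡ sum (λ j → v j ^ p) [mod p ]
  frobenius-sum {zero}  v = ≈⇒∼ 0^p
  frobenius-sum {suc n} v = Q.trans (frobenius-+ (v zero) _) (Q.+-congˡ {v zero ^ p} (frobenius-sum (λ j → v (suc j))))

  -- With x = y + p z, the mixed binomial terms carry one p from the coefficient and one from p z,
  -- and the last term (p z)^p carries two since p is at least 2.
  ^p-lift : ∀ {x y} → x ≡ y [mod p ] → x ^ p ≡ y ^ p [mod p ℕ.* p ]
  ^p-lift {x} {y} (z , e) = go p ≡.refl
    where
    open SetoidReasoning setoid
    P = p · 1#
    go : ∀ n → n ≡ p → x ^ p ≡ y ^ p [mod p ℕ.* p ]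
    go zero          ≡.refl = ⊥-elim (ℕ.≢-nonZero⁻¹ 0 {{prime⇒nonZero p-prime}} ≡.refl)
    go (suc zero)    ≡.refl = ⊥-elim (ℕ.<-irrefl ≡.refl (ℕ.nonTrivial⇒n>1 1 {{prime⇒nonTrivial p-prime}}))
    -- Writing p as `suc (suc r)` exposes two factors `P * z` of the last term; `u` is what remains
    -- of it.
    go (suc (suc r)) ≡.refl = z * z * u + y * z * w , (begin
      x ^ p - y ^ p
        ≈⟨ +-congʳ (^-congˡ p (trans (solve 2 (λ x y → x := y :+ (x :- y)) refl x y) (+-congˡ (trans e (·-as-* p z))))) ⟩
      (y + P * z) ^ p - y ^ p
        ≈⟨ +-congʳ (trans (proj₂ ([x+y]^p y (P * z))) (+-congˡ (·-as-* p _))) ⟩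
      y ^ p + (P * z) ^ p + P * (y * (P * z) * w) - y ^ p
        ≈⟨ solve 6 (λ a P z u y w → a :+ P :* z :* (P :* z :* u) :+ P :* (y :* (P :* z) :* w) :- a :=
                     P :* P :* (z :* z :* u :+ y :* z :* w)) refl (y ^ p) P z u y w ⟩
      P * P * (z * z * u + y * z * w)
        ≈⟨ *-congʳ (×1-homo-* p p) ⟨
      ((p ℕ.* p) · 1#) * (z * z * u + y * z * w)
        ≈⟨ ·-as-* (p ℕ.* p) _ ⟨
      (p ℕ.* p) · (z * z * u + y * z * w) ∎)
      where
      u = (P * z) ^ r
      w = proj₁ ([x+y]^p y (P * z))

  scale-p : ∀ {x y} → x ≡ y [mod p ] → (p · 1#) * x ≡ (p · 1#) * y [mod p ℕ.* p ]
  scale-p {x} {y} (w , e) = w , (begin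
    P * x - P * y        ≈⟨ solve 3 (λ P x y → P :* x :- P :* y := P :* (x :- y)) refl P x y ⟩
    P * (x - y)          ≈⟨ *-congˡ (trans e (·-as-* p w)) ⟩
    P * (P * w)          ≈⟨ *-assoc P P w ⟨
    P * P * w            ≈⟨ *-congʳ (×1-homo-* p p) ⟨
    ((p ℕ.* p) · 1#) * w ≈⟨ ·-as-* (p ℕ.* p) w ⟨
    (p ℕ.* p) · w        ∎)
    where
    open SetoidReasoning setoid
    P = p · 1#

-- Matrix products of the form uᵗ q v

module TripleProduct (A : CommutativeRing c ℓ) where
  open RingOps A
  open IntegerRing A
  open Sum semiring using (*-distribˡ-sum; *-distribʳ-sum; ∑-distrib-+; ∑-comm)
  open SetoidReasoning setoid

  sum-zero : ∀ {n} {v : Fin n → Carrier} → (∀ i → v i ≈ 0#) → sum v ≈ 0#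
  sum-zero {zero}  e = refl
  sum-zero {suc n} e = trans (+-cong (e zero) (sum-zero (λ i → e (suc i)))) (+-identityˡ _)

  infix 9 ∬_

  -- The outer sum runs over the second index because `u ᵗ ⊗ q ⊗ v` associates to the left.
  ∬_ : ∀ {n} → Matrix n → Carrier
  ∬ X = sum λ b → sum λ a → X a b

  ∬-cong : ∀ {n} {X Y : Matrix n} → X ≋ Y → ∬ X ≈ ∬ Y
  ∬-cong e = sum-cong-≋ λ b → sum-cong-≋ λ a → e a b

  ∬-+ : ∀ {n} (X Y : Matrix n) → ∬ (λ a b → X a b + Y a b) ≈ ∬ X + ∬ Y
  ∬-+ X Y = trans (sum-cong-≋ λ b → ∑-distrib-+ (λ a → X a b) (λ a → Y a b)) (∑-distrib-+ (λ b → sum λ a → X a b) (λ b → sum λ a → Y a b))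

  ∬-* : ∀ {n} r (X : Matrix n) → ∬ (λ a b → r * X a b) ≈ r * ∬ X
  ∬-* r X = sym (trans (*-distribˡ-sum r (λ b → sum λ a → X a b)) (sum-cong-≋ λ b → *-distribˡ-sum r (λ a → X a b)))

  triple≈∬ : ∀ {n} (u q v : Matrix n) j k → (u ᵗ ⊗ q ⊗ v) j k ≈ ∬ (λ a b → u a j * q a b * v b k)
  triple≈∬ u q v j k = sum-cong-≋ λ b → *-distribʳ-sum (v b k) (λ a → u a j * q a b)

  triple-transpose : ∀ {n} (u q v : Matrix n) j k → (u ᵗ ⊗ q ⊗ v) j k ≈ (v ᵗ ⊗ q ᵗ ⊗ u) k j
  triple-transpose u q v j k = begin
    (u ᵗ ⊗ q ⊗ v) j k                     ≈⟨ triple≈∬ u q v j k ⟩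
    ∬ (λ a b → u a j * q a b * v b k)     ≈⟨ ∑-comm (λ b a → u a j * q a b * v b k) ⟩
    ∬ (λ b a → u a j * q a b * v b k)     ≈⟨ ∬-cong (λ b a → solve 3 (λ u q v → u :* q :* v := v :* q :* u) refl (u a j) (q a b) (v b k)) ⟩
    ∬ (λ b a → v b k * q a b * u a j)     ≈⟨ triple≈∬ v (q ᵗ) u k j ⟨
    (v ᵗ ⊗ q ᵗ ⊗ u) k j                   ∎

  ⊗-cong : ∀ {n} {X X′ Y Y′ : Matrix n} → X ≋ X′ → Y ≋ Y′ → X ⊗ Y ≋ X′ ⊗ Y′
  ⊗-cong d e j k = sum-cong-≋ λ l → *-cong (d j l) (e l k)

  triple-cong : ∀ {n} {u u′ q q′ v v′ : Matrix n} → u ≋ u′ → q ≋ q′ → v ≋ v′ → u ᵗ ⊗ q ⊗ v ≋ u′ ᵗ ⊗ q′ ⊗ v′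
  triple-cong d e f = ⊗-cong (⊗-cong (λ j k → d k j) e) f

  -- Used with r = p for Φ(x) = x⁽ᵖ⁾ + pΔ: the two cross terms become a Christoffel symbol and its
  -- transpose, and the term with two factors r disappears mod p².
  triple-expand : ∀ {n} r (u u′ q v v′ : Matrix n) j k →
    ((λ a b → u a b + r * u′ a b) ᵗ ⊗ q ⊗ (λ a b → v a b + r * v′ a b)) j k ≈
    (u ᵗ ⊗ q ⊗ v) j k + r * ((u′ ᵗ ⊗ q ⊗ v) j k + (u ᵗ ⊗ q ⊗ v′) j k + r * (u′ ᵗ ⊗ q ⊗ v′) j k)
  triple-expand {n} r u u′ q v v′ j k = begin
    ((λ a b → u a b + r * u′ a b) ᵗ ⊗ q ⊗ (λ a b → v a b + r * v′ a b)) j k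
      ≈⟨ triple≈∬ (λ a b → u a b + r * u′ a b) q (λ a b → v a b + r * v′ a b) j k ⟩
    ∬ (λ a b → (u a j + r * u′ a j) * q a b * (v b k + r * v′ b k))
      ≈⟨ ∬-cong (λ a b → solve 6 (λ r u u′ q v v′ → (u :+ r :* u′) :* q :* (v :+ r :* v′) :=
           u :* q :* v :+ r :* (u′ :* q :* v :+ u :* q :* v′ :+ r :* (u′ :* q :* v′)))
           refl r (u a j) (u′ a j) (q a b) (v b k) (v′ b k)) ⟩
    ∬ (λ a b → I u v a b + r * (I u′ v a b + I u v′ a b + r * I u′ v′ a b))
      ≈⟨ trans (∬-+ (I u v) (λ a b → r * (I u′ v a b + I u v′ a b + r * I u′ v′ a b)))
         (+-congˡ (trans (∬-* r (λ a b → I u′ v a b + I u v′ a b + r * I u′ v′ a b))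
         (*-congˡ (trans (∬-+ (λ a b → I u′ v a b + I u v′ a b) (λ a b → r * I u′ v′ a b))
         (+-cong (∬-+ (I u′ v) (I u v′)) (∬-* r (I u′ v′)))))))  ⟩
    ∬ I u v + r * (∬ I u′ v + ∬ I u v′ + r * ∬ I u′ v′)
      ≈⟨ +-cong (triple≈∬ u q v j k) (*-congˡ (+-cong (+-cong (triple≈∬ u′ q v j k) (triple≈∬ u q v′ j k)) (*-congˡ (triple≈∬ u′ q v′ j k)))) ⟨
    (u ᵗ ⊗ q ⊗ v) j k + r * ((u′ ᵗ ⊗ q ⊗ v) j k + (u ᵗ ⊗ q ⊗ v′) j k + r * (u′ ᵗ ⊗ q ⊗ v′) j k) ∎
    where
    I : Matrix n → Matrix n → Matrix n
    I u v a b = u a j * q a b * v b k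

  triple-linear : ∀ {n} r (u q q′ v : Matrix n) j k →
    (u ᵗ ⊗ (λ a b → q a b + r * q′ a b) ⊗ v) j k ≈ (u ᵗ ⊗ q ⊗ v) j k + r * (u ᵗ ⊗ q′ ⊗ v) j k
  triple-linear r u q q′ v j k = begin
    (u ᵗ ⊗ (λ a b → q a b + r * q′ a b) ⊗ v) j k
      ≈⟨ triple≈∬ u _ v j k ⟩
    ∬ (λ a b → u a j * (q a b + r * q′ a b) * v b k)
      ≈⟨ ∬-cong (λ a b → solve 5 (λ r u q q′ v → u :* (q :+ r :* q′) :* v := u :* q :* v :+ r :* (u :* q′ :* v))
           refl r (u a j) (q a b) (q′ a b) (v b k)) ⟩
    ∬ (λ a b → u a j * q a b * v b k + r * (u a j * q′ a b * v b k))
      ≈⟨ trans (∬-+ (λ a b → u a j * q a b * v b k) (λ a b → r * (u a j * q′ a b * v b k)))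
               (+-congˡ (∬-* r (λ a b → u a j * q′ a b * v b k))) ⟩
    ∬ (λ a b → u a j * q a b * v b k) + r * ∬ (λ a b → u a j * q′ a b * v b k)
      ≈⟨ +-cong (triple≈∬ u q v j k) (*-congˡ (triple≈∬ u q′ v j k)) ⟨
    (u ᵗ ⊗ q ⊗ v) j k + r * (u ᵗ ⊗ q′ ⊗ v) j k ∎

  triple-difference : ∀ {n} (u q v v′ : Matrix n) j k →
    (u ᵗ ⊗ q ⊗ (λ a b → v a b - v′ a b)) j k ≈ (u ᵗ ⊗ q ⊗ v) j k - (u ᵗ ⊗ q ⊗ v′) j k
  triple-difference u q v v′ j k = begin
    (u ᵗ ⊗ q ⊗ (λ a b → v a b - v′ a b)) j k
      -- The difference is rewritten as a sum with coefficient -1, in the form in which the solver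
      -- interprets this constant, so that additivity and scaling of sums apply.
      ≈⟨ sum-cong-≋ (λ b → solve 3 (λ y v v′ → y :* (v :- v′) := y :* v :+ :- :con ℤ.1ℤ :* (y :* v′)) refl ((u ᵗ ⊗ q) j b) (v b k) (v′ b k)) ⟩
    sum (λ b → (u ᵗ ⊗ q) j b * v b k + - (ℤ.1ℤ ⋆ 1#) * ((u ᵗ ⊗ q) j b * v′ b k))
      ≈⟨ trans (∑-distrib-+ (λ b → (u ᵗ ⊗ q) j b * v b k) (λ b → - (ℤ.1ℤ ⋆ 1#) * ((u ᵗ ⊗ q) j b * v′ b k))) (+-congˡ (sym (*-distribˡ-sum _ (λ b → (u ᵗ ⊗ q) j b * v′ b k)))) ⟩
    (u ᵗ ⊗ q ⊗ v) j k + - (ℤ.1ℤ ⋆ 1#) * (u ᵗ ⊗ q ⊗ v′) j k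
      ≈⟨ solve 2 (λ y z → y :+ :- :con ℤ.1ℤ :* z := y :- z) refl _ _ ⟩
    (u ᵗ ⊗ q ⊗ v) j k - (u ᵗ ⊗ q ⊗ v′) j k ∎

  sum-𝟙 : ∀ {n} (v : Fin n → Carrier) k → sum (λ j → v j * 𝟙 j k) ≈ v k
  sum-𝟙 {suc n} v zero    = trans (+-cong (*-identityʳ _) (sum-zero (λ j → zeroʳ (v (suc j))))) (+-identityʳ _)
  sum-𝟙 {suc n} v (suc k) = trans (+-cong (zeroʳ _) (sum-𝟙 (λ j → v (suc j)) k)) (+-identityˡ _)

  triple-𝟙 : ∀ {n} (q : Matrix n) j k → (𝟙 ᵗ ⊗ q ⊗ 𝟙) j k ≈ q j k
  triple-𝟙 q j k = trans (sum-𝟙 (λ b → (𝟙 ᵗ ⊗ q) j b) k)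
    (trans (sum-cong-≋ (λ a → *-comm (𝟙 a j) (q a k))) (sum-𝟙 (λ a → q a k) j))

  𝟙-offDiagonal : ∀ {n} {j k : Fin n} → j ≢ k → 𝟙 j k ≈ 0#
  𝟙-offDiagonal {j = zero}  {zero}  j≢k = ⊥-elim (j≢k ≡.refl)
  𝟙-offDiagonal {j = zero}  {suc k} j≢k = refl
  𝟙-offDiagonal {j = suc j} {zero}  j≢k = refl
  𝟙-offDiagonal {j = suc j} {suc k} j≢k = 𝟙-offDiagonal {j = j} {k} (λ { ≡.refl → j≢k ≡.refl })

-- The first curvature congruence, for several Frobenius lifts on one ring

module _ (A : CommutativeRing c ℓ) {p : ℕ} (p-prime : Prime p) (torsionFree : TorsionFree A p) {n : ℕ} where
  open RingOps A

  -- The connection appears here after transport to a single ring. `Φ-q` has the same `dq` for every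
  -- i, which is possible because it is required only mod p²; the metric and torsion conditions are
  -- exact.
  module CurvatureCongruence
    (½ : Carrier) (½*2≈1 : ½ * (1# + 1#) ≈ 1#)
    (x q dq : Matrix n) (q-sym : q ᵗ ≋ q)
    (Φ : Fin n → Hom A A)
    (Φ-lift : ∀ i f → ⟦ Φ i ⟧ f ≡ f ^ p [mod p ])
    (Δ : Fin n → Matrix n)
    (Φ-x : ∀ i j k → ⟦ Φ i ⟧ (x j k) ≈ x j k ^ p + p · Δ i j k)
    (Φ-q : ∀ i j k → ⟦ Φ i ⟧ (q j k) ≡ q j k ^ p + p · dq j k [mod p ℕ.* p ])
    (metric : ∀ i j k → (mapᴹ ⟦ Φ i ⟧ x ᵗ ⊗ mapᴹ ⟦ Φ i ⟧ q ⊗ mapᴹ ⟦ Φ i ⟧ x) j k ≈ (x ᵗ ⊗ q ⊗ x) j k ^ p)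
    (torsion : ∀ i j k → (Δ i ᵗ ⊗ mapᴹ ⟦ Φ i ⟧ q ⊗ x ⁽ p ⁾) j k ≈ (Δ j ᵗ ⊗ mapᴹ ⟦ Φ j ⟧ q ⊗ x ⁽ p ⁾) i k)
    (T : Matrix n) (isCorrection : IsCorrection A p x q T)
    where

    open RingProperties ring using (-0#≈0#; x∙y⁻¹≈ε⇒x≈y)
    open IntegerRing A
    open TripleProduct A
    open FrobeniusCongruences A p-prime
    open Exp commutativeSemiring using (^-assocʳ; ^-distrib-*; ^-congʳ)
    open Sum semiring using (∑-distrib-+; *-distribˡ-sum)

    private
      module P = Congruence A (multiples A p)
      module P² = Congruence A (multiples A (p ℕ.* p))

      P : Carrier
      P = p · 1#

      -- Torsion freeness is applied to `x - y - P * w`. This turns identities mod p², where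
      -- products of two multiples of p vanish, into congruences mod p.
      cancel-p : ∀ {x y} → P * x ≡ P * y [mod p ℕ.* p ] → x ≡ y [mod p ]
      cancel-p {x} {y} (w , e) = w , trans (x∙y⁻¹≈ε⇒x≈y (x - y) (P * w) (torsionFree _ (begin
          p · (x - y - P * w)       ≈⟨ ·-as-* p _ ⟩
          P * (x - y - P * w)       ≈⟨ solve 4 (λ P x y w → P :* (x :- y :- P :* w) := (P :* x :- P :* y) :- P :* P :* w) refl P x y w ⟩
          P * x - P * y - P * P * w ≈⟨ +-congʳ (trans e (trans (·-as-* (p ℕ.* p) w) (*-congʳ (×1-homo-* p p)))) ⟩
          P * P * w - P * P * w     ≈⟨ -‿inverseʳ _ ⟩
          0#                        ∎))) (sym (·-as-* p w))
        where open SetoidReasoning setoid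

      Q : Fin n → Matrix n
      Q i = mapᴹ ⟦ Φ i ⟧ q

      Γ : Fin n → Matrix n
      Γ i = Δ i ᵗ ⊗ Q i ⊗ x ⁽ p ⁾

      -- `C` unfolds to the same expression as `C-matrix`, so the results below apply to the matrix
      -- of the theorem without conversion.
      E C : Matrix n
      E = x ⁽ p ⁾ ᵗ ⊗ dq ⊗ x ⁽ p ⁾
      C j k = - E j k + T j k

      -- Symmetry of q identifies the second cross term of the metric equation with the transposed
      -- Christoffel symbol.
      Γ-transpose : ∀ i j k → (x ⁽ p ⁾ ᵗ ⊗ Q i ⊗ Δ i) j k ≈ Γ i k j
      Γ-transpose i j k = trans (triple-transpose (x ⁽ p ⁾) (Q i) (Δ i) j k)
        (triple-cong {u = Δ i} {v = x ⁽ p ⁾} (λ _ _ → refl) (λ a b → RingHomomorphism.⟦⟧-cong (Φ i) (q-sym a b)) (λ _ _ → refl) k j)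

    -- Arithmetic counterpart of the classical compatibility of a connection with a metric, where
    -- Γᵢⱼₖ + Γᵢₖⱼ is the derivative of the metric in direction i. Here the left side is the same in
    -- all directions.
    metric-mod-p : ∀ i j k → C j k ≡ Γ i j k + Γ i k j [mod p ]
    metric-mod-p i j k = P.Q.trans
      (P.≈⇒∼ (+-comm (- E j k) (T j k)))
      (P.Q.trans (P.Q.+-congʳ {x = - E j k} (cancel-p expansion))
      (P.≈⇒∼ (solve 2 (λ e g → e :+ g :- e := g) refl (E j k) (Γ i j k + Γ i k j))))
      where
      open SetoidReasoning P².Q.setoid
      N Z D : Carrier
      N = (x ᵗ ⊗ q ⊗ x) j k ^ p
      Z = (x ⁽ p ⁾ ᵗ ⊗ q ⁽ p ⁾ ⊗ x ⁽ p ⁾) j k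
      D = (Δ i ᵗ ⊗ Q i ⊗ Δ i) j k

      Φ-x′ : mapᴹ ⟦ Φ i ⟧ x ≋ (λ a b → (x ⁽ p ⁾) a b + P * Δ i a b)
      Φ-x′ a b = trans (Φ-x i a b) (+-congˡ (·-as-* p _))

      base : (x ⁽ p ⁾ ᵗ ⊗ Q i ⊗ x ⁽ p ⁾) j k ≡ Z + P * E j k [mod p ℕ.* p ]
      base = P².Q.trans
        (P².⊗-∼ {Y = x ⁽ p ⁾} (P².⊗-∼ {X = x ⁽ p ⁾ ᵗ} (λ _ _ → P².Q.refl)
          (λ a b → P².Q.trans (Φ-q i a b) (P².≈⇒∼ (+-congˡ (·-as-* p _))))) (λ _ _ → P².Q.refl) j k)
        (P².≈⇒∼ (triple-linear P (x ⁽ p ⁾) (q ⁽ p ⁾) dq (x ⁽ p ⁾) j k))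

      expansion : P * T j k ≡ P * (E j k + (Γ i j k + Γ i k j)) [mod p ℕ.* p ]
      expansion = begin
        P * T j k
          ≈⟨ P².≈⇒∼ (sym (·-as-* p _)) ⟩
        p · T j k
          ≈⟨ P².≈⇒∼ (isCorrection j k) ⟩
        N - Z
          ≈⟨ P².≈⇒∼ (+-congʳ (trans (sym (metric i j k)) (trans (triple-cong {q = Q i} Φ-x′ (λ _ _ → refl) Φ-x′ j k)
               (triple-expand P (x ⁽ p ⁾) (Δ i) (Q i) (x ⁽ p ⁾) (Δ i) j k)))) ⟩
        (x ⁽ p ⁾ ᵗ ⊗ Q i ⊗ x ⁽ p ⁾) j k + P * (Γ i j k + (x ⁽ p ⁾ ᵗ ⊗ Q i ⊗ Δ i) j k + P * D) - Z
          ≈⟨ P².Q.+-congʳ {x = - Z} (P².Q.+-cong base (P².≈⇒∼ (*-congˡ (+-congʳ (+-congˡ (Γ-transpose i j k)))))) ⟩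
        Z + P * E j k + P * (Γ i j k + Γ i k j + P * D) - Z
          ≈⟨ P².≈⇒∼ (solve 5 (λ Z P e g d → Z :+ P :* e :+ P :* (g :+ P :* d) :- Z := P :* (e :+ g :+ P :* d)) refl Z P (E j k) _ D) ⟩
        P * (E j k + (Γ i j k + Γ i k j) + P * D)
          -- The quadratic term in Δ has a factor p inside the bracket and another one in front of
          -- it.
          ≈⟨ scale-p (P.Q.trans (P.Q.+-congˡ {x = E j k + (Γ i j k + Γ i k j)} (P.mem⇒∼0 (D , sym (·-as-* p D)))) (P.≈⇒∼ (+-identityʳ _))) ⟩
        P * (E j k + (Γ i j k + Γ i k j)) ∎

    -- The Koszul computation of the Christoffel symbols.
    2Γ : ∀ i j k → Γ i j k + Γ i j k ≡ C j k + C i k - C i j [mod p ]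
    2Γ i j k = P.Q.sym (begin
      C j k + C i k - C i j
        ≈⟨ P.Q.+-cong (P.Q.+-cong (metric-mod-p i j k) (metric-mod-p j i k)) (P.Q.-‿cong (metric-mod-p k i j)) ⟩
      (Γ i j k + Γ i k j) + (Γ j i k + Γ j k i) - (Γ k i j + Γ k j i)
        ≈⟨ P.≈⇒∼ (+-cong (+-cong (+-congˡ (torsion i k j)) (+-cong (torsion j i k) (torsion j k i))) refl) ⟩
      (Γ i j k + Γ k i j) + (Γ i j k + Γ k j i) - (Γ k i j + Γ k j i)
        ≈⟨ P.≈⇒∼ (solve 3 (λ a b c → (a :+ b) :+ (a :+ c) :- (b :+ c) := a :+ a) refl _ _ _) ⟩
      Γ i j k + Γ i j k ∎)
      where open SetoidReasoning P.Q.setoid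

    module _ (i j : Fin n) (φx : Matrix n)
      (curvature : ∀ a b → p · φx a b ≈ ⟦ Φ i ⟧ (⟦ Φ j ⟧ (x a b)) - ⟦ Φ j ⟧ (⟦ Φ i ⟧ (x a b))) where

      private
        -- Φᵢ is applied to x^p + pΔⱼ. The p-th power raises the congruence Φᵢ(x) ≡ x^p to one mod
        -- p², and the factor p does the same for Φᵢ(Δⱼ) ≡ Δⱼ^p. The leading term no longer depends
        -- on i or j, so it drops out of the commutator.
        composite : ∀ i j a b → ⟦ Φ i ⟧ (⟦ Φ j ⟧ (x a b)) ≡ (x a b ^ p) ^ p + P * Δ j a b ^ p [mod p ℕ.* p ]
        composite i j a b = begin
          ⟦ Φ i ⟧ (⟦ Φ j ⟧ (x a b))
            ≈⟨ P².≈⇒∼ (trans (⟦⟧-cong (Φ-x j a b)) (trans (+-homo _ _) (+-cong (^-homo (x a b) p) (trans (·-homo p (Δ j a b)) (·-as-* p _))))) ⟩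
          ⟦ Φ i ⟧ (x a b) ^ p + P * ⟦ Φ i ⟧ (Δ j a b)
            ≈⟨ P².Q.+-cong (^p-lift (Φ-lift i (x a b))) (scale-p (Φ-lift i (Δ j a b))) ⟩
          (x a b ^ p) ^ p + P * Δ j a b ^ p ∎
          where
          open SetoidReasoning P².Q.setoid
          open HomProperties A A (Φ i)

        φx-mod-p : ∀ a b → φx a b ≡ Δ j a b ^ p - Δ i a b ^ p [mod p ]
        φx-mod-p a b = cancel-p (begin
          P * φx a b
            ≈⟨ P².≈⇒∼ (trans (sym (·-as-* p _)) (curvature a b)) ⟩
          ⟦ Φ i ⟧ (⟦ Φ j ⟧ (x a b)) - ⟦ Φ j ⟧ (⟦ Φ i ⟧ (x a b))
            ≈⟨ P².Q.+-cong (composite i j a b) (P².Q.-‿cong (composite j i a b)) ⟩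
          (x a b ^ p) ^ p + P * Δ j a b ^ p - ((x a b ^ p) ^ p + P * Δ i a b ^ p)
            ≈⟨ P².≈⇒∼ (solve 4 (λ y P u v → y :+ P :* u :- (y :+ P :* v) := P :* (u :- v)) refl _ P _ _) ⟩
          P * (Δ j a b ^ p - Δ i a b ^ p) ∎)
          where open SetoidReasoning P².Q.setoid

        -- Frobenius is additive mod p, so entrywise p-th powers can be pulled out of the matrix
        -- product; inside, q⁽ᵖ⁾ may be replaced by Φᵢ(q).
        triple-^p : ∀ i m k → (x ⁽ p ℕ.^ 2 ⁾ ᵗ ⊗ q ⁽ p ℕ.^ 2 ⁾ ⊗ Δ i ⁽ p ⁾) m k ≡ Γ i k m ^ p [mod p ]
        triple-^p i m k = begin
          (x ⁽ p ℕ.^ 2 ⁾ ᵗ ⊗ q ⁽ p ℕ.^ 2 ⁾ ⊗ Δ i ⁽ p ⁾) m k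
            ≈⟨ P.≈⇒∼ (triple-cong {v = Δ i ⁽ p ⁾} (λ a b → square (x a b)) (λ a b → square (q a b)) (λ _ _ → refl) m k) ⟩
          (x ⁽ p ⁾ ⁽ p ⁾ ᵗ ⊗ q ⁽ p ⁾ ⁽ p ⁾ ⊗ Δ i ⁽ p ⁾) m k
            ≈⟨ P.sum-∼ (λ b → P.Q.*-congʳ {x = Δ i b k ^ p} (inner b)) ⟨
          sum (λ b → (x ⁽ p ⁾ ᵗ ⊗ q ⁽ p ⁾) m b ^ p * Δ i b k ^ p)
            ≈⟨ P.≈⇒∼ (sum-cong-≋ (λ b → ^-distrib-* _ (Δ i b k) p)) ⟨
          sum (λ b → ((x ⁽ p ⁾ ᵗ ⊗ q ⁽ p ⁾) m b * Δ i b k) ^ p)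
            ≈⟨ frobenius-sum (λ b → (x ⁽ p ⁾ ᵗ ⊗ q ⁽ p ⁾) m b * Δ i b k) ⟨
          (x ⁽ p ⁾ ᵗ ⊗ q ⁽ p ⁾ ⊗ Δ i) m k ^ p
            ≈⟨ P.^-∼ p (P.⊗-∼ {Y = Δ i} (P.⊗-∼ {X = x ⁽ p ⁾ ᵗ} (λ _ _ → P.Q.refl) (λ a b → Φ-lift i (q a b))) (λ _ _ → P.Q.refl) m k) ⟨
          (x ⁽ p ⁾ ᵗ ⊗ Q i ⊗ Δ i) m k ^ p
            ≈⟨ P.≈⇒∼ (^-congˡ p (Γ-transpose i m k)) ⟩
          Γ i k m ^ p ∎
          where
          open SetoidReasoning P.Q.setoid
          square : ∀ y → y ^ (p ℕ.^ 2) ≈ (y ^ p) ^ p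
          square y = trans (^-congʳ y (≡.cong (p ℕ.*_) (ℕ.*-identityʳ p))) (sym (^-assocʳ y p p))
          inner : ∀ b → (x ⁽ p ⁾ ᵗ ⊗ q ⁽ p ⁾) m b ^ p ≡ (x ⁽ p ⁾ ⁽ p ⁾ ᵗ ⊗ q ⁽ p ⁾ ⁽ p ⁾) m b [mod p ]
          inner b = P.Q.trans (frobenius-sum (λ a → x a m ^ p * q a b ^ p))
            (P.≈⇒∼ (sum-cong-≋ (λ a → ^-distrib-* (x a m ^ p) (q a b ^ p) p)))

      Riem≡½C : ∀ m k → lower A p x q φx m k ≡ ½ * (C i k + C j m - C j k - C i m) ^ p [mod p ]
      Riem≡½C m k = begin
        lower A p x q φx m k
          ≈⟨ P.⊗-∼ {X = x ⁽ p ℕ.^ 2 ⁾ ᵗ ⊗ q ⁽ p ℕ.^ 2 ⁾} (λ _ _ → P.Q.refl) φx-mod-p m k ⟩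
        (x ⁽ p ℕ.^ 2 ⁾ ᵗ ⊗ q ⁽ p ℕ.^ 2 ⁾ ⊗ (λ a b → Δ j a b ^ p - Δ i a b ^ p)) m k
          ≈⟨ P.≈⇒∼ (triple-difference (x ⁽ p ℕ.^ 2 ⁾) (q ⁽ p ℕ.^ 2 ⁾) (Δ j ⁽ p ⁾) (Δ i ⁽ p ⁾) m k) ⟩
        (x ⁽ p ℕ.^ 2 ⁾ ᵗ ⊗ q ⁽ p ℕ.^ 2 ⁾ ⊗ Δ j ⁽ p ⁾) m k - (x ⁽ p ℕ.^ 2 ⁾ ᵗ ⊗ q ⁽ p ℕ.^ 2 ⁾ ⊗ Δ i ⁽ p ⁾) m k
          ≈⟨ P.Q.+-cong (triple-^p j m k) (P.Q.-‿cong (triple-^p i m k)) ⟩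
        Γ j k m ^ p - Γ i k m ^ p
          -- Writing u as (u - v) + v needs only additivity of Frobenius and avoids the power of a
          -- negative.
          ≈⟨ P.Q.+-congʳ {x = - (Γ i k m ^ p)} (P.Q.trans (P.≈⇒∼ (^-congˡ p (solve 2 (λ u v → u := (u :- v) :+ v) refl (Γ j k m) (Γ i k m))))
               (frobenius-+ g (Γ i k m))) ⟩
        g ^ p + Γ i k m ^ p - Γ i k m ^ p
          ≈⟨ P.≈⇒∼ (solve 2 (λ u v → u :+ v :- v := u) refl _ _) ⟩
        g ^ p
          ≈⟨ P.≈⇒∼ (trans (sym (*-identityˡ _)) (trans (*-congʳ (sym ½*2≈1)) (solve 3 (λ h u y → h :* (u :+ u) :* y := h :* (u :* y :+ u :* y)) refl ½ 1# (g ^ p)))) ⟩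
        ½ * (1# * g ^ p + 1# * g ^ p)
          ≈⟨ P.≈⇒∼ (*-congˡ (+-cong (*-identityˡ _) (*-identityˡ _))) ⟩
        ½ * (g ^ p + g ^ p)
          -- Doubling commutes with the p-th power mod p, which is why ½ stays outside the power.
          ≈⟨ P.Q.*-congˡ {x = ½} (frobenius-+ g g) ⟨
        ½ * (g + g) ^ p
          ≈⟨ P.Q.*-congˡ {x = ½} (P.^-∼ p 2g) ⟩
        ½ * (C i k + C j m - C j k - C i m) ^ p ∎
        where
        open SetoidReasoning P.Q.setoid
        g : Carrier
        g = Γ j k m - Γ i k m

        2g : g + g ≡ C i k + C j m - C j k - C i m [mod p ]
        2g = begin
          g + g
            ≈⟨ P.≈⇒∼ (solve 2 (λ u v → (u :- v) :+ (u :- v) := (u :+ u) :- (v :+ v)) refl (Γ j k m) (Γ i k m)) ⟩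
          (Γ j k m + Γ j k m) - (Γ i k m + Γ i k m)
            ≈⟨ P.Q.+-cong (2Γ j k m) (P.Q.-‿cong (2Γ i k m)) ⟩
          (C k m + C j m - C j k) - (C k m + C i m - C i k)
            ≈⟨ P.≈⇒∼ (solve 5 (λ km jm jk im ik → (km :+ jm :- jk) :- (km :+ im :- ik) := ik :+ jm :- jk :- im) refl
                 (C k m) (C j m) (C j k) (C i m) (C i k)) ⟩
          C i k + C j m - C j k - C i m ∎

    -- Reduction modulo the ideal (p, x - 1)

    private
      -- Membership is spelled out so that congruence modulo `J` unfolds to `Congruent[p,x-1]`.
      J : Ideal A (c ⊔ ℓ)
      J = record
        { Mem      = λ z → Σ[ u ∈ Carrier ] Σ[ v ∈ Matrix n ] z ≈ p · u + combination v
        ; Mem-resp = λ { y≈z (u , v , e) → u , v , trans (sym y≈z) e }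
        ; 0-mem    = 0# , (λ _ _ → 0#) , sym (trans (+-cong (trans (·-as-* p 0#) (zeroʳ P)) (sum-zero λ a → sum-zero λ b → zeroˡ (y a b))) (+-identityʳ _))
        ; +-mem    = λ { (u , v , d) (u′ , v′ , e) → u + u′ , (λ a b → v a b + v′ a b) , trans (+-cong d e)
                       (trans (+-cong (+-congʳ (·-as-* p u)) (+-congʳ (·-as-* p u′)))
                       (trans (solve 5 (λ P u u′ w w′ → (P :* u :+ w) :+ (P :* u′ :+ w′) := P :* (u :+ u′) :+ (w :+ w′)) refl P u u′ _ _)
                       (+-cong (sym (·-as-* p _)) (trans (sym (∬-+ (λ b a → v a b * y a b) (λ b a → v′ a b * y a b)))
                         (∬-cong (λ b a → sym (distribʳ (y a b) (v a b) (v′ a b)))))))) }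
        ; *-mem    = λ { r (u , v , e) → r * u , (λ a b → r * v a b) , trans (*-congˡ e) (trans (distribˡ r _ _)
                       (+-cong (×-comm-* p r u) (trans (sym (∬-* r (λ b a → v a b * y a b))) (∬-cong (λ b a → sym (*-assoc r (v a b) (y a b))))))) }
        }
        where
        y : Matrix n
        y a b = x a b - 𝟙 a b
        combination : Matrix n → Carrier
        combination v = sum λ a → sum λ b → v a b * y a b

      module J = Ideal J
      module JC = Congruence A J

      mod-p⇒J : ∀ {y z} → y ≡ z [mod p ] → y JC.∼ z
      mod-p⇒J (w , e) = J.Mem-resp (trans (+-congˡ (sum-zero λ a → sum-zero λ b → zeroˡ (x a b - 𝟙 a b))) (trans (+-identityʳ _) (sym e)))
        (w , (λ _ _ → 0#) , refl)

      x∼𝟙 : ∀ a b → x a b JC.∼ 𝟙 a b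
      -- The coefficients form the matrix unit at (a, b), which selects a single generator of the
      -- ideal.
      x∼𝟙 a b = 0# , (λ i j → 𝟙 a i * 𝟙 j b) , sym (begin
        p · 0# + sum (λ i → sum λ j → 𝟙 a i * 𝟙 j b * y i j)
          ≈⟨ +-cong (trans (·-as-* p 0#) (zeroʳ P)) (sum-cong-≋ λ i → trans (sum-cong-≋ λ j → trans (*-assoc (𝟙 a i) (𝟙 j b) (y i j)) (*-congˡ (*-comm (𝟙 j b) (y i j)))) (sym (*-distribˡ-sum (𝟙 a i) (λ j → y i j * 𝟙 j b)))) ⟩
        0# + sum (λ i → 𝟙 a i * sum (λ j → y i j * 𝟙 j b))
          ≈⟨ trans (+-identityˡ _) (sum-cong-≋ λ i → trans (*-comm _ _) (*-cong (sum-𝟙 (λ j → y i j) b) (𝟙-sym a i))) ⟩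
        sum (λ i → y i b * 𝟙 i a)
          ≈⟨ sum-𝟙 (λ i → y i b) a ⟩
        y a b ∎)
        where
        open SetoidReasoning setoid
        y : Matrix n
        y a b = x a b - 𝟙 a b
        𝟙-sym : ∀ {n} (i j : Fin n) → 𝟙 i j ≈ 𝟙 j i
        𝟙-sym zero    zero    = refl
        𝟙-sym zero    (suc j) = refl
        𝟙-sym (suc i) zero    = refl
        𝟙-sym (suc i) (suc j) = 𝟙-sym i j

      𝟙^p : ∀ {n} (a b : Fin n) → 𝟙 a b ^ p ≈ 𝟙 a b
      𝟙^p zero    zero    = 1^ p
        where
        1^ : ∀ m → 1# ^ m ≈ 1#
        1^ zero    = refl
        1^ (suc m) = trans (*-identityˡ _) (1^ m)
      𝟙^p zero    (suc b) = 0^p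
      𝟙^p (suc a) zero    = 0^p
      𝟙^p (suc a) (suc b) = 𝟙^p a b

      x-offDiagonal : ∀ {a b} → a ≢ b → J.Mem (x a b)
      x-offDiagonal {a} {b} a≢b = J.Mem-resp (trans (+-congˡ (trans (-‿cong (𝟙-offDiagonal a≢b)) -0#≈0#)) (+-identityʳ _)) (x∼𝟙 a b)

      -- Two distinct row indices cannot both equal k, so one of the two entries of column k lies
      -- off the diagonal and hence in the ideal.
      off-diagonal : ∀ k {a b} → a ≢ b → (s t : Fin n → Carrier) → J.Mem ((x a k * s a) * (x b k * s b))
      off-diagonal k {a} {b} a≢b s t with a Fin.≟ k
      ... | no a≢k     = J.Mem-resp (solve 3 (λ y u w → (u :* w) :* y := (y :* u) :* w) refl (x a k) (s a) (x b k * s b)) (J.*-mem _ (x-offDiagonal a≢k))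
      ... | yes ≡.refl = J.Mem-resp (solve 3 (λ y u w → (w :* u) :* y := w :* (y :* u)) refl (x b k) (s b) (x a k * s a))
                           (J.*-mem _ (x-offDiagonal (λ b≡a → a≢b (≡.sym b≡a))))

    -- T involves only products of distinct terms of the expansion of xᵗqx, and at x = 1 at most one term survives.
    T∈J : ∀ j k → J.Mem (T j k)
    -- Division by p gives T = t + s, where t is the error of expanding the outer sum and s gathers
    -- the errors of the inner sums.
    T∈J j k = J.Mem-resp (x∙y⁻¹≈ε⇒x≈y _ _ (torsionFree _ (begin
        p · (t + s - T j k)
          ≈⟨ ·-as-* p _ ⟩
        P * (t + s - T j k)
          ≈⟨ solve 4 (λ P t s T → P :* (t :+ s :- T) := P :* s :+ P :* t :- P :* T) refl P t s (T j k) ⟩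
        P * s + P * t - P * T j k
          ≈⟨ +-cong difference (-‿cong (trans (sym (·-as-* p _)) (isCorrection j k))) ⟩
        (N - Z) - (N - Z)
          ≈⟨ -‿inverseʳ _ ⟩
        0# ∎)))
      (J.+-mem (proj₁ (proj₂ outer)) (JC.sum-mem _ (λ b → J.Mem-resp (*-comm _ _) (J.*-mem (x b k ^ p) (proj₁ (proj₂ (inner b)))))))
      where
      open SetoidReasoning setoid
      N Z : Carrier
      N = (x ᵗ ⊗ q ⊗ x) j k ^ p
      Z = (x ⁽ p ⁾ ᵗ ⊗ q ⁽ p ⁾ ⊗ x ⁽ p ⁾) j k

      xq : Fin n → Carrier
      xq = (x ᵗ ⊗ q) j

      inner : ∀ b → ∃[ t ] J.Mem t × xq b ^ p ≈ sum (λ a → (x a j * q a b) ^ p) + p · t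
      inner b = sum-^p J (λ a → x a j * q a b) (λ a a′ a≢a′ → off-diagonal j a≢a′ (λ a → q a b) (λ a → q a b))

      outer : ∃[ t ] J.Mem t × N ≈ sum (λ b → (xq b * x b k) ^ p) + p · t
      outer = sum-^p J (λ b → xq b * x b k) (λ b b′ b≢b′ →
        J.Mem-resp (*-cong (*-comm _ _) (*-comm _ _)) (off-diagonal k b≢b′ xq xq))

      r : Fin n → Carrier
      r b = proj₁ (inner b)
      t s : Carrier
      t = proj₁ outer
      s = sum λ b → r b * x b k ^ p

      summand : ∀ b → (xq b * x b k) ^ p ≈ (x ⁽ p ⁾ ᵗ ⊗ q ⁽ p ⁾) j b * x b k ^ p + P * (r b * x b k ^ p)
      summand b = begin
        (xq b * x b k) ^ p
          ≈⟨ ^-distrib-* (xq b) (x b k) p ⟩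
        xq b ^ p * x b k ^ p
          ≈⟨ *-congʳ (trans (proj₂ (proj₂ (inner b))) (+-cong (sum-cong-≋ λ a → ^-distrib-* (x a j) (q a b) p) (·-as-* p _))) ⟩
        ((x ⁽ p ⁾ ᵗ ⊗ q ⁽ p ⁾) j b + P * r b) * x b k ^ p
          ≈⟨ solve 4 (λ u P r y → (u :+ P :* r) :* y := u :* y :+ P :* (r :* y)) refl _ P (r b) (x b k ^ p) ⟩
        (x ⁽ p ⁾ ᵗ ⊗ q ⁽ p ⁾) j b * x b k ^ p + P * (r b * x b k ^ p) ∎

      difference : P * s + P * t ≈ N - Z
      difference = sym (begin
        N - Z
          ≈⟨ +-congʳ (trans (proj₂ (proj₂ outer)) (+-cong (sum-cong-≋ summand) (·-as-* p t))) ⟩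
        sum (λ b → (x ⁽ p ⁾ ᵗ ⊗ q ⁽ p ⁾) j b * x b k ^ p + P * (r b * x b k ^ p)) + P * t - Z
          ≈⟨ +-congʳ (+-congʳ (trans (∑-distrib-+ (λ b → (x ⁽ p ⁾ ᵗ ⊗ q ⁽ p ⁾) j b * x b k ^ p) (λ b → P * (r b * x b k ^ p)))
               (+-congˡ (sym (*-distribˡ-sum P (λ b → r b * x b k ^ p)))))) ⟩
        Z + P * s + P * t - Z
          ≈⟨ solve 3 (λ Z s t → Z :+ s :+ t :- Z := s :+ t) refl Z (P * s) (P * t) ⟩
        P * s + P * t ∎)

    C∼-dq : ∀ j k → C j k JC.∼ - dq j k
    C∼-dq j k = JC.Q.trans
      (JC.Q.+-cong (JC.Q.-‿cong (JC.Q.trans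
        (JC.⊗-∼ (JC.⊗-∼ {Y = dq} (λ a b → x^p∼𝟙 b a) (λ _ _ → JC.Q.refl)) x^p∼𝟙 j k)
        (JC.≈⇒∼ (triple-𝟙 dq j k)))) (JC.mem⇒∼0 (T∈J j k)))
      (JC.≈⇒∼ (+-identityʳ _))
      where
      x^p∼𝟙 : ∀ a b → (x ⁽ p ⁾) a b JC.∼ 𝟙 a b
      x^p∼𝟙 a b = JC.Q.trans (JC.^-∼ p (x∼𝟙 a b)) (JC.≈⇒∼ (𝟙^p a b))

    ½C∼½dq : ∀ {R} i j m k → R ≡ ½ * (C i k + C j m - C j k - C i m) ^ p [mod p ] →
             Congruent[p,x-1] A p x R (½ * (dq j k + dq i m - dq i k - dq j m) ^ p)
    ½C∼½dq i j m k e = JC.Q.trans (mod-p⇒J e) (JC.Q.*-congˡ {x = ½} (JC.^-∼ p (JC.Q.trans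
      (JC.Q.+-cong (JC.Q.+-cong (JC.Q.+-cong (C∼-dq i k) (C∼-dq j m)) (JC.Q.-‿cong (C∼-dq j k))) (JC.Q.-‿cong (C∼-dq i m)))
      (JC.≈⇒∼ (solve 4 (λ ik jm jk im → :- ik :+ :- jm :- :- jk :- :- im := jk :+ im :- ik :- jm) refl (dq i k) (dq j m) (dq j k) (dq i m))))))

-- Torsion freeness of localizations and completions

module _ (B : CommutativeRing b ℓ₁) (C : CommutativeRing c ℓ₂) where
  private
    module B = CommutativeRing B
    module C = CommutativeRing C

  torsionFree-retract : ∀ m (f : Hom C B) (g : Hom B C) → (∀ x → ⟦ g ⟧ (⟦ f ⟧ x) C.≈ x) →
                        TorsionFree B m → TorsionFree C m
  torsionFree-retract m f g g∘f≈id tf x mx≈0 = C.trans (C.sym (g∘f≈id x)) (C.trans (g.⟦⟧-cong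
    (tf (⟦ f ⟧ x) (B.trans (B.sym (f.·-homo m x)) (B.trans (f.⟦⟧-cong mx≈0) f.0#-homo)))) g.0#-homo)
    where
    module f = HomProperties C B f
    module g = HomProperties B C g

module _ (A : CommutativeRing a ℓ₁) (B : CommutativeRing b ℓ₂) (f : Hom A B) where
  private
    module A = RingOps A
    module B = RingOps B

  -- An m-fold sum of fractions accumulates denominators when unfolded. Multiplying by the image of
  -- the integer m keeps the denominator under control, and in a completion it makes the factor a
  -- constant sequence.
  ·-as-hom : ∀ m x → m B.· x B.≈ B.0# → ⟦ f ⟧ (m A.· A.1#) B.* x B.≈ B.0#
  ·-as-hom m x mx≈0 = B.trans (B.*-congʳ (B.trans (·-homo m A.1#) (B.×-congʳ m 1#-homo)))
    (B.trans (B.sym (IntegerRing.·-as-* B m x)) mx≈0)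
    where open HomProperties A B f

module _ (A : CommutativeRing c ℓ) {l} (S : MulSubset A l) {m : ℕ} (tf : TorsionFree A m) where
  private
    open RingOps A
    module S = MulSubset S

    divide : ∀ y t t∈ s∈ → FractionEq A S (frac ((m · 1#) * y) (1# * t) s∈) (frac 0# 1# S.1-mem) →
             FractionEq A S (frac y t t∈) (frac 0# 1# S.1-mem)
    divide y t t∈ s∈ (cross u u∈ e) = cross u u∈ (begin
      u * (y * 1#)   ≈⟨ *-congˡ (*-identityʳ y) ⟩
      u * y          ≈⟨ tf (u * y) torsion ⟩
      0#             ≈⟨ zeroʳ u ⟨
      u * 0#         ≈⟨ *-congˡ (zeroˡ t) ⟨
      u * (0# * t)   ∎)
      where
      open IntegerRing A
      open SetoidReasoning setoid
      torsion : m · (u * y) ≈ 0#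
      torsion = begin
        m · (u * y)                ≈⟨ ·-as-* m _ ⟩
        (m · 1#) * (u * y)         ≈⟨ solve 3 (λ m u y → m :* (u :* y) := u :* (m :* y)) refl (m · 1#) u y ⟩
        u * ((m · 1#) * y)         ≈⟨ *-congˡ (*-identityʳ _) ⟨
        u * ((m · 1#) * y * 1#)    ≈⟨ e ⟩
        u * (0# * (1# * t))        ≈⟨ trans (*-congˡ (zeroˡ _)) (zeroʳ u) ⟩
        0#                         ∎

  opaque
    unfolding Localization

    localization-torsionFree : TorsionFree (Localization A S) m
    localization-torsionFree x@(frac y t t∈) mx≈0 =
      divide y t t∈ _ (·-as-hom A (Localization A S) (toLocalization A S) m x mx≈0)

module _ (A : CommutativeRing c ℓ) {p : ℕ} (tf : TorsionFree A p) where
  private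
    open RingOps A
    open IntegerRing A

    divide : ∀ k {y} → (p · 1#) * y ≡ 0# [mod p ℕ.^ suc k ] → y ≡ 0# [mod p ℕ.^ k ]
    divide k {y} (z , e) = z , trans (solve 2 (λ y w → y :- :con ℤ.0ℤ := (y :- w) :+ w) refl y w)
      (trans (+-congʳ (tf _ (begin
        p · (y - w)
          ≈⟨ ·-as-* p _ ⟩
        (p · 1#) * (y - w)
          ≈⟨ solve 3 (λ P y w → P :* (y :- w) := P :* y :- :con ℤ.0ℤ :- P :* w) refl (p · 1#) y w ⟩
        (p · 1#) * y - 0# - (p · 1#) * w
          ≈⟨ +-cong e (-‿cong (trans (sym (·-as-* p _)) (×-assocˡ z p (p ℕ.^ k)))) ⟩
        ((p ℕ.^ suc k) · z) - ((p ℕ.^ suc k) · z)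
          ≈⟨ -‿inverseʳ _ ⟩
        0# ∎))) (+-identityˡ w))
      where
      open SetoidReasoning setoid
      w = (p ℕ.^ k) · z

    -- Dividing by p costs one level of precision, so level k is read off from level k + 1 and
    -- compatibility of the representatives brings it back.
    divide-all : ∀ x → (∀ k → (p · 1#) * PAdic.term x k ≡ 0# [mod p ℕ.^ k ]) → PAdicEq A p x (constant A p 0#)
    divide-all x e = levelwise λ k → mod-trans k (mod-sym k (PAdic.compatible x k)) (divide k (e (suc k)))
      where open module CP k = CongruenceProperties A (p ℕ.^ k)

  opaque
    unfolding Completion

    completion-torsionFree : TorsionFree (Completion A p) p
    completion-torsionFree x px≈0 = divide-all x
      (PAdicEq.at (·-as-hom A (Completion A p) (toCompletion A p) p x px≈0))

-- Universal property and coefficients of polynomial rings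

module Evaluation (A : CommutativeRing a ℓ₁) (B : CommutativeRing b ℓ₂) {V : Set}
                  (h : Hom A B) (y : V → ∣ B ∣ᴿ) where
  private
    module B = CommutativeRing B
    open HomProperties A B h

  evalᴱ : Expr A V → ∣ B ∣ᴿ
  evalᴱ (con r) = ⟦ h ⟧ r
  evalᴱ (var v) = y v
  evalᴱ (f ⊕ g) = evalᴱ f B.+ evalᴱ g
  evalᴱ (f ⊛ g) = evalᴱ f B.* evalᴱ g
  evalᴱ (⊖ f)   = B.- evalᴱ f

  evalᴱ-cong : ∀ {f g} → _≈ᴾ_ A V f g → evalᴱ f B.≈ evalᴱ g
  evalᴱ-cong ≈-refl             = B.refl
  evalᴱ-cong (≈-sym e)          = B.sym (evalᴱ-cong e)
  evalᴱ-cong (≈-trans d e)      = B.trans (evalᴱ-cong d) (evalᴱ-cong e)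
  evalᴱ-cong (con-cong e)       = ⟦⟧-cong e
  evalᴱ-cong (⊕-cong d e)       = B.+-cong (evalᴱ-cong d) (evalᴱ-cong e)
  evalᴱ-cong (⊛-cong d e)       = B.*-cong (evalᴱ-cong d) (evalᴱ-cong e)
  evalᴱ-cong (⊖-cong e)         = B.-‿cong (evalᴱ-cong e)
  evalᴱ-cong (con-+ r s)        = +-homo r s
  evalᴱ-cong (con-* r s)        = *-homo r s
  evalᴱ-cong (⊕-assoc f g h)    = B.+-assoc _ _ _
  evalᴱ-cong (⊕-comm f g)       = B.+-comm _ _
  evalᴱ-cong (⊕-identityˡ f)    = B.trans (B.+-congʳ 0#-homo) (B.+-identityˡ _)
  evalᴱ-cong (⊖-inverseˡ f)     = B.trans (B.-‿inverseˡ _) (B.sym 0#-homo)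
  evalᴱ-cong (⊛-assoc f g h)    = B.*-assoc _ _ _
  evalᴱ-cong (⊛-comm f g)       = B.*-comm _ _
  evalᴱ-cong (⊛-identityˡ f)    = B.trans (B.*-congʳ 1#-homo) (B.*-identityˡ _)
  evalᴱ-cong (⊛-distribˡ f g h) = B.distribˡ _ _ _

  opaque
    unfolding Polynomial

    eval : Hom (Polynomial A V) B
    eval = mkHom (Polynomial A V) B evalᴱ evalᴱ-cong (λ _ _ → B.refl) (λ _ _ → B.refl) 1#-homo

    eval-con : ∀ r → ⟦ eval ⟧ (⟦ toPolynomial A V ⟧ r) B.≈ ⟦ h ⟧ r
    eval-con r = B.refl

    eval-X : ∀ v → ⟦ eval ⟧ (X A V v) B.≈ y v
    eval-X v = B.refl

module _ (A : CommutativeRing a ℓ₁) (B : CommutativeRing b ℓ₂) (V : Set) where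
  private module B = CommutativeRing B

  opaque
    unfolding Polynomial

    polynomial-hom-ext : (f g : Hom (Polynomial A V) B) →
      (∀ r → ⟦ f ⟧ (⟦ toPolynomial A V ⟧ r) B.≈ ⟦ g ⟧ (⟦ toPolynomial A V ⟧ r)) →
      (∀ v → ⟦ f ⟧ (X A V v) B.≈ ⟦ g ⟧ (X A V v)) → ∀ e → ⟦ f ⟧ e B.≈ ⟦ g ⟧ e
    polynomial-hom-ext f g agree-con agree-X = go
      where
      module f = HomProperties (Polynomial A V) B f
      module g = HomProperties (Polynomial A V) B g
      go : ∀ e → ⟦ f ⟧ e B.≈ ⟦ g ⟧ e
      go (con r)   = agree-con r
      go (var v)   = agree-X v
      go (e ⊕ e′)  = B.trans (f.+-homo e e′) (B.trans (B.+-cong (go e) (go e′)) (B.sym (g.+-homo e e′)))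
      go (e ⊛ e′)  = B.trans (f.*-homo e e′) (B.trans (B.*-cong (go e) (go e′)) (B.sym (g.*-homo e e′)))
      go (⊖ e)     = B.trans (f.-‿homo e) (B.trans (B.-‿cong (go e)) (B.sym (g.-‿homo e)))

composeHom : (A : CommutativeRing a ℓ) (B : CommutativeRing b ℓ₁) (C : CommutativeRing c ℓ₂) →
             Hom B C → Hom A B → Hom A C
composeHom A B C g f = mkHom A C (λ x → ⟦ g ⟧ (⟦ f ⟧ x)) (λ e → g.⟦⟧-cong (f.⟦⟧-cong e))
  (λ x y → C.trans (g.⟦⟧-cong (f.+-homo x y)) (g.+-homo _ _))
  (λ x y → C.trans (g.⟦⟧-cong (f.*-homo x y)) (g.*-homo _ _))
  (C.trans (g.⟦⟧-cong f.1#-homo) g.1#-homo)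
  where
  module C = CommutativeRing C
  module f = HomProperties A B f
  module g = HomProperties B C g

-- A polynomial in one more variable acts on sequences in P, multiplication by the new
-- variable being the shift. This recovers its coefficients without constructing P[t].
module SequenceAction (A : CommutativeRing a ℓ₁) (P : CommutativeRing b ℓ₂) {N : ℕ}
                      (h : Hom A P) (y : Fin N → ∣ P ∣ᴿ) where
  open RingOps P
  open IntegerRing P
  open RingProperties ring using (-‿distribʳ-*; -0#≈0#)
  open AbelianGroupProperties +-abelianGroup using (⁻¹-∙-comm)
  private
    module h = HomProperties A P h

    V : Set
    V = Fin (suc N)

    Sequence : Set _
    Sequence = ℕ → Carrier

    infix 4 _≗_
    _≗_ : Sequence → Sequence → Set _
    s ≗ t = ∀ i → s i ≈ t i

    shift : Sequence → Sequence
    shift s zero    = 0#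
    shift s (suc i) = s i

  act : Expr A V → Sequence → Sequence
  act (con r)       s i = ⟦ h ⟧ r * s i
  act (var zero)    s   = shift s
  act (var (suc v)) s i = y v * s i
  act (f ⊕ g)       s i = act f s i + act g s i
  act (f ⊛ g)       s   = act f (act g s)
  act (⊖ f)         s i = - act f s i

  private
    act-cong : ∀ f {s t} → s ≗ t → act f s ≗ act f t
    act-cong (con r)       e i       = *-congˡ (e i)
    act-cong (var zero)    e zero    = refl
    act-cong (var zero)    e (suc i) = e i
    act-cong (var (suc v)) e i       = *-congˡ (e i)
    act-cong (f ⊕ g)       e i       = +-cong (act-cong f e i) (act-cong g e i)
    act-cong (f ⊛ g)       e         = act-cong f (act-cong g e)
    act-cong (⊖ f)         e i       = -‿cong (act-cong f e i)

    act-+ : ∀ f s t → act f (λ i → s i + t i) ≗ (λ i → act f s i + act f t i)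
    act-+ (con r)       s t i       = distribˡ _ _ _
    act-+ (var zero)    s t zero    = sym (+-identityˡ 0#)
    act-+ (var zero)    s t (suc i) = refl
    act-+ (var (suc v)) s t i       = distribˡ _ _ _
    act-+ (f ⊕ g)       s t i       = trans (+-cong (act-+ f s t i) (act-+ g s t i))
      (solve 4 (λ u v w z → (u :+ v) :+ (w :+ z) := (u :+ w) :+ (v :+ z)) refl _ _ _ _)
    act-+ (f ⊛ g)       s t i       = trans (act-cong f (act-+ g s t) i) (act-+ f _ _ i)
    act-+ (⊖ f)         s t i       = trans (-‿cong (act-+ f s t i)) (sym (⁻¹-∙-comm _ _))

    act-neg : ∀ f s → act f (λ i → - s i) ≗ (λ i → - act f s i)
    act-neg (con r)       s i       = sym (-‿distribʳ-* _ _)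
    act-neg (var zero)    s zero    = sym -0#≈0#
    act-neg (var zero)    s (suc i) = refl
    act-neg (var (suc v)) s i       = sym (-‿distribʳ-* _ _)
    act-neg (f ⊕ g)       s i       = trans (+-cong (act-neg f s i) (act-neg g s i)) (⁻¹-∙-comm _ _)
    act-neg (f ⊛ g)       s i       = trans (act-cong f (act-neg g s) i) (act-neg f _ i)
    act-neg (⊖ f)         s i       = -‿cong (act-neg f s i)

    act-* : ∀ f r s → act f (λ i → r * s i) ≗ (λ i → r * act f s i)
    act-* (con q)       r s i       = solve 3 (λ q r s → q :* (r :* s) := r :* (q :* s)) refl _ _ _
    act-* (var zero)    r s zero    = sym (zeroʳ r)
    act-* (var zero)    r s (suc i) = refl
    act-* (var (suc v)) r s i       = solve 3 (λ q r s → q :* (r :* s) := r :* (q :* s)) refl _ _ _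
    act-* (f ⊕ g)       r s i       = trans (+-cong (act-* f r s i) (act-* g r s i)) (sym (distribˡ _ _ _))
    act-* (f ⊛ g)       r s i       = trans (act-cong f (act-* g r s) i) (act-* f r _ i)
    act-* (⊖ f)         r s i       = trans (-‿cong (act-* f r s i)) (-‿distribʳ-* _ _)

    act-shift : ∀ f s → act f (shift s) ≗ shift (act f s)
    act-shift (con r)       s zero    = zeroʳ _
    act-shift (con r)       s (suc i) = refl
    act-shift (var zero)    s zero    = refl
    act-shift (var zero)    s (suc i) = refl
    act-shift (var (suc v)) s zero    = zeroʳ _
    act-shift (var (suc v)) s (suc i) = refl
    act-shift (f ⊕ g)       s zero    = trans (+-cong (act-shift f s zero) (act-shift g s zero)) (+-identityˡ 0#)
    act-shift (f ⊕ g)       s (suc i) = +-cong (act-shift f s (suc i)) (act-shift g s (suc i))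
    act-shift (f ⊛ g)       s i       = trans (act-cong f (act-shift g s) i) (act-shift f _ i)
    act-shift (⊖ f)         s zero    = trans (-‿cong (act-shift f s zero)) -0#≈0#
    act-shift (⊖ f)         s (suc i) = -‿cong (act-shift f s (suc i))

    -- Every generator acts by a scalar or by the shift, and these commute with every action. This
    -- is what the relation `⊛-comm` demands of the representation.
    act-comm : ∀ f g s → act f (act g s) ≗ act g (act f s)
    act-comm (con r)       g s i = sym (act-* g _ s i)
    act-comm (var zero)    g s i = sym (act-shift g s i)
    act-comm (var (suc v)) g s i = sym (act-* g _ s i)
    act-comm (f ⊕ f′)      g s i = trans (+-cong (act-comm f g s i) (act-comm f′ g s i)) (sym (act-+ g _ _ i))
    act-comm (f ⊛ f′)      g s i = trans (act-cong f (act-comm f′ g s) i) (act-comm f g _ i)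
    act-comm (⊖ f)         g s i = trans (-‿cong (act-comm f g s i)) (sym (act-neg g _ i))

  -- All relations of the presentation hold for the action, so the coefficients of an expression
  -- depend only on the polynomial it denotes.
  act-resp : ∀ {f g} → _≈ᴾ_ A V f g → ∀ s i → act f s i ≈ act g s i
  act-resp ≈-refl             s i = refl
  act-resp (≈-sym e)          s i = sym (act-resp e s i)
  act-resp (≈-trans d e)      s i = trans (act-resp d s i) (act-resp e s i)
  act-resp (con-cong e)       s i = *-congʳ (h.⟦⟧-cong e)
  act-resp (⊕-cong d e)       s i = +-cong (act-resp d s i) (act-resp e s i)
  act-resp (⊛-cong {f} {f′} {g} {g′} d e) s i = trans (act-cong f (act-resp e s) i) (act-resp d (act g′ s) i)
  act-resp (⊖-cong e)         s i = -‿cong (act-resp e s i)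
  act-resp (con-+ q r)        s i = trans (*-congʳ (h.+-homo q r)) (distribʳ _ _ _)
  act-resp (con-* q r)        s i = trans (*-congʳ (h.*-homo q r)) (*-assoc _ _ _)
  act-resp (⊕-assoc e f g)    s i = +-assoc _ _ _
  act-resp (⊕-comm f g)       s i = +-comm _ _
  act-resp (⊕-identityˡ f)    s i = trans (+-congʳ (trans (*-congʳ h.0#-homo) (zeroˡ _))) (+-identityˡ _)
  act-resp (⊖-inverseˡ f)     s i = trans (-‿inverseˡ _) (sym (trans (*-congʳ h.0#-homo) (zeroˡ _)))
  act-resp (⊛-assoc e f g)    s i = refl
  act-resp (⊛-comm f g)       s i = act-comm f g s i
  act-resp (⊛-identityˡ f)    s i = trans (*-congʳ h.1#-homo) (*-identityˡ _)
  act-resp (⊛-distribˡ e f g) s i = act-+ e _ _ i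

  private
    infixl 6 _+ᴸ_
    _+ᴸ_ : List Carrier → List Carrier → List Carrier
    []      +ᴸ l       = l
    (x ∷ k) +ᴸ []      = x ∷ k
    (x ∷ k) +ᴸ (z ∷ l) = x + z ∷ k +ᴸ l

  -- The same action on finite lists. Lists can be reassembled into a polynomial but differ by
  -- trailing zeros; sequences carry the usable equality, so both versions are kept and compared by
  -- `coeff-act`.
  actᴸ : Expr A V → List Carrier → List Carrier
  actᴸ (con r)       l = map (⟦ h ⟧ r *_) l
  actᴸ (var zero)    l = 0# ∷ l
  actᴸ (var (suc v)) l = map (y v *_) l
  actᴸ (f ⊕ g)       l = actᴸ f l +ᴸ actᴸ g l
  actᴸ (f ⊛ g)       l = actᴸ f (actᴸ g l)
  actᴸ (⊖ f)         l = map (-_) (actᴸ f l)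

  coeff : List Carrier → ℕ → Carrier
  coeff []      i       = 0#
  coeff (x ∷ l) zero    = x
  coeff (x ∷ l) (suc i) = coeff l i

  private
    coeff-map : ∀ (f : Carrier → Carrier) → f 0# ≈ 0# → ∀ l i → coeff (map f l) i ≈ f (coeff l i)
    coeff-map f f0 []      i       = sym f0
    coeff-map f f0 (x ∷ l) zero    = refl
    coeff-map f f0 (x ∷ l) (suc i) = coeff-map f f0 l i

    coeff-+ : ∀ k l i → coeff (k +ᴸ l) i ≈ coeff k i + coeff l i
    coeff-+ []      l       i       = sym (+-identityˡ _)
    coeff-+ (x ∷ k) []      i       = sym (+-identityʳ _)
    coeff-+ (x ∷ k) (z ∷ l) zero    = refl
    coeff-+ (x ∷ k) (z ∷ l) (suc i) = coeff-+ k l i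

  coeff-act : ∀ f l i → coeff (actᴸ f l) i ≈ act f (coeff l) i
  coeff-act (con r)       l i       = coeff-map (_ *_) (zeroʳ _) l i
  coeff-act (var zero)    l zero    = refl
  coeff-act (var zero)    l (suc i) = refl
  coeff-act (var (suc v)) l i       = coeff-map (_ *_) (zeroʳ _) l i
  coeff-act (f ⊕ g)       l i       = trans (coeff-+ (actᴸ f l) (actᴸ g l) i) (+-cong (coeff-act f l i) (coeff-act g l i))
  coeff-act (f ⊛ g)       l i       = trans (coeff-act f (actᴸ g l) i) (act-cong f (coeff-act g l) i)
  coeff-act (⊖ f)         l i       = trans (coeff-map -_ -0#≈0# (actᴸ f l) i) (-‿cong (coeff-act f l i))

  module Reassemble (B : CommutativeRing c ℓ) (ι : Hom P B) (t : ∣ B ∣ᴿ) where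
    private
      module B = RingOps B
      module BI = IntegerRing B
      module ι = HomProperties P B ι

      variables : V → ∣ B ∣ᴿ
      variables zero    = t
      variables (suc v) = ⟦ ι ⟧ (y v)

    open Evaluation A B (composeHom A P B ι h) variables public using (evalᴱ)

    assemble : List Carrier → ∣ B ∣ᴿ
    assemble []      = B.0#
    assemble (x ∷ l) = ⟦ ι ⟧ x B.+ t B.* assemble l

    private
      assemble-* : ∀ r l → assemble (map (r *_) l) B.≈ ⟦ ι ⟧ r B.* assemble l
      assemble-* r []      = B.sym (B.zeroʳ _)
      assemble-* r (x ∷ l) = B.trans (B.+-cong (ι.*-homo r x) (B.*-congˡ (assemble-* r l)))
        (BI.solve 4 (λ r x t l → r BI.:* x BI.:+ t BI.:* (r BI.:* l) BI.:= r BI.:* (x BI.:+ t BI.:* l)) B.refl _ _ _ _)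

      assemble-+ : ∀ k l → assemble (k +ᴸ l) B.≈ assemble k B.+ assemble l
      assemble-+ []      l       = B.sym (B.+-identityˡ _)
      assemble-+ (x ∷ k) []      = B.sym (B.+-identityʳ _)
      assemble-+ (x ∷ k) (z ∷ l) = B.trans (B.+-cong (ι.+-homo x z) (B.*-congˡ (assemble-+ k l)))
        (BI.solve 5 (λ x z t k l → (x BI.:+ z) BI.:+ t BI.:* (k BI.:+ l) BI.:= (x BI.:+ t BI.:* k) BI.:+ (z BI.:+ t BI.:* l))
          B.refl _ _ _ _ _)

      assemble-neg : ∀ l → assemble (map (-_) l) B.≈ B.- assemble l
      assemble-neg []      = B.sym (RingProperties.-0#≈0# B.ring)
      assemble-neg (x ∷ l) = B.trans (B.+-cong (ι.-‿homo x) (B.*-congˡ (assemble-neg l)))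
        (BI.solve 3 (λ x t l → BI.:- x BI.:+ t BI.:* (BI.:- l) BI.:= BI.:- (x BI.:+ t BI.:* l)) B.refl _ _ _)

    assemble-act : ∀ f l → assemble (actᴸ f l) B.≈ evalᴱ f B.* assemble l
    assemble-act (con r)       l = assemble-* (⟦ h ⟧ r) l
    assemble-act (var zero)    l = B.trans (B.+-congʳ ι.0#-homo) (B.+-identityˡ _)
    assemble-act (var (suc v)) l = assemble-* (y v) l
    assemble-act (f ⊕ g)       l = B.trans (assemble-+ (actᴸ f l) (actᴸ g l))
      (B.trans (B.+-cong (assemble-act f l) (assemble-act g l)) (B.sym (B.distribʳ _ _ _)))
    assemble-act (f ⊛ g)       l = B.trans (assemble-act f (actᴸ g l))
      (B.trans (B.*-congˡ (assemble-act g l)) (B.sym (B.*-assoc _ _ _)))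
    assemble-act (⊖ f)         l = B.trans (assemble-neg (actᴸ f l))
      (B.trans (B.-‿cong (assemble-act f l)) (RingProperties.-‿distribˡ-* B.ring _ _))

    assemble-zero : ∀ l → (∀ i → coeff l i ≈ 0#) → assemble l B.≈ B.0#
    assemble-zero []      e = B.refl
    assemble-zero (x ∷ l) e = B.trans
      (B.+-cong (B.trans (ι.⟦⟧-cong (e zero)) ι.0#-homo) (B.trans (B.*-congˡ (assemble-zero l (λ i → e (suc i)))) (B.zeroʳ t)))
      (B.+-identityˡ B.0#)

-- Torsion freeness of polynomial rings

module _ (A : CommutativeRing a ℓ₁) where
  private
    A[_] : ℕ → CommutativeRing a (a ⊔ ℓ₁)
    A[ N ] = Polynomial A (Fin N)

    weaken : ∀ N → Hom A[ N ] A[ suc N ]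
    weaken N = Evaluation.eval A A[ suc N ] (toPolynomial A (Fin (suc N))) (λ v → X A (Fin (suc N)) (suc v))

  opaque
    unfolding Polynomial Evaluation.eval

    private
      -- The coefficients of f are those of its action on the constant 1. If m f = 0, each of them
      -- is killed by m in the smaller ring and so vanishes, and f is reassembled from them.
      step : ∀ m N → TorsionFree A[ N ] m → TorsionFree A[ suc N ] m
      step m N tf f mf≈0 = begin
        f                             ≈⟨ sym (*-identityʳ f) ⟩
        f * 1#                        ≈⟨ *-cong (eval≈id f) unit ⟨
        evalᴱ f * assemble (P.1# ∷ []) ≈⟨ assemble-act f (P.1# ∷ []) ⟨
        assemble (actᴸ f (P.1# ∷ []))  ≈⟨ assemble-zero (actᴸ f (P.1# ∷ [])) (λ i → P.trans (coeff-act f (P.1# ∷ []) i) (vanish i)) ⟩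
        0#                            ∎
        where
        module P = RingOps A[ N ]
        open RingOps A[ suc N ]
        open SetoidReasoning setoid
        open SequenceAction A A[ N ] (toPolynomial A (Fin N)) (X A (Fin N))
        open Reassemble A[ suc N ] (weaken N) (X A (Fin (suc N)) zero)

        eval≈id : ∀ e → evalᴱ e ≈ e
        eval≈id (con r)       = refl
        eval≈id (var zero)    = refl
        eval≈id (var (suc v)) = refl
        eval≈id (e ⊕ e′)      = +-cong (eval≈id e) (eval≈id e′)
        eval≈id (e ⊛ e′)      = *-cong (eval≈id e) (eval≈id e′)
        eval≈id (⊖ e)         = -‿cong (eval≈id e)

        unit : assemble (P.1# ∷ []) ≈ 1#
        unit = trans (+-congˡ {1#} (zeroʳ _)) (+-identityʳ 1#)

        act-· : ∀ k s i → act (k · f) s i P.≈ k P.· act f s i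
        act-· zero    s i = P.zeroˡ (s i)
        act-· (suc k) s i = P.+-congˡ {act f s i} (act-· k s i)

        vanish : ∀ i → act f (coeff (P.1# ∷ [])) i P.≈ P.0#
        vanish i = tf _ (P.trans (P.sym (act-· m _ i)) (P.trans (act-resp mf≈0 _ i) (P.zeroˡ _)))

  polynomial-torsionFree-Fin : ∀ m N → TorsionFree A m → TorsionFree A[ N ] m
  polynomial-torsionFree-Fin m zero    tf = torsionFree-retract A A[ 0 ] m collapse (toPolynomial A (Fin 0))
    (polynomial-hom-ext A A[ 0 ] (Fin 0) (composeHom A[ 0 ] A A[ 0 ] (toPolynomial A (Fin 0)) collapse) (idHom A[ 0 ])
      (λ r → HomProperties.⟦⟧-cong A A[ 0 ] (toPolynomial A (Fin 0)) (Evaluation.eval-con A A (idHom A) (λ ()) r)) (λ ())) tf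
    where
    collapse : Hom A[ 0 ] A
    collapse = Evaluation.eval A A (idHom A) (λ ())
  polynomial-torsionFree-Fin m (suc N) tf = step m N (polynomial-torsionFree-Fin m N tf)

  polynomial-torsionFree : ∀ {V : Set} {N} m (encode : V → Fin N) (decode : Fin N → V) →
    (∀ v → decode (encode v) ≡ v) → TorsionFree A m → TorsionFree (Polynomial A V) m
  polynomial-torsionFree {V} {N} m encode decode decode∘encode tf =
    torsionFree-retract A[ N ] A[V] m to from
      (polynomial-hom-ext A A[V] V (composeHom A[V] A[ N ] A[V] from to) (idHom A[V])
        (λ r → A[V].trans (HomProperties.⟦⟧-cong A[ N ] A[V] from (To.eval-con r)) (From.eval-con r))
        (λ v → A[V].trans (HomProperties.⟦⟧-cong A[ N ] A[V] from (To.eval-X v))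
          (A[V].trans (From.eval-X (encode v)) (A[V].reflexive (≡.cong (X A V) (decode∘encode v))))))
      (polynomial-torsionFree-Fin m N tf)
    where
    A[V] = Polynomial A V
    module A[V] = CommutativeRing A[V]
    module To = Evaluation A A[ N ] (toPolynomial A (Fin N)) (λ v → X A (Fin N) (encode v))
    module From = Evaluation A A[V] (toPolynomial A V) (λ i → X A V (decode i))
    to : Hom A[V] A[ N ]
    to = To.eval
    from : Hom A[ N ] A[V]
    from = From.eval

-- Determinants by expansion along the first row: multilinearity, alternation, Cramer's rule

module Determinant (A : CommutativeRing c ℓ) where
  open RingOps A
  open IntegerRing A
  open TripleProduct A using (sum-zero)
  open RingProperties ring using (-1*x≈-x)
  open Sum semiring using (∑-distrib-+; *-distribˡ-sum)
  open SetoidReasoning setoid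

  private
    minor-punch : ∀ {n} (X : Matrix (suc n)) {j k} (j≢k : j ≢ k) i → minor X j i (punchOut j≢k) ≡ X (suc i) k
    minor-punch X j≢k i = ≡.cong (X (suc i)) (Fin.punchIn-punchOut j≢k)

    off-punch : ∀ {n} {j k : Fin (suc n)} (j≢k : j ≢ k) l → l ≢ punchOut j≢k → punchIn j l ≢ k
    off-punch {j = j} j≢k l l≢ e = l≢ (Fin.punchIn-injective j l _ (≡.trans e (≡.sym (Fin.punchIn-punchOut j≢k))))

  det-cong : ∀ {n} {X Y : Matrix n} → X ≋ Y → det X ≈ det Y
  det-cong {zero}  e = refl
  det-cong {suc n} e = sum-cong-≋ λ j → *-cong (*-congˡ {sign j} (e zero j)) (det-cong (λ k l → e (suc k) (punchIn j l)))

  -- Induction over the expansion: the term of column k is linear through its entry in row zero, and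
  -- every other minor still contains column k, at the position given by `punchOut`.
  det-column-linear : ∀ {n} r (X Y Z : Matrix n) k →
    (∀ i j → j ≢ k → X i j ≈ Y i j) → (∀ i j → j ≢ k → X i j ≈ Z i j) →
    (∀ i → Z i k ≈ X i k + r * Y i k) → det Z ≈ det X + r * det Y
  det-column-linear {suc n} r X Y Z k X≈Y X≈Z Zₖ = begin
    sum (term Z)                         ≈⟨ sum-cong-≋ term-linear ⟩
    sum (λ j → term X j + r * term Y j)  ≈⟨ ∑-distrib-+ (term X) (λ j → r * term Y j) ⟩
    sum (term X) + sum (λ j → r * term Y j) ≈⟨ +-congˡ (*-distribˡ-sum r (term Y)) ⟨
    sum (term X) + r * sum (term Y)      ∎
    where
    term : Matrix (suc n) → Fin (suc n) → Carrier
    term X j = (sign j * X zero j) * det (minor X j)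

    term-linear : ∀ j → term Z j ≈ term X j + r * term Y j
    term-linear j with j Fin.≟ k
    ... | yes ≡.refl = begin
      (sign k * Z zero k) * det (minor Z k)
        ≈⟨ *-cong (*-congˡ (Zₖ zero)) (det-cong (λ i l → sym (X≈Z (suc i) (punchIn k l) (Fin.punchInᵢ≢i k l)))) ⟩
      (sign k * (X zero k + r * Y zero k)) * det (minor X k)
        ≈⟨ solve 5 (λ s x r y d → (s :* (x :+ r :* y)) :* d := (s :* x) :* d :+ r :* ((s :* y) :* d)) refl (sign k) (X zero k) r (Y zero k) (det (minor X k)) ⟩
      term X k + r * ((sign k * Y zero k) * det (minor X k))
        ≈⟨ +-congˡ (*-congˡ (*-congˡ (det-cong (λ i l → X≈Y (suc i) (punchIn k l) (Fin.punchInᵢ≢i k l))))) ⟩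
      term X k + r * term Y k ∎
    ... | no j≢k = begin
      (sign j * Z zero j) * det (minor Z j)
        ≈⟨ *-cong (*-congˡ (sym (X≈Z zero j j≢k))) (det-column-linear r (minor X j) (minor Y j) (minor Z j) (punchOut j≢k)
             (λ i l l≢ → X≈Y (suc i) (punchIn j l) (off-punch j≢k l l≢))
             (λ i l l≢ → X≈Z (suc i) (punchIn j l) (off-punch j≢k l l≢))
             (λ i → trans (reflexive (minor-punch Z j≢k i)) (trans (Zₖ (suc i))
               (reflexive (≡.sym (≡.cong₂ (λ x y → x + r * y) (minor-punch X j≢k i) (minor-punch Y j≢k i))))))) ⟩
      (sign j * X zero j) * (det (minor X j) + r * det (minor Y j))
        ≈⟨ solve 4 (λ s r x y → s :* (x :+ r :* y) := s :* x :+ r :* (s :* y)) refl _ r _ _ ⟩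
      term X j + r * ((sign j * X zero j) * det (minor Y j))
        ≈⟨ +-congˡ (*-congˡ (*-congʳ (*-congˡ (X≈Y zero j j≢k)))) ⟩
      term X j + r * term Y j ∎

  det-column-mem : ∀ {i} (I : Ideal A i) → ∀ {n} (X : Matrix n) k → (∀ i → Ideal.Mem I (X i k)) → Ideal.Mem I (det X)
  det-column-mem I {suc n} X k Xₖ∈ = Congruence.sum-mem A I _ term-mem
    where
    open Ideal I
    term-mem : ∀ j → Mem ((sign j * X zero j) * det (minor X j))
    term-mem j with j Fin.≟ k
    ... | yes ≡.refl = Mem-resp (*-comm _ _) (*-mem _ (*-mem (sign k) (Xₖ∈ zero)))
    ... | no j≢k     = *-mem _ (det-column-mem I (minor X j) (punchOut j≢k)
                         (λ i → ≡.subst Mem (≡.sym (minor-punch X j≢k i)) (Xₖ∈ (suc i))))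

  private
    sum-cancel-adjacent : ∀ {n} (v : Fin (suc n) → Carrier) a → v (inject₁ a) + v (suc a) ≈ 0# →
                          (∀ j → j ≢ inject₁ a → j ≢ suc a → v j ≈ 0#) → sum v ≈ 0#
    sum-cancel-adjacent v zero    e v≈0 = trans (sym (+-assoc _ _ _)) (trans (+-cong e
      (sum-zero (λ j → v≈0 (suc (suc j)) (λ ()) (λ ())))) (+-identityˡ _))
    sum-cancel-adjacent v (suc a) e v≈0 = trans (+-cong (v≈0 zero (λ ()) (λ ()))
      (sum-cancel-adjacent (λ j → v (suc j)) a e (λ j j≢ j≢′ → v≈0 (suc j)
        (λ e → j≢ (Fin.suc-injective e)) (λ e → j≢′ (Fin.suc-injective e))))) (+-identityˡ _)

    -- Keeps the induction for equal neighbouring columns within neighbours, since removing a third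
    -- column does not separate them.
    adjacent-in-minor : ∀ {m} (j : Fin (suc (suc m))) (a : Fin (suc m)) → j ≢ inject₁ a → j ≢ suc a →
                        ∃[ a′ ] punchIn j (inject₁ a′) ≡ inject₁ a × punchIn j (suc a′) ≡ suc a
    adjacent-in-minor         zero          zero    j≢ j≢′ = ⊥-elim (j≢ ≡.refl)
    adjacent-in-minor         zero          (suc a) j≢ j≢′ = a , ≡.refl , ≡.refl
    adjacent-in-minor         (suc zero)    zero    j≢ j≢′ = ⊥-elim (j≢′ ≡.refl)
    adjacent-in-minor {suc m} (suc (suc j)) zero    j≢ j≢′ = zero , ≡.refl , ≡.refl
    adjacent-in-minor {suc m} (suc j)       (suc a) j≢ j≢′
      with adjacent-in-minor j a (λ e → j≢ (≡.cong suc e)) (λ e → j≢′ (≡.cong suc e))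
    ... | a′ , e , e′ = suc a′ , ≡.cong suc e , ≡.cong suc e′

    punchIn-adjacent : ∀ {n} (a : Fin n) l → punchIn (inject₁ a) l ≡ punchIn (suc a) l ⊎
                       (punchIn (inject₁ a) l ≡ suc a × punchIn (suc a) l ≡ inject₁ a)
    punchIn-adjacent zero    zero    = inj₂ (≡.refl , ≡.refl)
    punchIn-adjacent zero    (suc l) = inj₁ ≡.refl
    punchIn-adjacent (suc a) zero    = inj₁ ≡.refl
    punchIn-adjacent (suc a) (suc l) with punchIn-adjacent a l
    ... | inj₁ e        = inj₁ (≡.cong suc e)
    ... | inj₂ (e , e′) = inj₂ (≡.cong suc e , ≡.cong suc e′)

  -- The minors omitting one or the other equal column coincide and their signs are opposite; all
  -- other minors still contain both columns and vanish by induction.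
  det-alternating-adjacent : ∀ {n} (X : Matrix (suc n)) a → (∀ i → X i (inject₁ a) ≈ X i (suc a)) → det X ≈ 0#
  det-alternating-adjacent {suc n} X a e = sum-cancel-adjacent (λ j → (sign j * X zero j) * det (minor X j)) a
    (begin
      (sign (inject₁ a) * X zero (inject₁ a)) * det (minor X (inject₁ a)) + (sign (suc a) * X zero (suc a)) * det (minor X (suc a))
        ≈⟨ +-cong (*-cong (*-congʳ (reflexive (≡.cong ((- 1#) ^_) (Fin.toℕ-inject₁ a)))) (det-cong minors)) (*-congʳ (*-congˡ (sym (e zero)))) ⟩
      (sign a * X zero (inject₁ a)) * det (minor X (suc a)) + ((- 1# * sign a) * X zero (inject₁ a)) * det (minor X (suc a))
        ≈⟨ +-congˡ (*-congʳ (*-congʳ (-1*x≈-x (sign a)))) ⟩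
      (sign a * X zero (inject₁ a)) * det (minor X (suc a)) + (- sign a * X zero (inject₁ a)) * det (minor X (suc a))
        ≈⟨ solve 3 (λ s x d → (s :* x) :* d :+ (:- s :* x) :* d := :con ℤ.0ℤ) refl (sign a) _ _ ⟩
      0# ∎)
    (λ j j≢ j≢′ → trans (*-congˡ (minor-zero j (adjacent-in-minor j a j≢ j≢′))) (zeroʳ _))
    where
    minors : minor X (inject₁ a) ≋ minor X (suc a)
    minors k l with punchIn-adjacent a l
    ... | inj₁ e′        = reflexive (≡.cong (X (suc k)) e′)
    ... | inj₂ (e′ , e″) = trans (reflexive (≡.cong (X (suc k)) e′)) (trans (sym (e (suc k))) (reflexive (≡.cong (X (suc k)) (≡.sym e″))))
    minor-zero : ∀ j → ∃[ a′ ] punchIn j (inject₁ a′) ≡ inject₁ a × punchIn j (suc a′) ≡ suc a → det (minor X j) ≈ 0#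
    minor-zero j (a′ , e′ , e″) = det-alternating-adjacent (minor X j) a′ (λ i →
      trans (reflexive (≡.cong (X (suc i)) e′)) (trans (e (suc i)) (reflexive (≡.cong (X (suc i)) (≡.sym e″)))))

  infixl 9 _[_≔_]

  _[_≔_] : ∀ {n} → Matrix n → Fin n → (Fin n → Carrier) → Matrix n
  (X [ k ≔ u ]) i = updateAt (X i) k (λ _ → u i)

  private
    ≔-at : ∀ {n} (X : Matrix n) k u i → (X [ k ≔ u ]) i k ≈ u i
    ≔-at X k u i = reflexive (Vector.updateAt-updates k (X i))

    ≔-off : ∀ {n} (X : Matrix n) k u i j → j ≢ k → (X [ k ≔ u ]) i j ≈ X i j
    ≔-off X k u i j j≢k = reflexive (Vector.updateAt-minimal j k (X i) j≢k)

  det-≔-linear : ∀ {n} r (X : Matrix n) k (u v w : Fin n → Carrier) → (∀ i → w i ≈ u i + r * v i) →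
                 det (X [ k ≔ w ]) ≈ det (X [ k ≔ u ]) + r * det (X [ k ≔ v ])
  det-≔-linear r X k u v w e = det-column-linear r (X [ k ≔ u ]) (X [ k ≔ v ]) (X [ k ≔ w ]) k
    (λ i j j≢k → trans (≔-off X k u i j j≢k) (sym (≔-off X k v i j j≢k)))
    (λ i j j≢k → trans (≔-off X k u i j j≢k) (sym (≔-off X k w i j j≢k)))
    (λ i → trans (≔-at X k w i) (trans (e i) (sym (+-cong (≔-at X k u i) (*-congˡ (≔-at X k v i))))))

  private
    distance : ∀ {m n} → m ℕ.< n → n ≡ suc (n ℕ.∸ suc m) ℕ.+ m
    distance {m} {n} m<n = ≡.sym (≡.trans (≡.sym (ℕ.+-suc (n ℕ.∸ suc m) m)) (ℕ.m∸n+n≡m m<n))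

    module Swap {n} (X : Matrix (suc n)) (a : Fin n) where
      F : (u v : Fin (suc n) → Carrier) → Carrier
      F u v = det (X [ inject₁ a ≔ u ] [ suc a ≔ v ])

      inject₁≢suc : inject₁ a ≢ suc a
      inject₁≢suc e = ℕ.1+n≢n (≡.trans (≡.cong toℕ (≡.sym e)) (Fin.toℕ-inject₁ a))

      first-at : ∀ u v i → (X [ inject₁ a ≔ u ] [ suc a ≔ v ]) i (inject₁ a) ≈ u i
      first-at u v i = trans (≔-off (X [ inject₁ a ≔ u ]) (suc a) v i _ inject₁≢suc) (≔-at X (inject₁ a) u i)

      F-diagonal : ∀ u → F u u ≈ 0#
      F-diagonal u = det-alternating-adjacent (X [ inject₁ a ≔ u ] [ suc a ≔ u ]) a
        (λ i → trans (first-at u u i) (sym (≔-at (X [ inject₁ a ≔ u ]) (suc a) u i)))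

      others : ∀ u u′ v v′ i j → j ≢ inject₁ a → j ≢ suc a →
        (X [ inject₁ a ≔ u ] [ suc a ≔ v ]) i j ≈ (X [ inject₁ a ≔ u′ ] [ suc a ≔ v′ ]) i j
      others u u′ v v′ i j j≢ j≢′ = trans (trans (≔-off (X [ inject₁ a ≔ u ]) (suc a) v i j j≢′) (≔-off X (inject₁ a) u i j j≢))
        (sym (trans (≔-off (X [ inject₁ a ≔ u′ ]) (suc a) v′ i j j≢′) (≔-off X (inject₁ a) u′ i j j≢)))

      F-linearˡ : ∀ u u′ v → F (λ i → u i + 1# * u′ i) v ≈ F u v + 1# * F u′ v
      F-linearˡ u u′ v = det-column-linear 1# (X [ inject₁ a ≔ u ] [ suc a ≔ v ]) (X [ inject₁ a ≔ u′ ] [ suc a ≔ v ])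
        (X [ inject₁ a ≔ (λ i → u i + 1# * u′ i) ] [ suc a ≔ v ]) (inject₁ a) (off u u′) (off u (λ i → u i + 1# * u′ i))
        (λ i → trans (first-at (λ i → u i + 1# * u′ i) v i) (sym (+-cong (first-at u v i) (*-congˡ (first-at u′ v i)))))
        where
        off : ∀ u u′ i j → j ≢ inject₁ a → (X [ inject₁ a ≔ u ] [ suc a ≔ v ]) i j ≈ (X [ inject₁ a ≔ u′ ] [ suc a ≔ v ]) i j
        off u u′ i j j≢ with j Fin.≟ suc a
        ... | yes ≡.refl = trans (≔-at (X [ inject₁ a ≔ u ]) (suc a) v i) (sym (≔-at (X [ inject₁ a ≔ u′ ]) (suc a) v i))
        ... | no j≢′     = others u u′ v v i j j≢ j≢′

      F-linearʳ : ∀ u v v′ → F u (λ i → v i + 1# * v′ i) ≈ F u v + 1# * F u v′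
      F-linearʳ u v v′ = det-≔-linear 1# (X [ inject₁ a ≔ u ]) (suc a) v v′ (λ i → v i + 1# * v′ i) (λ i → refl)

      -- Polarization: `F` vanishes at (u + v, u + v), at (u, u) and at (v, v), so `F u v` and
      -- `F v u` are opposite. Additivity in each argument is the case r = 1 of column linearity,
      -- whence the factors `1#`.
      swap : ∀ u v → F v u ≈ 0# → F u v ≈ 0#
      swap u v e = begin
        F u v
          ≈⟨ trans (+-cong (trans (+-identityˡ _) (*-identityˡ _)) (trans (*-identityˡ _) (trans (+-identityˡ _) (*-identityˡ _)))) (+-identityʳ _) ⟨
        (0# + 1# * F u v) + 1# * (0# + 1# * 0#)
          ≈⟨ +-cong (+-congʳ (F-diagonal u)) (*-congˡ (+-cong e (*-congˡ (F-diagonal v)))) ⟨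
        (F u u + 1# * F u v) + 1# * (F v u + 1# * F v v)
          ≈⟨ +-cong (F-linearʳ u u v) (*-congˡ (F-linearʳ v u v)) ⟨
        F u (λ i → u i + 1# * v i) + 1# * F v (λ i → u i + 1# * v i)
          ≈⟨ F-linearˡ u v (λ i → u i + 1# * v i) ⟨
        F (λ i → u i + 1# * v i) (λ i → u i + 1# * v i)
          ≈⟨ F-diagonal (λ i → u i + 1# * v i) ⟩
        0# ∎

    -- Exchanging column l with its left neighbour brings the equal columns one step closer and
    -- preserves the vanishing of the determinant.
    alternating-by-distance : ∀ d {n} (X : Matrix n) k l → toℕ l ≡ suc d ℕ.+ toℕ k → (∀ i → X i k ≈ X i l) → det X ≈ 0#
    alternating-by-distance zero    X k (suc a) dist e = det-alternating-adjacent X a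
      (λ i → trans (reflexive (≡.cong (X i) (Fin.toℕ-injective (≡.trans (Fin.toℕ-inject₁ a) (ℕ.suc-injective dist))))) (e i))
    alternating-by-distance (suc d) X k (suc a) dist e = trans (det-cong (λ i j → sym (restore i j)))
      (swap u v (alternating-by-distance d (X [ inject₁ a ≔ v ] [ suc a ≔ u ]) k (inject₁ a)
        (≡.trans (Fin.toℕ-inject₁ a) (ℕ.suc-injective dist))
        (λ i → trans (trans (≔-off (X [ inject₁ a ≔ v ]) (suc a) u i k k≢suc) (≔-off X (inject₁ a) v i k k≢inject₁))
          (trans (e i) (sym (first-at v u i))))))
      where
      open Swap X a
      u v : _ → Carrier
      u i = X i (inject₁ a)
      v i = X i (suc a)
      k<a : toℕ k ℕ.< toℕ a
      k<a = ≡.subst (toℕ k ℕ.<_) (≡.sym (ℕ.suc-injective dist)) (ℕ.s≤s (ℕ.m≤n+m (toℕ k) d))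
      k≢inject₁ : k ≢ inject₁ a
      k≢inject₁ k≡ = ℕ.<⇒≢ k<a (≡.trans (≡.cong toℕ k≡) (Fin.toℕ-inject₁ a))
      k≢suc : k ≢ suc a
      k≢suc k≡ = ℕ.<⇒≢ (ℕ.m<n⇒m<1+n k<a) (≡.cong toℕ k≡)
      restore : X [ inject₁ a ≔ u ] [ suc a ≔ v ] ≋ X
      restore i j with j Fin.≟ suc a | j Fin.≟ inject₁ a
      ... | yes ≡.refl | _          = ≔-at (X [ inject₁ a ≔ u ]) (suc a) v i
      ... | no _       | yes ≡.refl = first-at u v i
      ... | no j≢′     | no j≢      = trans (≔-off (X [ inject₁ a ≔ u ]) (suc a) v i j j≢′) (≔-off X (inject₁ a) u i j j≢)

  det-alternating : ∀ {n} (X : Matrix n) k l → k ≢ l → (∀ i → X i k ≈ X i l) → det X ≈ 0#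
  det-alternating X k l k≢l e with ℕ.<-cmp (toℕ k) (toℕ l)
  ... | tri< k<l _ _ = alternating-by-distance _ X k l (distance k<l) e
  ... | tri≈ _ k≡l _ = ⊥-elim (k≢l (Fin.toℕ-injective k≡l))
  ... | tri> _ _ l<k = alternating-by-distance _ X l k (distance l<k) (λ i → sym (e i))

  -- The substituted column is a combination of the columns of W, and each of its terms with l
  -- different from k repeats a column.
  cramer : ∀ {n} (W : Matrix n) (y : Fin n → Carrier) k → det (W [ k ≔ (λ i → sum λ l → y l * W i l) ]) ≈ y k * det W
  cramer {n} W y k = begin
    det (W [ k ≔ (λ i → sum λ l → y l * W i l) ])
      ≈⟨ expand y (λ l i → W i l) ⟩
    sum (λ l → y l * det (W [ k ≔ (λ i → W i l) ]))
      ≈⟨ sum-single (λ l l≢k → trans (*-congˡ (det-alternating (W [ k ≔ (λ i → W i l) ]) k l (λ k≡l → l≢k (≡.sym k≡l))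
           (λ i → trans (≔-at W k (λ i → W i l) i) (sym (≔-off W k (λ i → W i l) i l l≢k))))) (zeroʳ _)) ⟩
    y k * det (W [ k ≔ (λ i → W i k) ])
      ≈⟨ *-congˡ (det-cong restore) ⟩
    y k * det W ∎
    where
    zeroColumn : det (W [ k ≔ (λ _ → 0#) ]) ≈ 0#
    zeroColumn = begin
      det (W [ k ≔ (λ _ → 0#) ])
        -- Linearity for 0 = 0 + (-1) 0 equates the determinant with its difference from itself.
        ≈⟨ det-≔-linear (- 1#) W k (λ _ → 0#) (λ _ → 0#) (λ _ → 0#) (λ _ → sym (trans (+-identityˡ _) (zeroʳ _))) ⟩
      det (W [ k ≔ (λ _ → 0#) ]) + - 1# * det (W [ k ≔ (λ _ → 0#) ])
        ≈⟨ trans (+-congˡ (-1*x≈-x _)) (-‿inverseʳ _) ⟩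
      0# ∎

    expand : ∀ {m} (y : Fin m → Carrier) (v : Fin m → Fin n → Carrier) →
             det (W [ k ≔ (λ i → sum λ l → y l * v l i) ]) ≈ sum (λ l → y l * det (W [ k ≔ v l ]))
    expand {zero}  y v = zeroColumn
    expand {suc m} y v = trans
      (det-≔-linear (y zero) W k (λ i → sum λ l → y (suc l) * v (suc l) i) (v zero) _ (λ i → +-comm _ _))
      (trans (+-comm _ _) (+-congˡ (expand (λ l → y (suc l)) (λ l → v (suc l)))))

    sum-single : ∀ {m} {v : Fin m → Carrier} {k} → (∀ l → l ≢ k → v l ≈ 0#) → sum v ≈ v k
    sum-single {suc m} {k = zero}  e = trans (+-congˡ (sum-zero (λ l → e (suc l) (λ ())))) (+-identityʳ _)
    sum-single {suc m} {k = suc k} e = trans (+-cong (e zero (λ ()))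
      (sum-single {k = k} (λ l l≢k → e (suc l) (λ sl≡ → l≢k (Fin.suc-injective sl≡))))) (+-identityˡ _)

    restore : W [ k ≔ (λ i → W i k) ] ≋ W
    restore i j with j Fin.≟ k
    ... | yes ≡.refl = ≔-at W k (λ i → W i k) i
    ... | no j≢k     = ≔-off W k (λ i → W i k) i j j≢k

-- Injective self-maps of finite sets, and residues modulo p

injective⇒surjective : ∀ {m} (f : Fin m → Fin m) → (∀ {x y} → f x ≡ f y → x ≡ y) → ∀ y → ∃[ x ] f x ≡ y
injective⇒surjective {suc m} f inj y with Fin.any? (λ x → f x Fin.≟ y)
... | yes found = found
-- A missed value would let `punchOut` squeeze `Fin (suc m)` injectively into `Fin m`.
... | no y∉     = ⊥-elim (ℕ.1+n≰n (Fin.injective⇒≤ {f = λ x → punchOut (y≢ x)} (λ e → inj (Fin.punchOut-injective (y≢ _) (y≢ _) e))))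
  where
  y≢ : ∀ x → y ≢ f x
  y≢ x y≡fx = y∉ (x , ≡.sym y≡fx)

funToFin-cong : ∀ {m n} {f g : Fin m → Fin n} → (∀ i → f i ≡ g i) → funToFin f ≡ funToFin g
funToFin-cong {zero}  e = ≡.refl
funToFin-cong {suc m} e = ≡.cong₂ combine (e zero) (funToFin-cong (λ i → e (suc i)))

-- Digit vectors are numbered by `Fin (p ^ d)`, where the pigeonhole principle applies; equality of
-- vectors is pointwise throughout.
pointwise-surjective : ∀ {d p} (f : (Fin d → Fin p) → Fin d → Fin p) →
  (∀ a b → (∀ k → f a k ≡ f b k) → ∀ k → a k ≡ b k) → ∀ b → ∃[ a ] (∀ k → f a k ≡ b k)
pointwise-surjective {d} {p} f f-inj b with injective⇒surjective (λ i → funToFin (f (finToFun i))) inj (funToFin b)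
  where
  inj : ∀ {i j : Fin (p ℕ.^ d)} → funToFin (f (finToFun i)) ≡ funToFin (f (finToFun j)) → i ≡ j
  inj {i} {j} e = ≡.trans (≡.sym (Fin.funToFin-finToFin {d} i)) (≡.trans (funToFin-cong (f-inj (finToFun i) (finToFun j) (λ k →
    ≡.trans (≡.sym (Fin.finToFun-funToFin (f (finToFun i)) k)) (≡.trans (≡.cong (λ n → finToFun {p} {d} n k) e)
      (Fin.finToFun-funToFin (f (finToFun j)) k)))))
    (Fin.funToFin-finToFin {d} j))
... | i , e = finToFun i , λ k → ≡.trans (≡.sym (Fin.finToFun-funToFin (f (finToFun i)) k))
  (≡.trans (≡.cong (λ n → finToFun {p} {d} n k) e) (Fin.finToFun-funToFin b k))

residue-injective : ∀ {p} (i j : Fin p) → + p ℤD.∣ + toℕ i ℤ.- + toℕ j → i ≡ j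
residue-injective {p} i j p∣ = Fin.toℕ-injective (ℤ.+-injective (ℤ.i-j≡0⇒i≡j (+ toℕ i) (+ toℕ j) (ℤ.∣i∣≡0⇒i≡0 (small _ bound p∣))))
  where
  small : ∀ n → n ℕ.< p → p ℕD.∣ n → n ≡ 0
  small zero    _   _   = ≡.refl
  small (suc n) n<p p∣n = ⊥-elim (ℕD.>⇒∤ n<p p∣n)
  bound : ℤ.∣ + toℕ i ℤ.- + toℕ j ∣ ℕ.< p
  bound = ℕ.≤-<-trans (≡.subst (ℕ._≤ toℕ i ℕ.⊔ toℕ j) (≡.cong ℤ.∣_∣ (≡.sym (ℤ.m-n≡m⊖n (toℕ i) (toℕ j)))) (ℤ.∣m⊝n∣≤m⊔n (toℕ i) (toℕ j)))
                      (ℕ.⊔-pres-<m (Fin.toℕ<n i) (Fin.toℕ<n j))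

-- Perfectness of 𝒪/p from the discriminant

module _ (A : CommutativeRing c ℓ) {p : ℕ} (p-prime : Prime p) where
  open RingOps A
  open FrobeniusCongruences A p-prime
  open Exp commutativeSemiring using (^-distrib-*)
  private
    module P = Congruence A (multiples A p)
    open Ideal (multiples A p)

  -- The preimage in A of the kernel of Frobenius on A/p.
  p-radical : Ideal A (c ⊔ ℓ)
  p-radical = record
    { Mem      = λ x → ∃[ w ] x ^ p ≈ p · w
    ; Mem-resp = λ x≈y → Mem-resp (^-congˡ p x≈y)
    ; 0-mem    = Mem-resp (sym 0^p) 0-mem
    ; +-mem    = λ {x} {y} x∈ y∈ → Mem-resp (solve 2 (λ u v → (u :- v) :+ v := u) refl ((x + y) ^ p) (x ^ p + y ^ p))
                   (+-mem (frobenius-+ x y) (+-mem x∈ y∈))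
    ; *-mem    = λ x {y} y∈ → Mem-resp (sym (^-distrib-* x y p)) (*-mem (x ^ p) y∈)
    }
    where open IntegerRing A

module _ (A : CommutativeRing c ℓ) {p : ℕ} (p-prime : Prime p) {d : ℕ} where
  open RingOps A
  open Ideal (p-radical A p-prime) using (Mem; Mem-resp; +-mem; *-mem)

  -- If p does not divide the discriminant, then 𝒪/p is reduced by Cramer's rule; being finite, it is perfect.
  module Perfect
    (ω : Fin d → Carrier) (spanning : ∀ y → Σ[ r ∈ (Fin d → ℤ) ] y ≈ sum (λ k → r k ⋆ ω k))
    (τ : Fin d → Hom A A)
    (D : ℤ) (disc : D ⋆ 1# ≈ det (λ i j → ⟦ τ i ⟧ (ω j)) ^ 2) (p∤D : ¬ + p ℤD.∣ D)
    (contract : ∀ k → Mem (k ⋆ 1#) → + p ℤD.∣ k)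
    where

    open IntegerRing A
    open Determinant A
    open FrobeniusCongruences A p-prime
    open Sum semiring using (∑-distrib-+; *-distribˡ-sum)
    private
      module P = Congruence A (multiples A p)
      instance _ = prime⇒nonZero p-prime

      W : Matrix d
      W i j = ⟦ τ i ⟧ (ω j)

      combination : (Fin d → ℤ) → Carrier
      combination r = sum λ k → (r k ⋆ 1#) * ω k

      combination-difference : ∀ r s → combination (λ k → r k ℤ.- s k) ≈ combination r - combination s
      combination-difference r s = begin
        combination (λ k → r k ℤ.- s k)
          ≈⟨ sum-cong-≋ (λ k → trans (*-congʳ (trans (⋆1-+ (r k) (ℤ.- s k)) (+-congˡ (⋆1-neg (s k)))))
               (solve 3 (λ r s w → (r :- s) :* w := r :* w :+ :- :con ℤ.1ℤ :* (s :* w)) refl (r k ⋆ 1#) (s k ⋆ 1#) (ω k))) ⟩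
        sum (λ k → (r k ⋆ 1#) * ω k + - (ℤ.1ℤ ⋆ 1#) * ((s k ⋆ 1#) * ω k))
          ≈⟨ trans (∑-distrib-+ (λ k → (r k ⋆ 1#) * ω k) (λ k → - (ℤ.1ℤ ⋆ 1#) * ((s k ⋆ 1#) * ω k)))
               (+-congˡ (sym (*-distribˡ-sum _ (λ k → (s k ⋆ 1#) * ω k)))) ⟩
        combination r + - (ℤ.1ℤ ⋆ 1#) * combination s
          ≈⟨ solve 2 (λ u v → u :+ :- :con ℤ.1ℤ :* v := u :- v) refl _ _ ⟩
        combination r - combination s ∎
        where open SetoidReasoning setoid

      -- The conjugates of the element stay in the radical, and they are the entries of W applied to
      -- the coordinates r. Cramer's rule puts `r k` times the discriminant into the radical; this
      -- is an integer, so p divides it, and p does not divide D.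
      reduced : ∀ r → Mem (combination r) → ∀ k → + p ℤD.∣ r k
      reduced r (w , e) k = split (euclidsLemma ℤ.∣ r k ∣ ℤ.∣ D ∣ p-prime (≡.subst (p ℕD.∣_) (ℤ.abs-* (r k) D) p∣rD))
        where
        split : p ℕD.∣ ℤ.∣ r k ∣ ⊎ p ℕD.∣ ℤ.∣ D ∣ → p ℕD.∣ ℤ.∣ r k ∣
        split (inj₁ p∣r) = p∣r
        split (inj₂ p∣D) = ⊥-elim (p∤D p∣D)

        u : Fin d → Carrier
        u i = sum λ l → (r l ⋆ 1#) * W i l

        u≈ : ∀ i → ⟦ τ i ⟧ (combination r) ≈ u i
        u≈ i = trans (sum-homo (λ l → (r l ⋆ 1#) * ω l)) (sum-cong-≋ λ l → trans (*-homo _ _)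
          (*-congʳ (trans (⋆-homo (r l) 1#) (⋆-congʳ (r l) 1#-homo))))
          where
          open HomProperties A A (τ i)
          ⋆-congʳ : ∀ k {x y} → x ≈ y → k ⋆ x ≈ k ⋆ y
          ⋆-congʳ k x≈y = trans (⋆-as-* k _) (trans (*-congˡ x≈y) (sym (⋆-as-* k _)))

        u∈ : ∀ i → Mem (u i)
        u∈ i = Mem-resp (u≈ i) (⟦ τ i ⟧ w , trans (sym (^-homo (combination r) p)) (trans (⟦⟧-cong e) (·-homo p w)))
          where open HomProperties A A (τ i)

        p∣rD : + p ℤD.∣ r k ℤ.* D
        p∣rD = contract (r k ℤ.* D) (Mem-resp (begin
          -- The additional factor `det W` completes the square, turning a possibly non-rational
          -- determinant into the integer D.
          det W * det (W [ k ≔ u ])             ≈⟨ *-congˡ (cramer W (λ l → r l ⋆ 1#) k) ⟩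
          det W * ((r k ⋆ 1#) * det W)          ≈⟨ solve 2 (λ w r → w :* (r :* w) := r :* (w :^ 2)) refl (det W) (r k ⋆ 1#) ⟩
          (r k ⋆ 1#) * det W ^ 2                ≈⟨ *-congˡ disc ⟨
          (r k ⋆ 1#) * (D ⋆ 1#)                 ≈⟨ ⋆1-* (r k) D ⟨
          (r k ℤ.* D) ⋆ 1#                      ∎)
          (*-mem (det W) (det-column-mem (p-radical A p-prime) (W [ k ≔ u ]) k
            (λ i → Mem-resp (sym (reflexive (Vector.updateAt-updates k (W i)))) (u∈ i)))))
          where open SetoidReasoning setoid

      lift : (Fin d → Fin p) → Carrier
      lift a = combination (λ k → + toℕ (a k))

      -- By additivity of Frobenius the difference of the two lifts lies in the radical, so its
      -- coordinates are divisible by p; as differences of digits below p they are zero.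
      lift-injective : ∀ a b → lift a ^ p ≡ lift b ^ p [mod p ] → ∀ k → a k ≡ b k
      lift-injective a b e k = residue-injective (a k) (b k) (reduced (λ k → + toℕ (a k) ℤ.- + toℕ (b k))
        (Mem-resp (sym (combination-difference (λ k → + toℕ (a k)) (λ k → + toℕ (b k)))) difference∈) k)
        where
        x = lift a
        y = lift b
        difference∈ : Mem (x - y)
        difference∈ = Ideal.Mem-resp (multiples A p) (solve 1 (λ z → z :- :con ℤ.0ℤ := z) refl _) (begin
          (x - y) ^ p                        ≈⟨ P.≈⇒∼ (solve 2 (λ u v → u := (u :+ v) :- v) refl _ (y ^ p)) ⟩
          (x - y) ^ p + y ^ p - y ^ p        ≈⟨ P.Q.+-congʳ {x = - (y ^ p)} (frobenius-+ (x - y) y) ⟨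
          (x - y + y) ^ p - y ^ p            ≈⟨ P.≈⇒∼ (+-congʳ (^-congˡ p (solve 2 (λ x y → x :- y :+ y := x) refl x y))) ⟩
          x ^ p - y ^ p                      ≈⟨ P.Q.+-congʳ {x = - (y ^ p)} e ⟩
          y ^ p - y ^ p                      ≈⟨ P.≈⇒∼ (-‿inverseʳ (y ^ p)) ⟩
          0#                                 ∎)
          where open SetoidReasoning P.Q.setoid

      reduce : Carrier → Fin d → Fin p
      reduce y k = fromℕ< (ℤ.n%ℕd<d (proj₁ (spanning y) k) p)

      lift-reduce : ∀ y → y ≡ lift (reduce y) [mod p ]
      lift-reduce y = P.Q.trans (P.≈⇒∼ (proj₂ (spanning y))) (P.sum-∼ (λ k → digit (r k) (ω k)))
        where
        r = proj₁ (spanning y)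
        digit : ∀ n x → n ⋆ x ≡ (toℕ (fromℕ< (ℤ.n%ℕd<d n p)) · 1#) * x [mod p ]
        digit n x = ((n ℤ./ℕ p) ⋆ 1#) * x , (begin
          n ⋆ x - (toℕ (fromℕ< (ℤ.n%ℕd<d n p)) · 1#) * x
            ≈⟨ +-cong (trans (⋆-as-* n x) (*-congʳ (trans (reflexive (≡.cong (_⋆ 1#) (ℤ.a≡a%ℕn+[a/ℕn]*n n p)))
                 (trans (⋆1-+ (+ (n ℤ.%ℕ p)) ((n ℤ./ℕ p) ℤ.* + p)) (+-congˡ (⋆1-* (n ℤ./ℕ p) (+ p)))))))
                 (-‿cong (*-congʳ (reflexive (≡.cong (_· 1#) (Fin.toℕ-fromℕ< (ℤ.n%ℕd<d n p)))))) ⟩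
          (((n ℤ.%ℕ p) · 1#) + ((n ℤ./ℕ p) ⋆ 1#) * (p · 1#)) * x - ((n ℤ.%ℕ p) · 1#) * x
            ≈⟨ solve 4 (λ r q p x → (r :+ q :* p) :* x :- r :* x := p :* (q :* x)) refl ((n ℤ.%ℕ p) · 1#) ((n ℤ./ℕ p) ⋆ 1#) (p · 1#) x ⟩
          (p · 1#) * (((n ℤ./ℕ p) ⋆ 1#) * x)
            ≈⟨ ·-as-* p _ ⟨
          p · (((n ℤ./ℕ p) ⋆ 1#) * x) ∎)
          where open SetoidReasoning setoid

      -- Frobenius of A/p in terms of the digits with respect to ω, a self-map of a finite set.
      frobenius : (Fin d → Fin p) → Fin d → Fin p
      frobenius a = reduce (lift a ^ p)

      lift-cong : ∀ {a b} → (∀ k → a k ≡ b k) → lift a ≈ lift b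
      lift-cong e = sum-cong-≋ λ k → *-congʳ (reflexive (≡.cong (λ i → toℕ i · 1#) (e k)))

      frobenius-injective : ∀ a b → (∀ k → frobenius a k ≡ frobenius b k) → ∀ k → a k ≡ b k
      frobenius-injective a b e = lift-injective a b (P.Q.trans (lift-reduce (lift a ^ p))
        (P.Q.trans (P.≈⇒∼ (lift-cong e)) (P.Q.sym (lift-reduce (lift b ^ p)))))

      frobenius-hits : ∀ b → ∃[ a ] (∀ k → frobenius a k ≡ b k)
      frobenius-hits = pointwise-surjective frobenius frobenius-injective

    frobenius-surjective : ∀ y → ∃[ s ] y ≡ s ^ p [mod p ]
    frobenius-surjective y = lift digits , P.Q.trans (lift-reduce y) (P.Q.trans
      (P.≈⇒∼ (lift-cong (λ k → ≡.sym (proj₂ (frobenius-hits (reduce y)) k)))) (P.Q.sym (lift-reduce (lift digits ^ p))))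
      where
      digits = proj₁ (frobenius-hits (reduce y))

-- Functoriality of localization, completion and polynomial rings

module _ (A : CommutativeRing c ℓ) {l} (S : MulSubset A l) where
  private
    open RingOps A
    module S = MulSubset S

    invert : ∀ y t t∈ s∈ → FractionEq A S (frac (y * t) (t * 1#) s∈) (frac y 1# t∈)
    invert y t t∈ s∈ = cross 1# S.1-mem (*-congˡ (trans (*-identityʳ _) (*-congˡ (sym (*-identityʳ t)))))

    unit : ∀ t s∈ → FractionEq A S (frac (t * 1#) (1# * t) s∈) (frac 1# 1# S.1-mem)
    unit t s∈ = cross 1# S.1-mem (*-congˡ (trans (*-identityʳ _) (trans (*-comm t 1#) (sym (*-identityˡ _)))))

    unit′ : ∀ t s∈ → FractionEq A S (frac (1# * t) (t * 1#) s∈) (frac 1# 1# S.1-mem)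
    unit′ t s∈ = cross 1# S.1-mem (*-congˡ (trans (*-identityʳ _) (*-congˡ (sym (*-identityʳ t)))))

  private module L = CommutativeRing (Localization A S)

  opaque
    unfolding Localization

    -- Presents y as n over t together with an inverse of t, for arguments in which the localization
    -- remains opaque.
    clear-denominator : ∀ y → Σ[ n ∈ Carrier ] Σ[ t ∈ Carrier ] Σ[ v ∈ L.Carrier ] S.Mem t
      × y L.* ⟦ toLocalization A S ⟧ t L.≈ ⟦ toLocalization A S ⟧ n
      × ⟦ toLocalization A S ⟧ t L.* v L.≈ L.1#
    clear-denominator (frac n t t∈) = n , t , frac 1# t t∈ , t∈ , invert n t _ _ , unit t _

    fraction-inverse : ∀ t t∈ → fraction A S 1# t t∈ L.* ⟦ toLocalization A S ⟧ t L.≈ L.1#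
    fraction-inverse t t∈ = unit′ t _

module _ (A : CommutativeRing a ℓ₁) {l} (S : MulSubset A l) where
  private
    open RingOps A
    module S = MulSubset S

  fraction-cong : ∀ {x y s t s∈ t∈} → x ≈ y → s ≈ t → FractionEq A S (frac x s s∈) (frac y t t∈)
  fraction-cong x≈y s≈t = cross 1# S.1-mem (*-congˡ (*-cong x≈y (sym s≈t)))

module _ (A : CommutativeRing a ℓ₁) (B : CommutativeRing b ℓ₂) {l m} (S : MulSubset A l) (T : MulSubset B m) where
  private
    module B = CommutativeRing B

  opaque
    unfolding mapLocalization

    mapLocalization-to : (f : Hom A B) (S⇒T : ∀ {x} → MulSubset.Mem S x → MulSubset.Mem T (⟦ f ⟧ x)) → ∀ x →
      CommutativeRing._≈_ (Localization B T) (⟦ mapLocalization A B S T f S⇒T ⟧ (⟦ toLocalization A S ⟧ x))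
                                             (⟦ toLocalization B T ⟧ (⟦ f ⟧ x))
    mapLocalization-to f S⇒T x = fraction-cong B T B.refl (RingHomomorphism.1#-homo f)

    -- Fractions carry proofs about their denominators, which equality ignores. The inclusion inside
    -- `from𝒪[1/M]` is local to that definition, and this lemma identifies it with the one rebuilt
    -- below.
    mapLocalization-irrelevant : (f : Hom A B) (S⇒T S⇒T′ : ∀ {x} → MulSubset.Mem S x → MulSubset.Mem T (⟦ f ⟧ x)) → ∀ x →
      CommutativeRing._≈_ (Localization B T) (⟦ mapLocalization A B S T f S⇒T ⟧ x) (⟦ mapLocalization A B S T f S⇒T′ ⟧ x)
    mapLocalization-irrelevant f S⇒T S⇒T′ (frac x s s∈) = fraction-cong B T B.refl B.refl

module _ (A : CommutativeRing a ℓ₁) (B : CommutativeRing b ℓ₂) {l m} (S : MulSubset A l) (T : MulSubset B m)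
         (f : Hom A B) (S⇒T : ∀ {x} → MulSubset.Mem S x → MulSubset.Mem T (⟦ f ⟧ x))
         (g : Hom B A) (T⇒S : ∀ {x} → MulSubset.Mem T x → MulSubset.Mem S (⟦ g ⟧ x)) where

  opaque
    unfolding mapLocalization

    mapLocalization-inverse : (∀ x → CommutativeRing._≈_ A (⟦ g ⟧ (⟦ f ⟧ x)) x) → ∀ x →
      CommutativeRing._≈_ (Localization A S)
        (⟦ mapLocalization B A T S g T⇒S ⟧ (⟦ mapLocalization A B S T f S⇒T ⟧ x)) x
    mapLocalization-inverse g∘f≈id (frac x s s∈) = fraction-cong A S (g∘f≈id x) (g∘f≈id s)

module _ (A : CommutativeRing a ℓ₁) {l m r} (S : MulSubset A l) (T : MulSubset A m) (U : MulSubset A r) (f : Hom A A)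
         (S⇒S : ∀ {x} → MulSubset.Mem S x → MulSubset.Mem S (⟦ f ⟧ x))
         (T⇒U : ∀ {x} → MulSubset.Mem T x → MulSubset.Mem U (⟦ f ⟧ x))
         (S⇒T : ∀ {x} → MulSubset.Mem S x → MulSubset.Mem T x)
         (S⇒U : ∀ {x} → MulSubset.Mem S x → MulSubset.Mem U x) where

  opaque
    unfolding mapLocalization

    mapLocalization-natural : ∀ x →
      CommutativeRing._≈_ (Localization A U)
        (⟦ mapLocalization A A T U f T⇒U ⟧ (⟦ mapLocalization A A S T (idHom A) S⇒T ⟧ x))
        (⟦ mapLocalization A A S U (idHom A) S⇒U ⟧ (⟦ mapLocalization A A S S f S⇒S ⟧ x))
    mapLocalization-natural (frac x s s∈) = fraction-cong A U (CommutativeRing.refl A) (CommutativeRing.refl A)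

  -- The form in which gauge invariance is used: an element fixed in the common localization has
  -- images in the two finer ones that correspond under the automorphism.
  mapLocalization-fixed : ∀ {x} → CommutativeRing._≈_ (Localization A S) (⟦ mapLocalization A A S S f S⇒S ⟧ x) x →
    CommutativeRing._≈_ (Localization A U)
      (⟦ mapLocalization A A T U f T⇒U ⟧ (⟦ mapLocalization A A S T (idHom A) S⇒T ⟧ x))
      (⟦ mapLocalization A A S U (idHom A) S⇒U ⟧ x)
  mapLocalization-fixed {x} fx≈x = CommutativeRing.trans (Localization A U) (mapLocalization-natural x)
    (RingHomomorphism.⟦⟧-cong (mapLocalization A A S U (idHom A) S⇒U) fx≈x)

module _ (A : CommutativeRing a ℓ₁) (B : CommutativeRing b ℓ₂) (p : ℕ) (f : Hom A B) where
  private
    module B = CommutativeRing B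

    levels : ∀ {x y} → (∀ k → PAdic.term x k B.≈ PAdic.term y k) → PAdicEq B p x y
    levels e = levelwise λ k → CongruenceProperties.mod-reflexive B (p ℕ.^ k) (e k)

  opaque
    unfolding mapCompletion

    mapCompletion-to : ∀ x → CommutativeRing._≈_ (Completion B p)
      (⟦ mapCompletion A B p f ⟧ (⟦ toCompletion A p ⟧ x)) (⟦ toCompletion B p ⟧ (⟦ f ⟧ x))
    mapCompletion-to x = levels λ k → B.refl

module _ (A : CommutativeRing a ℓ₁) (B : CommutativeRing b ℓ₂) (p : ℕ) (f : Hom A B) (g : Hom B A) where
  private
    module A = CommutativeRing A

    levels : ∀ {x y} → (∀ k → PAdic.term x k A.≈ PAdic.term y k) → PAdicEq A p x y
    levels e = levelwise λ k → CongruenceProperties.mod-reflexive A (p ℕ.^ k) (e k)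

  opaque
    unfolding mapCompletion

    mapCompletion-inverse : (∀ x → ⟦ g ⟧ (⟦ f ⟧ x) A.≈ x) → ∀ x → CommutativeRing._≈_ (Completion A p)
      (⟦ mapCompletion B A p g ⟧ (⟦ mapCompletion A B p f ⟧ x)) x
    mapCompletion-inverse g∘f≈id x = levels λ k → g∘f≈id (PAdic.term x k)

module _ (A : CommutativeRing a ℓ₁) (B : CommutativeRing b ℓ₂) (V : Set) (f : Hom A B) where
  opaque
    unfolding mapPolynomial

    mapPolynomial-con : ∀ r → ⟦ mapPolynomial A B V f ⟧ (⟦ toPolynomial A V ⟧ r) ≡ ⟦ toPolynomial B V ⟧ (⟦ f ⟧ r)
    mapPolynomial-con r = ≡.refl

    mapPolynomial-X : ∀ v → ⟦ mapPolynomial A B V f ⟧ (X A V v) ≡ X B V v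
    mapPolynomial-X v = ≡.refl

module _ (A : CommutativeRing a ℓ₁) (B : CommutativeRing b ℓ₂) (V : Set) (f : Hom A B) (g : Hom B A) where
  private
    module A = CommutativeRing A
    A[V] = Polynomial A V
    B[V] = Polynomial B V
    module A[V] = CommutativeRing A[V]
    f[V] = mapPolynomial A B V f
    g[V] = mapPolynomial B A V g

  mapPolynomial-inverse : (∀ x → ⟦ g ⟧ (⟦ f ⟧ x) A.≈ x) → ∀ e → ⟦ g[V] ⟧ (⟦ f[V] ⟧ e) A[V].≈ e
  mapPolynomial-inverse g∘f≈id = polynomial-hom-ext A A[V] V (composeHom A[V] B[V] A[V] g[V] f[V]) (idHom A[V])
    (λ r → A[V].trans (A[V].reflexive (≡.trans (≡.cong ⟦ g[V] ⟧ (mapPolynomial-con A B V f r)) (mapPolynomial-con B A V g (⟦ f ⟧ r))))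
             (RingHomomorphism.⟦⟧-cong (toPolynomial A V) (g∘f≈id r)))
    (λ v → A[V].reflexive (≡.trans (≡.cong ⟦ g[V] ⟧ (mapPolynomial-X A B V f v)) (mapPolynomial-X B A V g v)))

module _ (A : CommutativeRing a ℓ₁) (B : CommutativeRing b ℓ₂) (n p : ℕ) (f : Hom A B) where
  private
    module B̂ = CommutativeRing (𝒪Ĝ B n p)

    fromPolynomial-cong : ∀ {e e′} → CommutativeRing._≈_ (R[x] B n) e e′ → fromPolynomial B n p e B̂.≈ fromPolynomial B n p e′
    fromPolynomial-cong e≈e′ = RingHomomorphism.⟦⟧-cong (toCompletion (𝒪G B n) p)
      (RingHomomorphism.⟦⟧-cong (toLocalization (R[x] B n) (detPowers B n)) e≈e′)

    map-fromPolynomial : ∀ e → ⟦ map𝒪Ĝ A B n f p ⟧ (fromPolynomial A n p e) B̂.≈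
                               fromPolynomial B n p (⟦ mapPolynomial A B (Indeterminate n) f ⟧ e)
    map-fromPolynomial e = B̂.trans (mapCompletion-to (𝒪G A n) (𝒪G B n) p _ _)
      (RingHomomorphism.⟦⟧-cong (toCompletion (𝒪G B n) p) (mapLocalization-to (R[x] A n) (R[x] B n) (detPowers A n) (detPowers B n) _ _ e))

  map𝒪Ĝ-coordinate : ∀ j k → ⟦ map𝒪Ĝ A B n f p ⟧ (coordinate A n p j k) B̂.≈ coordinate B n p j k
  map𝒪Ĝ-coordinate j k = B̂.trans (map-fromPolynomial (generic A n j k))
    (B̂.reflexive (≡.cong (fromPolynomial B n p) (mapPolynomial-X A B (Indeterminate n) f (j , k))))

  map𝒪Ĝ-scalar : ∀ r → ⟦ map𝒪Ĝ A B n f p ⟧ (scalar A n p r) B̂.≈ scalar B n p (⟦ f ⟧ r)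
  map𝒪Ĝ-scalar r = B̂.trans (map-fromPolynomial (⟦ toPolynomial A (Indeterminate n) ⟧ r))
    (B̂.reflexive (≡.cong (fromPolynomial B n p) (mapPolynomial-con A B (Indeterminate n) f r)))

  map𝒪Ĝ-scalar-≈ : ∀ {r r′} → CommutativeRing._≈_ B (⟦ f ⟧ r) r′ → ⟦ map𝒪Ĝ A B n f p ⟧ (scalar A n p r) B̂.≈ scalar B n p r′
  map𝒪Ĝ-scalar-≈ {r} fr≈r′ = B̂.trans (map𝒪Ĝ-scalar r)
    (fromPolynomial-cong (RingHomomorphism.⟦⟧-cong (toPolynomial B (Indeterminate n)) fr≈r′))

  map𝒪Ĝ-inverse : (g : Hom B A) → (∀ x → CommutativeRing._≈_ A (⟦ g ⟧ (⟦ f ⟧ x)) x) → ∀ x →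
    CommutativeRing._≈_ (𝒪Ĝ A n p) (⟦ map𝒪Ĝ B A n g p ⟧ (⟦ map𝒪Ĝ A B n f p ⟧ x)) x
  map𝒪Ĝ-inverse g g∘f≈id = mapCompletion-inverse (𝒪G A n) (𝒪G B n) p _ _
    (mapLocalization-inverse (R[x] A n) (R[x] B n) (detPowers A n) (detPowers B n) _ _ _ _
      (mapPolynomial-inverse A B (Indeterminate n) f g g∘f≈id))

module _ (A : CommutativeRing a ℓ₁) (n : ℕ) {p : ℕ} where

  𝒪Ĝ-torsionFree : TorsionFree A p → TorsionFree (𝒪Ĝ A n p) p
  𝒪Ĝ-torsionFree tf = completion-torsionFree (𝒪G A n) (localization-torsionFree (R[x] A n) (detPowers A n) {p}
    (polynomial-torsionFree A p (λ { (i , j) → combine i j }) (remQuot n) (λ { (i , j) → Fin.remQuot-combine i j }) tf))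

  scalarHom : Hom A (𝒪Ĝ A n p)
  scalarHom = composeHom A (𝒪G A n) (𝒪Ĝ A n p) (toCompletion (𝒪G A n) p)
    (composeHom A (R[x] A n) (𝒪G A n) (toLocalization (R[x] A n) (detPowers A n)) (toPolynomial A (Indeterminate n)))

-- Uniqueness of Frobenius lifts modulo p²

frobeniusHom : (A : CommutativeRing c ℓ) {p : ℕ} → PDerivation A p → Hom A A
frobeniusHom A d = record { ⟦_⟧ = PDerivation.φ d ; isRingHomomorphism = proj₁ (PDerivation.attached-isFrobeniusLift d) }

module _ (A : CommutativeRing a ℓ₁) (B : CommutativeRing b ℓ₂) (f : Hom A B) where
  private
    module A = RingOps A
    module B = RingOps B
    open HomProperties A B f

  mod-homo : ∀ m {x y} → x A.≡ y [mod m ] → ⟦ f ⟧ x B.≡ ⟦ f ⟧ y [mod m ]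
  mod-homo m {x} {y} (z , e) = ⟦ f ⟧ z ,
    B.trans (B.+-congˡ (B.sym (-‿homo y))) (B.trans (B.sym (+-homo x _)) (B.trans (⟦⟧-cong e) (·-homo m z)))

  ⊗-homo : ∀ {n} (X Y : A.Matrix n) → mapᴹ ⟦ f ⟧ (X A.⊗ Y) B.≋ mapᴹ ⟦ f ⟧ X B.⊗ mapᴹ ⟦ f ⟧ Y
  ⊗-homo X Y j k = B.trans (sum-homo (λ l → X j l A.* Y l k)) (B.sum-cong-≋ λ l → *-homo (X j l) (Y l k))

  triple-homo : ∀ {n} (u q v : A.Matrix n) →
    mapᴹ ⟦ f ⟧ (u A.ᵗ A.⊗ q A.⊗ v) B.≋ mapᴹ ⟦ f ⟧ u B.ᵗ B.⊗ mapᴹ ⟦ f ⟧ q B.⊗ mapᴹ ⟦ f ⟧ v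
  triple-homo u q v j k = B.trans (⊗-homo (u A.ᵗ A.⊗ q) v j k)
    (TripleProduct.⊗-cong B {Y = mapᴹ ⟦ f ⟧ v} (⊗-homo (u A.ᵗ) q) (λ _ _ → B.refl) j k)

  -- Powers of an integer have the same image under all homomorphisms; in particular Frobenius lifts
  -- fix the denominators of 𝒪[1/M].
  integer-power-homo : ∀ k n {u} → u A.≈ (k A.⋆ A.1#) A.^ n → ⟦ f ⟧ u B.≈ (k B.⋆ B.1#) B.^ n
  integer-power-homo k n u≈ = B.trans (⟦⟧-cong u≈) (B.trans (^-homo _ n) (B.^-congˡ n (B.trans (⋆-homo k A.1#)
    (B.trans (B⋆ k (⟦ f ⟧ A.1#)) (B.trans (B.*-congˡ 1#-homo) (B.*-identityʳ _))))))
    where B⋆ = IntegerRing.⋆-as-* B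

module LiftUniqueness (A : CommutativeRing a ℓ₁) {p : ℕ} (p-prime : Prime p) (O : CommutativeRing b ℓ₂) (κ : Hom O A)
  (perfect : ∀ y → ∃[ s ] RingOps._≡_[mod_] O y (RingOps._^_ O s p) p) where
  private
    module O = RingOps O
    module κ = HomProperties O A κ
    open RingOps A
    open IntegerRing A
    open FrobeniusCongruences A p-prime
    module P² = Congruence A (multiples A (p ℕ.* p))

    -- The right side does not involve `F`: the lift of s is needed only mod p because it is raised
    -- to the power p, and that of t only mod p because it is multiplied by p.
    value : ∀ (F : Hom A A) → (∀ z → ⟦ F ⟧ z ≡ z ^ p [mod p ]) → ∀ {y s t} → y O.- s O.^ p O.≈ p O.· t →
            ⟦ F ⟧ (⟦ κ ⟧ y) ≡ (⟦ κ ⟧ s ^ p) ^ p + (p · 1#) * ⟦ κ ⟧ t ^ p [mod p ℕ.* p ]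
    value F F-lift {y} {s} {t} e = begin
      ⟦ F ⟧ (⟦ κ ⟧ y)
        ≈⟨ P².≈⇒∼ (F.⟦⟧-cong (κ.⟦⟧-cong (O.trans (IntegerRing.solve O 2 (λ y z → y :=ᴼ z +ᴼ (y -ᴼ z)) O.refl y (s O.^ p)) (O.+-congˡ e)))) ⟩
      ⟦ F ⟧ (⟦ κ ⟧ (s O.^ p O.+ p O.· t))
        ≈⟨ P².≈⇒∼ (F.⟦⟧-cong (trans (κ.+-homo _ _) (+-cong (κ.^-homo s p) (κ.·-homo p t)))) ⟩
      ⟦ F ⟧ (⟦ κ ⟧ s ^ p + p · ⟦ κ ⟧ t)
        ≈⟨ P².≈⇒∼ (trans (F.+-homo _ _) (+-cong (F.^-homo (⟦ κ ⟧ s) p) (trans (F.·-homo p (⟦ κ ⟧ t)) (·-as-* p _)))) ⟩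
      ⟦ F ⟧ (⟦ κ ⟧ s) ^ p + (p · 1#) * ⟦ F ⟧ (⟦ κ ⟧ t)
        ≈⟨ P².Q.+-cong (^p-lift (F-lift (⟦ κ ⟧ s))) (scale-p (F-lift (⟦ κ ⟧ t))) ⟩
      (⟦ κ ⟧ s ^ p) ^ p + (p · 1#) * ⟦ κ ⟧ t ^ p ∎
      where
      module F = HomProperties A A F
      open SetoidReasoning P².Q.setoid
      open IntegerRing O using () renaming (_:=_ to _:=ᴼ_; _:+_ to _+ᴼ_; _:-_ to _-ᴼ_)

  module _ (F G : Hom A A) (F-lift : ∀ z → ⟦ F ⟧ z ≡ z ^ p [mod p ]) (G-lift : ∀ z → ⟦ G ⟧ z ≡ z ^ p [mod p ]) where

    lifts-agree : ∀ y → ⟦ F ⟧ (⟦ κ ⟧ y) ≡ ⟦ G ⟧ (⟦ κ ⟧ y) [mod p ℕ.* p ]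
    lifts-agree y = P².Q.trans (value F F-lift e) (P².Q.sym (value G G-lift e))
      where e = proj₂ (proj₂ (perfect y))

    -- A homomorphism fixing t takes y to the image of n times the same inverse v, so agreement on n
    -- is enough.
    lifts-agree-fraction : ∀ {y n t v} → y * ⟦ κ ⟧ t ≈ ⟦ κ ⟧ n → ⟦ κ ⟧ t * v ≈ 1# →
      ⟦ F ⟧ (⟦ κ ⟧ t) ≈ ⟦ κ ⟧ t → ⟦ G ⟧ (⟦ κ ⟧ t) ≈ ⟦ κ ⟧ t → ⟦ F ⟧ y ≡ ⟦ G ⟧ y [mod p ℕ.* p ]
    lifts-agree-fraction {y} {n} {t} {v} yt≈n tv≈1 Ft≈t Gt≈t = P².Q.trans (P².≈⇒∼ (clear F Ft≈t))
      (P².Q.trans (P².Q.*-congʳ {x = v} (lifts-agree n)) (P².≈⇒∼ (sym (clear G Gt≈t))))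
      where
      clear : ∀ (H : Hom A A) → ⟦ H ⟧ (⟦ κ ⟧ t) ≈ ⟦ κ ⟧ t → ⟦ H ⟧ y ≈ ⟦ H ⟧ (⟦ κ ⟧ n) * v
      clear H Ht≈t = begin
        ⟦ H ⟧ y                              ≈⟨ *-identityʳ _ ⟨
        ⟦ H ⟧ y * 1#                         ≈⟨ *-congˡ tv≈1 ⟨
        ⟦ H ⟧ y * (⟦ κ ⟧ t * v)              ≈⟨ *-assoc _ _ _ ⟨
        ⟦ H ⟧ y * ⟦ κ ⟧ t * v                ≈⟨ *-congʳ (*-congˡ Ht≈t) ⟨
        ⟦ H ⟧ y * ⟦ H ⟧ (⟦ κ ⟧ t) * v        ≈⟨ *-congʳ (H.*-homo y (⟦ κ ⟧ t)) ⟨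
        ⟦ H ⟧ (y * ⟦ κ ⟧ t) * v              ≈⟨ *-congʳ (H.⟦⟧-cong yt≈n) ⟩
        ⟦ H ⟧ (⟦ κ ⟧ n) * v                  ∎
        where
        module H = HomProperties A A H
        open SetoidReasoning setoid

module _ (A : CommutativeRing a ℓ₁) {p : ℕ} (p-prime : Prime p) (O : CommutativeRing b ℓ₂)
  (perfect : ∀ y → ∃[ s ] RingOps._≡_[mod_] O y (RingOps._^_ O s p) p) (M : ℤ)
  (h : Hom (Localization O (powers O (RingOps._⋆_ O M (CommutativeRing.1# O)))) A) where
  private
    module A = RingOps A
    S = powers O (RingOps._⋆_ O M (CommutativeRing.1# O))
    open HomProperties (Localization O S) A h

    κ : Hom O A
    κ = composeHom O (Localization O S) A h (toLocalization O S)

    fixed : (G : Hom A A) → ∀ {t} → MulSubset.Mem S t → ⟦ G ⟧ (⟦ κ ⟧ t) A.≈ ⟦ κ ⟧ t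
    fixed G (e , t≈) = A.trans (integer-power-homo O A (composeHom O A A G κ) M e t≈) (A.sym (integer-power-homo O A κ M e t≈))

  lifts-agree-inverting : (G H : Hom A A) → (∀ z → ⟦ G ⟧ z A.≡ z A.^ p [mod p ]) → (∀ z → ⟦ H ⟧ z A.≡ z A.^ p [mod p ]) →
    ∀ y → ⟦ G ⟧ (⟦ h ⟧ y) A.≡ ⟦ H ⟧ (⟦ h ⟧ y) [mod p ℕ.* p ]
  lifts-agree-inverting G H G-lift H-lift y with clear-denominator O S y
  ... | n , t , v , t∈ , yt≈n , tv≈1 =
    LiftUniqueness.lifts-agree-fraction A p-prime O κ perfect G H G-lift H-lift
      {v = ⟦ h ⟧ v} (A.trans (A.sym (*-homo y (⟦ toLocalization O S ⟧ t))) (⟦⟧-cong yt≈n))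
      (A.trans (A.sym (*-homo (⟦ toLocalization O S ⟧ t) v)) (A.trans (⟦⟧-cong tv≈1) 1#-homo)) (fixed G t∈) (fixed H t∈)

-- Transport of one p-derivation along an isomorphism

module Conjugation (A : CommutativeRing a ℓ₁) (B : CommutativeRing b ℓ₂) {p n : ℕ}
  (f : Hom A B) (g : Hom B A) (g∘f≈id : ∀ z → CommutativeRing._≈_ A (⟦ g ⟧ (⟦ f ⟧ z)) z)
  (x q : RingOps.Matrix A n) (xᴮ qᴮ : RingOps.Matrix B n)
  (f-x : RingOps._≋_ B (mapᴹ ⟦ f ⟧ x) xᴮ) (f-q : RingOps._≋_ B (mapᴹ ⟦ f ⟧ q) qᴮ)
  (d : PDerivation B p) where
  private
    module A = RingOps A
    module B = RingOps B
    module f = HomProperties A B f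
    module g = HomProperties B A g
    module φ = HomProperties B B (frobeniusHom B d)
    open PDerivation d using (δ; φ)
    open TripleProduct A

    g∘φ : Hom B A
    g∘φ = composeHom B B A g (frobeniusHom B d)

  Φ : Hom A A
  Φ = composeHom A B A g∘φ f

  Φ-lift : ∀ z → ⟦ Φ ⟧ z A.≡ z A.^ p [mod p ]
  Φ-lift z = P.Q.trans (mod-homo B A g p (proj₂ (PDerivation.attached-isFrobeniusLift d) (⟦ f ⟧ z)))
    (P.≈⇒∼ (A.trans (g.^-homo (⟦ f ⟧ z) p) (A.^-congˡ p (g∘f≈id z))))
    where module P = Congruence A (multiples A p)

  private
    transfer : ∀ {X : A.Matrix n} {Xᴮ : B.Matrix n} → mapᴹ ⟦ f ⟧ X B.≋ Xᴮ → mapᴹ ⟦ g ⟧ Xᴮ A.≋ X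
    transfer {X} e j k = A.trans (g.⟦⟧-cong (B.sym (e j k))) (g∘f≈id (X j k))

    transfer-φ : ∀ {X : A.Matrix n} {Xᴮ : B.Matrix n} → mapᴹ ⟦ f ⟧ X B.≋ Xᴮ → mapᴹ ⟦ g∘φ ⟧ Xᴮ A.≋ mapᴹ ⟦ Φ ⟧ X
    transfer-φ e j k = g.⟦⟧-cong (φ.⟦⟧-cong (B.sym (e j k)))

  -- The quotient of Φ(x) - x⁽ᵖ⁾ by p, obtained by transporting δ instead of dividing in A.
  Δ : A.Matrix n
  Δ j k = ⟦ g ⟧ (δ (xᴮ j k))

  Φ-x : ∀ j k → ⟦ Φ ⟧ (x j k) A.≈ x j k A.^ p A.+ p A.· Δ j k
  Φ-x j k = A.trans (A.sym (transfer-φ f-x j k)) (A.trans (g.+-homo _ _)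
    (A.+-cong (A.trans (g.^-homo (xᴮ j k) p) (A.^-congˡ p (transfer f-x j k))) (g.·-homo p (δ (xᴮ j k)))))

  -- Turns torsion freeness, which compares elements coming from two different rings, into an
  -- identity between the matrices Δᵗ Φ(q) x⁽ᵖ⁾ in A.
  christoffel-transport : ∀ j k → ⟦ g ⟧ (christoffel B p xᴮ qᴮ d j k) A.≈
    (Δ A.ᵗ A.⊗ mapᴹ ⟦ Φ ⟧ q A.⊗ x A.⁽ p ⁾) j k
  christoffel-transport j k = A.trans (triple-homo B A g (mapᴹ δ xᴮ) (mapᴹ φ qᴮ) (xᴮ B.⁽ p ⁾) j k)
    (triple-cong {u = Δ} (λ _ _ → A.refl) (transfer-φ f-q)
      (λ a b → A.trans (g.^-homo (xᴮ a b) p) (A.^-congˡ p (transfer f-x a b))) j k)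

  -- The relation between φ, H and φ₀ is evaluated at the coordinates: φ(xᵗqx) = H(φ₀(x)) = H(x⁽ᵖ⁾),
  -- whose entries are the p-th powers of those of xᵗqx.
  metric-transport : ∀ {l m} (R : CommutativeRing l m) ι (dR : PDerivation R p) → IsMetricLift B p xᴮ qᴮ R ι dR d →
    ∀ j k → (mapᴹ ⟦ Φ ⟧ x A.ᵗ A.⊗ mapᴹ ⟦ Φ ⟧ q A.⊗ mapᴹ ⟦ Φ ⟧ x) j k A.≈ (x A.ᵗ A.⊗ q A.⊗ x) j k A.^ p
  metric-transport R ι dR (H , φ₀ , _ , H-x , _ , _ , φ₀-x , φ∘H≈H∘φ₀) j k = begin
    (mapᴹ ⟦ Φ ⟧ x A.ᵗ A.⊗ mapᴹ ⟦ Φ ⟧ q A.⊗ mapᴹ ⟦ Φ ⟧ x) j k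
      ≈⟨ triple-cong (transfer-φ f-x) (transfer-φ f-q) (transfer-φ f-x) j k ⟨
    (mapᴹ ⟦ g∘φ ⟧ xᴮ A.ᵗ A.⊗ mapᴹ ⟦ g∘φ ⟧ qᴮ A.⊗ mapᴹ ⟦ g∘φ ⟧ xᴮ) j k
      ≈⟨ triple-homo B A g∘φ xᴮ qᴮ xᴮ j k ⟨
    ⟦ g ⟧ (φ ((xᴮ B.ᵗ B.⊗ qᴮ B.⊗ xᴮ) j k))
      ≈⟨ g.⟦⟧-cong (φ.⟦⟧-cong (H-x j k)) ⟨
    ⟦ g ⟧ (φ (⟦ H ⟧ (xᴮ j k)))
      ≈⟨ g.⟦⟧-cong (B.trans (φ∘H≈H∘φ₀ (xᴮ j k)) (B.trans (H.⟦⟧-cong (φ₀-x j k)) (B.trans (H.^-homo (xᴮ j k) p) (B.^-congˡ p (H-x j k))))) ⟩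
    ⟦ g ⟧ ((xᴮ B.ᵗ B.⊗ qᴮ B.⊗ xᴮ) j k B.^ p)
      ≈⟨ g.^-homo _ p ⟩
    ⟦ g ⟧ ((xᴮ B.ᵗ B.⊗ qᴮ B.⊗ xᴮ) j k) A.^ p
      ≈⟨ A.^-congˡ p (A.trans (triple-homo B A g xᴮ qᴮ xᴮ j k) (triple-cong (transfer f-x) (transfer f-q) (transfer f-x) j k)) ⟩
    (x A.ᵗ A.⊗ q A.⊗ x) j k A.^ p ∎
    where
    open SetoidReasoning A.setoid
    module H = HomProperties B B H

-- The rings attached to a number field

module OverSetting {π : Level} (S : Setting c ℓ π) where
  open Setting S
  open NumberField K using (F; degree)
  open RingOfIntegers 𝓞
  open IsGalois galois using (aut)
  private
    module F = RingOps F
    module 𝒪 = RingOps 𝒪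
    module ι = HomProperties 𝒪 F embed
    module 𝔓 = PrimeIdeal 𝔓

    ω : Fin degree → 𝒪.Carrier
    ω = proj₁ isDisc

    ω-isBasis : IsBasis 𝒪 𝒪._⋆_ ω
    ω-isBasis = proj₁ (proj₂ isDisc)

    res : Automorphism K → Hom 𝒪 𝒪
    res = restrict K 𝓞

  -- Coordinates in the integral basis are unique, so p times each coordinate is the integer zero.
  𝒪-torsionFree : TorsionFree 𝒪 p
  𝒪-torsionFree y py≈0 = begin
    y                           ≈⟨ y≈ ⟩
    𝒪.sum (λ k → r k 𝒪.⋆ ω k)  ≈⟨ TripleProduct.sum-zero 𝒪 (λ k → 𝒪.reflexive (≡.cong (𝒪._⋆ ω k) (r≡0 k))) ⟩
    𝒪.0#                        ∎
    where
    open SetoidReasoning 𝒪.setoid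
    open IntegerRing 𝒪
    r = proj₁ (proj₁ ω-isBasis y)
    y≈ = proj₂ (proj₁ ω-isBasis y)

    p*r≈0 : 𝒪.sum (λ k → (+ p ℤ.* r k) 𝒪.⋆ ω k) 𝒪.≈ 𝒪.sum (λ k → (+ 0) 𝒪.⋆ ω k)
    p*r≈0 = begin
      𝒪.sum (λ k → (+ p ℤ.* r k) 𝒪.⋆ ω k)
        ≈⟨ 𝒪.sum-cong-≋ (λ k → 𝒪.trans (⋆-as-* (+ p ℤ.* r k) (ω k)) (𝒪.trans (𝒪.*-congʳ (⋆1-* (+ p) (r k)))
             (𝒪.trans (𝒪.*-assoc _ _ _) (𝒪.*-congˡ (𝒪.sym (⋆-as-* (r k) (ω k))))))) ⟩
      𝒪.sum (λ k → (p 𝒪.· 𝒪.1#) 𝒪.* (r k 𝒪.⋆ ω k))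
        ≈⟨ Sum.*-distribˡ-sum 𝒪.semiring (p 𝒪.· 𝒪.1#) (λ k → r k 𝒪.⋆ ω k) ⟨
      (p 𝒪.· 𝒪.1#) 𝒪.* 𝒪.sum (λ k → r k 𝒪.⋆ ω k)
        ≈⟨ 𝒪.trans (𝒪.*-congˡ (𝒪.sym y≈)) (𝒪.trans (𝒪.sym (·-as-* p y)) py≈0) ⟩
      𝒪.0#
        ≈⟨ TripleProduct.sum-zero 𝒪 {degree} {λ _ → 𝒪.0#} (λ _ → 𝒪.refl) ⟨
      𝒪.sum (λ k → (+ 0) 𝒪.⋆ ω k) ∎

    r≡0 : ∀ k → r k ≡ + 0
    r≡0 k with ℤ.i*j≡0⇒i≡0∨j≡0 (+ p) (proj₂ ω-isBasis (λ k → + p ℤ.* r k) (λ _ → + 0) p*r≈0 k)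
    ... | inj₁ p≡0 = ⊥-elim (ℕ.≢-nonZero⁻¹ p {{prime⇒nonZero p-prime}} (ℤ.+-injective p≡0))
    ... | inj₂ e   = e

  private
    -- If p does not divide k, then k and all its powers lie outside 𝔓, whereas an element of p𝒪
    -- lies inside.
    contract : ∀ k → Ideal.Mem (p-radical 𝒪 p-prime) (k 𝒪.⋆ 𝒪.1#) → + p ℤD.∣ k
    contract k (w , e) with p ℕD.∣? ℤ.∣ k ∣
    ... | yes p∣k = p∣k
    ... | no p∤k  = ⊥-elim (power∉ 𝒪 𝔓 p p-prime (int∉ 𝒪 𝔓 p p-prime 𝔓∣p k p∤k) p
      (𝔓.Mem-resp (𝒪.trans (𝒪.*-comm w _) (𝒪.trans (𝒪.sym (IntegerRing.·-as-* 𝒪 p w)) (𝒪.sym e))) (𝔓.*-mem w 𝔓∣p)))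

    discriminant : D 𝒪.⋆ 𝒪.1# 𝒪.≈ 𝒪.det (λ i j → ⟦ res (aut i) ⟧ (ω j)) 𝒪.^ 2
    discriminant = embed-injective (begin
      ⟦ embed ⟧ (D 𝒪.⋆ 𝒪.1#)
        ≈⟨ ι.⋆-homo D 𝒪.1# ⟩
      D F.⋆ ⟦ embed ⟧ 𝒪.1#
        ≈⟨ F.trans (⋆-as-* D _) (F.trans (F.*-congˡ ι.1#-homo) (F.*-identityʳ _)) ⟩
      D F.⋆ F.1#
        ≈⟨ proj₂ (proj₂ isDisc) ⟩
      F.det (λ i j → ⟦ Automorphism.to (aut i) ⟧ (⟦ embed ⟧ (ω j))) F.^ 2
        ≈⟨ F.^-congˡ 2 (Determinant.det-cong F (λ i j → restrict-embed K 𝓞 (aut i) (ω j))) ⟨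
      F.det (mapᴹ ⟦ embed ⟧ (λ i j → ⟦ res (aut i) ⟧ (ω j))) F.^ 2
        ≈⟨ F.^-congˡ 2 (ι.det-homo (λ i j → ⟦ res (aut i) ⟧ (ω j))) ⟨
      ⟦ embed ⟧ (𝒪.det (λ i j → ⟦ res (aut i) ⟧ (ω j))) F.^ 2
        ≈⟨ ι.^-homo _ 2 ⟨
      ⟦ embed ⟧ (𝒪.det (λ i j → ⟦ res (aut i) ⟧ (ω j)) 𝒪.^ 2) ∎)
      where
      open SetoidReasoning F.setoid
      open IntegerRing F using (⋆-as-*)

  𝒪-perfect : ∀ y → ∃[ s ] y 𝒪.≡ s 𝒪.^ p [mod p ]
  𝒪-perfect = Perfect.frobenius-surjective 𝒪 p-prime ω (proj₁ ω-isBasis) (λ i → res (aut i))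
    D discriminant (λ p∣D → p∤M (ℕD.∣-trans p∣D D∣M)) contract

  A : CommutativeRing (c ⊔ ℓ ⊔ π) (c ⊔ ℓ ⊔ π)
  A = Ô S zero

  private
    module A = RingOps A
    module R₀ = CommutativeRing (R S zero)

  Ô-torsionFree : TorsionFree A p
  Ô-torsionFree = 𝒪Ĝ-torsionFree (R S zero) (Size S) (completion-torsionFree (𝒪at S zero)
    (localization-torsionFree 𝒪 (complement 𝒪 (𝔓[_] S zero)) {p} 𝒪-torsionFree))

  private
    𝔓₀∣p : (𝔓[_] S zero) Divides p
    𝔓₀∣p = p 𝒪.· 𝒪.1# , 𝔓∣p , 𝒪.trans (·-homo p 𝒪.1#) (𝒪.×-congʳ p 1#-homo)
      where open HomProperties 𝒪 𝒪 (res (σ zero))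

    σR-inverse : ∀ i r → ⟦ σR⁻¹ S i ⟧ (⟦ σR S i ⟧ r) R₀.≈ r
    σR-inverse i = mapCompletion-inverse (𝒪at S zero) (𝒪at S i) p _ _
      (mapLocalization-inverse 𝒪 𝒪 (complement 𝒪 (𝔓[_] S zero)) (complement 𝒪 (𝔓[_] S i)) _ _ _ _
        (restrict-inverse K 𝓞 (_⁻¹ᴬ K (σ i))))

  σÔ-inverse : ∀ i z → ⟦ σÔ⁻¹ S i ⟧ (⟦ σÔ S i ⟧ z) A.≈ z
  σÔ-inverse i = map𝒪Ĝ-inverse (R S zero) (R S i) (Size S) p (σR S i) (σR⁻¹ S i) (σR-inverse i)

  σÔ-x : ∀ i j k → CommutativeRing._≈_ (Ô S i) (⟦ σÔ S i ⟧ (x[_] S zero j k)) (x[_] S i j k)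
  σÔ-x i = map𝒪Ĝ-coordinate (R S zero) (R S i) (Size S) p (σR S i)

  private
    σR-𝒪[1/M] : ∀ i {y} → CommutativeRing._≈_ (𝒪[1/M] S) (⟦ restrict[1/_] K 𝓞 M (σ i) ⟧ y) y →
      CommutativeRing._≈_ (R S i) (⟦ σR S i ⟧ (from𝒪[1/M] S zero y)) (from𝒪[1/M] S i y)
    σR-𝒪[1/M] i {y} σy≈y = CommutativeRing.trans (R S i) (mapCompletion-to (𝒪at S zero) (𝒪at S i) p _ _)
      (RingHomomorphism.⟦⟧-cong (toCompletion (𝒪at S i) p)
        (mapLocalization-fixed 𝒪 (intPowers K 𝓞 M) (complement 𝒪 (𝔓[_] S zero)) (complement 𝒪 (𝔓[_] S i)) (res (σ i)) _ _ _ _ σy≈y))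

  σÔ-𝒪[1/M] : ∀ i {y} → CommutativeRing._≈_ (𝒪[1/M] S) (⟦ restrict[1/_] K 𝓞 M (σ i) ⟧ y) y →
    CommutativeRing._≈_ (Ô S i) (⟦ σÔ S i ⟧ (fromR S zero (from𝒪[1/M] S zero y))) (fromR S i (from𝒪[1/M] S i y))
  σÔ-𝒪[1/M] i {y} σy≈y =
    map𝒪Ĝ-scalar-≈ (R S zero) (R S i) (Size S) p (σR S i) (σR-𝒪[1/M] i σy≈y)

  private
    inclusion : Hom (𝒪[1/M] S) (𝒪at S zero)
    inclusion = mapLocalization 𝒪 𝒪 (intPowers K 𝓞 M) (complement 𝒪 (𝔓[_] S zero)) (idHom 𝒪)
      λ { (k , e) s∈ → power∉ 𝒪 (𝔓[_] S zero) p p-prime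
            (int∉ 𝒪 (𝔓[_] S zero) p p-prime 𝔓₀∣p M p∤M) k (PrimeIdeal.Mem-resp (𝔓[_] S zero) e s∈) }

    from𝒪at : Hom (𝒪at S zero) A
    from𝒪at = composeHom (𝒪at S zero) (R S zero) A (scalarHom (R S zero) (Size S)) (toCompletion (𝒪at S zero) p)

  -- `fromR` and `from𝒪[1/M]` are bare functions; uniqueness of lifts needs their composite as a
  -- homomorphism.
  structure : Hom (𝒪[1/M] S) A
  structure = composeHom (𝒪[1/M] S) (𝒪at S zero) A from𝒪at inclusion

  structure≈ : ∀ y → fromR S zero (from𝒪[1/M] S zero y) A.≈ ⟦ structure ⟧ y
  structure≈ y = RingHomomorphism.⟦⟧-cong from𝒪at
    (mapLocalization-irrelevant 𝒪 𝒪 (intPowers K 𝓞 M) (complement 𝒪 (𝔓[_] S zero)) (idHom 𝒪) _ _ y)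

  half*2≈1 : half S A.* (A.1# A.+ A.1#) A.≈ A.1#
  half*2≈1 = begin
    half S A.* (A.1# A.+ A.1#)
      ≈⟨ A.*-congˡ two ⟨
    half S A.* ⟦ from𝒪at ⟧ (⟦ to𝒪at ⟧ (2 𝒪.· 𝒪.1#))
      ≈⟨ *-homo _ _ ⟨
    ⟦ from𝒪at ⟧ (CommutativeRing._*_ (𝒪at S zero) (fraction 𝒪 (complement 𝒪 (𝔓[_] S zero)) 𝒪.1# (2 𝒪.· 𝒪.1#) _) (⟦ to𝒪at ⟧ (2 𝒪.· 𝒪.1#)))
      ≈⟨ ⟦⟧-cong (fraction-inverse 𝒪 (complement 𝒪 (𝔓[_] S zero)) (2 𝒪.· 𝒪.1#) _) ⟩
    ⟦ from𝒪at ⟧ (CommutativeRing.1# (𝒪at S zero))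
      ≈⟨ 1#-homo ⟩
    A.1# ∎
    where
    open SetoidReasoning A.setoid
    open HomProperties (𝒪at S zero) A from𝒪at
    to𝒪at : Hom 𝒪 (𝒪at S zero)
    to𝒪at = toLocalization 𝒪 (complement 𝒪 (𝔓[_] S zero))
    module 𝒪→A = HomProperties 𝒪 A (composeHom 𝒪 (𝒪at S zero) A from𝒪at to𝒪at)
    two : ⟦ from𝒪at ⟧ (⟦ to𝒪at ⟧ (2 𝒪.· 𝒪.1#)) A.≈ A.1# A.+ A.1#
    two = A.trans (𝒪→A.·-homo 2 𝒪.1#) (A.+-cong 𝒪→A.1#-homo (A.trans (A.+-identityʳ _) 𝒪→A.1#-homo))

  lifts-agree-on-𝒪[1/M] : (G H : Hom A A) → (∀ z → ⟦ G ⟧ z A.≡ z A.^ p [mod p ]) → (∀ z → ⟦ H ⟧ z A.≡ z A.^ p [mod p ]) →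
    ∀ y → ⟦ G ⟧ (⟦ structure ⟧ y) A.≡ ⟦ H ⟧ (⟦ structure ⟧ y) [mod p ℕ.* p ]
  lifts-agree-on-𝒪[1/M] = lifts-agree-inverting A p-prime 𝒪 𝒪-perfect M structure

-- The Levi-Civita connection satisfies the abstract conditions

module LeviCivita {π : Level} (S : Setting c ℓ π)
  (q : RingOps.Matrix (𝒪[1/M] S) (Size S)) (q-sym : RingOps._≋_ (𝒪[1/M] S) (RingOps._ᵗ (𝒪[1/M] S) q) q)
  (invariant : IsGaugeInvariant S q)
  (∇ : VerticalConnection S) (isMetric : IsMetric S q ∇) (isTorsionFree : IsTorsionFree S q ∇) where
  open Setting S using (p; p-prime)
  open OverSetting S
  private
    module A = RingOps A

    x₁ q₁ δq : A.Matrix (Size S)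
    x₁ = x[_] S zero
    q₁ = q[_] S q zero
    δq j k = PDerivation.δ (Connection.deriv ∇ zero) (q₁ j k)

    module Conj i = Conjugation A (Ô S i) (σÔ S i) (σÔ⁻¹ S i) (σÔ-inverse i)
      x₁ q₁ (x[_] S i) (q[_] S q i) (σÔ-x i) (λ j k → σÔ-𝒪[1/M] i (invariant i j k)) (Connection.deriv ∇ i)

    q₁-sym : q₁ A.ᵗ A.≋ q₁
    q₁-sym j k = A.trans (structure≈ (q k j))
      (A.trans (RingHomomorphism.⟦⟧-cong structure (q-sym j k)) (A.sym (structure≈ (q j k))))

    φ¹ : Hom A A
    φ¹ = frobeniusHom A (Connection.deriv ∇ zero)

    -- φ¹ serves as the common reference: its value at q is q⁽ᵖ⁾ + pδq by definition of the attached
    -- lift, and every conjugate lift agrees with it mod p².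
    Φ-q : ∀ i j k → ⟦ Conj.Φ i ⟧ (q₁ j k) A.≡ q₁ j k A.^ p A.+ p A.· δq j k [mod p ℕ.* p ]
    Φ-q i j k = P².Q.trans (P².≈⇒∼ (RingHomomorphism.⟦⟧-cong (Conj.Φ i) (structure≈ (q j k))))
      (P².Q.trans (lifts-agree-on-𝒪[1/M] (Conj.Φ i) φ¹ (Conj.Φ-lift i)
                    (proj₂ (PDerivation.attached-isFrobeniusLift (Connection.deriv ∇ zero))) (q j k))
                  (P².≈⇒∼ (RingHomomorphism.⟦⟧-cong φ¹ (A.sym (structure≈ (q j k))))))
      where module P² = Congruence A (multiples A (p ℕ.* p))

  module Theorem (T : A.Matrix (Size S)) (isCorrection : IsCorrection A p x₁ q₁ T) = CurvatureCongruence
    A p-prime Ô-torsionFree (half S) half*2≈1 x₁ q₁ δq q₁-sym Conj.Φ Conj.Φ-lift Conj.Δ Conj.Φ-x Φ-q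
    (λ i → Conj.metric-transport i (R S i) (fromR S i) (Connection.base ∇ i) (isMetric i))
    (λ i j k → A.trans (A.sym (Conj.christoffel-transport i j k))
      (A.trans (isTorsionFree i j k) (Conj.christoffel-transport j i k)))
    T isCorrection

corollary3p4 :
  {c ℓ π : Level} (S : Setting c ℓ π) →
  let p = Setting.p S
      n = Size S
      module Q = RingOps (𝒪[1/M] S)
      module Ô¹ = RingOps (Ô S zero)
  in
  (q : Q.Matrix n) → Q.IsInvertible q → (q Q.ᵗ) Q.≋ q →
  IsGaugeInvariant S q →
  (∇ : VerticalConnection S) → IsLeviCivita S q ∇ →
  (φ : Index S → Index S → Ô¹.Carrier → Ô¹.Carrier) → IsCurvature S ∇ φ →
  let x  = x[_] S zero
      q¹ = q[_] S q zero
      δ¹ = Connection.deriv ∇ zero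
      δq = mapᴹ (PDerivation.δ δ¹) q¹
  in
  (T : Ô¹.Matrix n) → IsCorrection (Ô S zero) p x q¹ T →
  let C = C-matrix (Ô S zero) p x q¹ δ¹ T
      Riem = λ i j → lower (Ô S zero) p x q¹ (mapᴹ (φ i j) x)
  in
  (i j m k : Index S) →
    (Riem i j m k Ô¹.≡
      half S Ô¹.* (C i k Ô¹.+ C j m Ô¹.- C j k Ô¹.- C i m) Ô¹.^ p [mod p ])
  × Congruent[p,x-1] (Ô S zero) p x
      (Riem i j m k)
      (half S Ô¹.* (δq j k Ô¹.+ δq i m Ô¹.- δq i k Ô¹.- δq j m) Ô¹.^ p)
corollary3p4 S q _ q-sym invariant ∇ (isMetric , isTorsionFree) φ isCurvature T isCorrection i j m k =
  Riem≡ , Theorem.½C∼½dq T isCorrection i j m k Riem≡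
  where
  open LeviCivita S q q-sym invariant ∇ isMetric isTorsionFree
  Riem≡ = Theorem.Riem≡½C T isCorrection i j (mapᴹ (φ i j) (x[_] S zero)) (λ a b → isCurvature i j (x[_] S zero a b)) m k
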